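{- Fix $n\geqslant3$. There is no function $f$ recursive in the oracle $\emptyset^{(n)}$ (in particular no recursive function) with the following property: whenever $m$ is the Gödel code of a $\Sigma_{n+1}$-formula $\Psi(x)$ such that the theory $\mathcal{T}_\Psi$ axiomatized by $\{\alpha:\mathbb{N}\models\Psi(\ulcorner\alpha\urcorner)\}$ is an $n$-consistent extension of Robinson arithmetic $\mathsf{Q}$, then $f(m)$ is the Gödel code of a $\Pi_{n+1}$-sentence $\sigma$ with $\mathcal{T}_\Psi\nvdash\sigma$ and $\mathcal{T}_\Psi\nvdash\neg\sigma$.
   Context: Work in a fixed first-order language of arithmetic with a fixed standard Gödel numbering; $\ulcorner\alpha\urcorner$ is the Gödel number of $\alpha$, $\overline{k}$ the numeral of $k$, $\mathbb{N}$ the standard model, $\mathsf{Q}$ Robinson arithmetic. The classes $\Sigma_n,\Pi_n$ are the usual arithmetical hierarchy classes. $\emptyset^{(n)}$ is the $n$-th Turing jump of the empty set. $T$ is $n$-consistent if there is no formula $\psi(x)\in\Pi_{n-1}$ with $T\vdash\exists x\,\psi(x)$ and $T\vdash\neg\psi(\overline{k})$ for all $k\in\mathbb{N}$. -}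

module Defs where

open import Data.Nat using (ℕ; zero; suc; _+_; _*_; _^_; _≤_; _∸_)
open import Data.Fin using (Fin; zero; suc; toℕ)
open import Data.Vec using (Vec; []; _∷_)
open import Data.Product using (Σ; _×_; _,_)
open import Data.Empty using (⊥)
open import Relation.Nullary using (¬_)
open import Relation.Binary.PropositionalEquality using (_≡_)

-- Syntax of first-order arithmetic (language 0, S, +, ·, ≤, =),
-- well-scoped de Bruijn style: Term k / Formula k have at most k free
-- variables (variable `zero` is the most recently bound one).

infixl 7 _·'_
infixl 6 _+'_
infix  4 _≐_ _≼_
infixr 3 _∧'_
infixr 2 _∨'_
infixr 1 _⇒'_

data Term (k : ℕ) : Set where
  var  : Fin k → Term k
  zer  : Term k
  S    : Term k → Term k
  _+'_ : Term k → Term k → Term k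
  _·'_ : Term k → Term k → Term k

data Formula (k : ℕ) : Set where
  _≐_  : Term k → Term k → Formula k
  _≼_  : Term k → Term k → Formula k
  ⊥'   : Formula k
  ¬'_  : Formula k → Formula k
  _∧'_ : Formula k → Formula k → Formula k
  _∨'_ : Formula k → Formula k → Formula k
  _⇒'_ : Formula k → Formula k → Formula k
  ∀'   : Formula (suc k) → Formula k
  ∃'   : Formula (suc k) → Formula k

Sentence : Set
Sentence = Formula 0

num : {k : ℕ} → ℕ → Term k
num zero    = zer
num (suc n) = S (num n)

Ren : ℕ → ℕ → Set
Ren k l = Fin k → Fin l

extR : {k l : ℕ} → Ren k l → Ren (suc k) (suc l)
extR ρ zero    = zero
extR ρ (suc i) = suc (ρ i)

renT : {k l : ℕ} → Ren k l → Term k → Term l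
renT ρ (var i)  = var (ρ i)
renT ρ zer      = zer
renT ρ (S t)    = S (renT ρ t)
renT ρ (t +' u) = renT ρ t +' renT ρ u
renT ρ (t ·' u) = renT ρ t ·' renT ρ u

renF : {k l : ℕ} → Ren k l → Formula k → Formula l
renF ρ (t ≐ u)  = renT ρ t ≐ renT ρ u
renF ρ (t ≼ u)  = renT ρ t ≼ renT ρ u
renF ρ ⊥'       = ⊥'
renF ρ (¬' φ)   = ¬' renF ρ φ
renF ρ (φ ∧' ψ) = renF ρ φ ∧' renF ρ ψ
renF ρ (φ ∨' ψ) = renF ρ φ ∨' renF ρ ψ
renF ρ (φ ⇒' ψ) = renF ρ φ ⇒' renF ρ ψ
renF ρ (∀' φ)   = ∀' (renF (extR ρ) φ)
renF ρ (∃' φ)   = ∃' (renF (extR ρ) φ)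

wkT : {k : ℕ} → Term k → Term (suc k)
wkT = renT suc

wkF : {k : ℕ} → Formula k → Formula (suc k)
wkF = renF suc

closedF : {k : ℕ} → Sentence → Formula k
closedF = renF (λ ())

Sub : ℕ → ℕ → Set
Sub k l = Fin k → Term l

extS : {k l : ℕ} → Sub k l → Sub (suc k) (suc l)
extS σ zero    = var zero
extS σ (suc i) = wkT (σ i)

subT : {k l : ℕ} → Sub k l → Term k → Term l
subT σ (var i)  = σ i
subT σ zer      = zer
subT σ (S t)    = S (subT σ t)
subT σ (t +' u) = subT σ t +' subT σ u
subT σ (t ·' u) = subT σ t ·' subT σ u

subF : {k l : ℕ} → Sub k l → Formula k → Formula l
subF σ (t ≐ u)  = subT σ t ≐ subT σ u
subF σ (t ≼ u)  = subT σ t ≼ subT σ u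
subF σ ⊥'       = ⊥'
subF σ (¬' φ)   = ¬' subF σ φ
subF σ (φ ∧' ψ) = subF σ φ ∧' subF σ ψ
subF σ (φ ∨' ψ) = subF σ φ ∨' subF σ ψ
subF σ (φ ⇒' ψ) = subF σ φ ⇒' subF σ ψ
subF σ (∀' φ)   = ∀' (subF (extS σ) φ)
subF σ (∃' φ)   = ∃' (subF (extS σ) φ)

single : {k : ℕ} → Term k → Sub (suc k) k
single t zero    = t
single t (suc i) = var i

_[_] : {k : ℕ} → Formula (suc k) → Term k → Formula k
φ [ t ] = subF (single t) φ

pair : ℕ → ℕ → ℕ
pair a b = 2 ^ a * suc (2 * b)

⌜_⌝ᵗ : {k : ℕ} → Term k → ℕ
⌜ var i ⌝ᵗ  = pair 0 (toℕ i)
⌜ zer ⌝ᵗ    = pair 1 0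
⌜ S t ⌝ᵗ    = pair 2 ⌜ t ⌝ᵗ
⌜ t +' u ⌝ᵗ = pair 3 (pair ⌜ t ⌝ᵗ ⌜ u ⌝ᵗ)
⌜ t ·' u ⌝ᵗ = pair 4 (pair ⌜ t ⌝ᵗ ⌜ u ⌝ᵗ)

⌜_⌝ : {k : ℕ} → Formula k → ℕ
⌜ t ≐ u ⌝  = pair 0 (pair ⌜ t ⌝ᵗ ⌜ u ⌝ᵗ)
⌜ t ≼ u ⌝  = pair 1 (pair ⌜ t ⌝ᵗ ⌜ u ⌝ᵗ)
⌜ ⊥' ⌝     = pair 2 0
⌜ ¬' φ ⌝   = pair 3 ⌜ φ ⌝
⌜ φ ∧' ψ ⌝ = pair 4 (pair ⌜ φ ⌝ ⌜ ψ ⌝)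
⌜ φ ∨' ψ ⌝ = pair 5 (pair ⌜ φ ⌝ ⌜ ψ ⌝)
⌜ φ ⇒' ψ ⌝ = pair 6 (pair ⌜ φ ⌝ ⌜ ψ ⌝)
⌜ ∀' φ ⌝   = pair 7 ⌜ φ ⌝
⌜ ∃' φ ⌝   = pair 8 ⌜ φ ⌝

-- Truth in the standard model ℕ (classical: ∨ and ∃ are read
-- via their classical (double-negation) meaning)

Env : ℕ → Set
Env k = Fin k → ℕ

_∷ᵉ_ : {k : ℕ} → ℕ → Env k → Env (suc k)
(n ∷ᵉ ρ) zero    = n
(n ∷ᵉ ρ) (suc i) = ρ i

⟦_⟧ᵗ : {k : ℕ} → Term k → Env k → ℕ
⟦ var i ⟧ᵗ ρ  = ρ i
⟦ zer ⟧ᵗ ρ    = 0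
⟦ S t ⟧ᵗ ρ    = suc (⟦ t ⟧ᵗ ρ)
⟦ t +' u ⟧ᵗ ρ = ⟦ t ⟧ᵗ ρ + ⟦ u ⟧ᵗ ρ
⟦ t ·' u ⟧ᵗ ρ = ⟦ t ⟧ᵗ ρ * ⟦ u ⟧ᵗ ρ

⟦_⟧ : {k : ℕ} → Formula k → Env k → Set
⟦ t ≐ u ⟧ ρ  = ⟦ t ⟧ᵗ ρ ≡ ⟦ u ⟧ᵗ ρ
⟦ t ≼ u ⟧ ρ  = ⟦ t ⟧ᵗ ρ ≤ ⟦ u ⟧ᵗ ρ
⟦ ⊥' ⟧ ρ     = ⊥
⟦ ¬' φ ⟧ ρ   = ¬ ⟦ φ ⟧ ρ
⟦ φ ∧' ψ ⟧ ρ = ⟦ φ ⟧ ρ × ⟦ ψ ⟧ ρ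
⟦ φ ∨' ψ ⟧ ρ = ¬ (¬ ⟦ φ ⟧ ρ × ¬ ⟦ ψ ⟧ ρ)
⟦ φ ⇒' ψ ⟧ ρ = ⟦ φ ⟧ ρ → ⟦ ψ ⟧ ρ
⟦ ∀' φ ⟧ ρ   = (n : ℕ) → ⟦ φ ⟧ (n ∷ᵉ ρ)
⟦ ∃' φ ⟧ ρ   = ¬ ((n : ℕ) → ¬ ⟦ φ ⟧ (n ∷ᵉ ρ))

_holdsAt_ : Formula 1 → ℕ → Set
Ψ holdsAt m = ⟦ Ψ ⟧ (m ∷ᵉ (λ ()))

data Δ₀ {k : ℕ} : Formula k → Set where
  atom-≐ : (t u : Term k) → Δ₀ (t ≐ u)
  atom-≼ : (t u : Term k) → Δ₀ (t ≼ u)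
  d-⊥    : Δ₀ ⊥'
  d-¬    : {φ : Formula k} → Δ₀ φ → Δ₀ (¬' φ)
  d-∧    : {φ ψ : Formula k} → Δ₀ φ → Δ₀ ψ → Δ₀ (φ ∧' ψ)
  d-∨    : {φ ψ : Formula k} → Δ₀ φ → Δ₀ ψ → Δ₀ (φ ∨' ψ)
  d-⇒    : {φ ψ : Formula k} → Δ₀ φ → Δ₀ ψ → Δ₀ (φ ⇒' ψ)
  d-∀≤   : (t : Term k) {φ : Formula (suc k)} → Δ₀ φ →
           Δ₀ (∀' (var zero ≼ wkT t ⇒' φ))
  d-∃≤   : (t : Term k) {φ : Formula (suc k)} → Δ₀ φ →
           Δ₀ (∃' (var zero ≼ wkT t ∧' φ))

data IsΣ : ℕ → {k : ℕ} → Formula k → Set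
data IsΠ : ℕ → {k : ℕ} → Formula k → Set

data IsΣ where
  σ₀  : {k : ℕ} {φ : Formula k} → Δ₀ φ → IsΣ zero φ
  σΠ  : {n k : ℕ} {φ : Formula k} → IsΠ n φ → IsΣ (suc n) φ
  σ∃  : {n k : ℕ} {φ : Formula (suc k)} → IsΣ (suc n) φ → IsΣ (suc n) (∃' φ)

data IsΠ where
  π₀  : {k : ℕ} {φ : Formula k} → Δ₀ φ → IsΠ zero φ
  πΣ  : {n k : ℕ} {φ : Formula k} → IsΣ n φ → IsΠ (suc n) φ
  π∀  : {n k : ℕ} {φ : Formula (suc k)} → IsΠ (suc n) φ → IsΠ (suc n) (∀' φ)

Theory : Set₁
Theory = Sentence → Set

data Prov (T : Theory) : (k : ℕ) → Formula k → Set where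
  ax     : {k : ℕ} {α : Sentence} → T α → Prov T k (closedF α)
  A1     : {k : ℕ} (A B : Formula k) → Prov T k (A ⇒' (B ⇒' A))
  A2     : {k : ℕ} (A B C : Formula k) →
           Prov T k ((A ⇒' (B ⇒' C)) ⇒' ((A ⇒' B) ⇒' (A ⇒' C)))
  ∧E₁    : {k : ℕ} (A B : Formula k) → Prov T k (A ∧' B ⇒' A)
  ∧E₂    : {k : ℕ} (A B : Formula k) → Prov T k (A ∧' B ⇒' B)
  ∧I     : {k : ℕ} (A B : Formula k) → Prov T k (A ⇒' (B ⇒' A ∧' B))
  ∨I₁    : {k : ℕ} (A B : Formula k) → Prov T k (A ⇒' A ∨' B)
  ∨I₂    : {k : ℕ} (A B : Formula k) → Prov T k (B ⇒' A ∨' B)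
  ∨E     : {k : ℕ} (A B C : Formula k) →
           Prov T k ((A ⇒' C) ⇒' ((B ⇒' C) ⇒' (A ∨' B ⇒' C)))
  ⊥E     : {k : ℕ} (A : Formula k) → Prov T k (⊥' ⇒' A)
  ¬E     : {k : ℕ} (A : Formula k) → Prov T k (¬' A ⇒' (A ⇒' ⊥'))
  ¬I     : {k : ℕ} (A : Formula k) → Prov T k ((A ⇒' ⊥') ⇒' ¬' A)
  DNE    : {k : ℕ} (A : Formula k) → Prov T k (¬' ¬' A ⇒' A)
  ∀E     : {k : ℕ} (φ : Formula (suc k)) (t : Term k) → Prov T k (∀' φ ⇒' φ [ t ])
  ∃I     : {k : ℕ} (φ : Formula (suc k)) (t : Term k) → Prov T k (φ [ t ] ⇒' ∃' φ)
  ∀I     : {k : ℕ} {ψ : Formula k} {φ : Formula (suc k)} →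
           Prov T (suc k) (wkF ψ ⇒' φ) → Prov T k (ψ ⇒' ∀' φ)
  ∃Elim  : {k : ℕ} {ψ : Formula k} {φ : Formula (suc k)} →
           Prov T (suc k) (φ ⇒' wkF ψ) → Prov T k (∃' φ ⇒' ψ)
  ≐refl  : {k : ℕ} (t : Term k) → Prov T k (t ≐ t)
  ≐subst : {k : ℕ} (s t : Term k) (φ : Formula (suc k)) →
           Prov T k (s ≐ t ⇒' (φ [ s ] ⇒' φ [ t ]))
  MP     : {k : ℕ} {A B : Formula k} → Prov T k (A ⇒' B) → Prov T k A → Prov T k B

infix 2 _⊢_
_⊢_ : Theory → Sentence → Set
T ⊢ σ = Prov T 0 σ

private
  x0 : {k : ℕ} → Term (suc k)
  x0 = var zero
  x1 : {k : ℕ} → Term (suc (suc k))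
  x1 = var (suc zero)
  x2 : {k : ℕ} → Term (suc (suc (suc k)))
  x2 = var (suc (suc zero))

data QAxiom : Sentence → Set where
  Q1 : QAxiom (∀' (¬' (S x0 ≐ zer)))
  Q2 : QAxiom (∀' (∀' (S x1 ≐ S x0 ⇒' x1 ≐ x0)))
  Q3 : QAxiom (∀' (¬' (x0 ≐ zer) ⇒' ∃' (x1 ≐ S x0)))
  Q4 : QAxiom (∀' (x0 +' zer ≐ x0))
  Q5 : QAxiom (∀' (∀' (x1 +' S x0 ≐ S (x1 +' x0))))
  Q6 : QAxiom (∀' (x0 ·' zer ≐ zer))
  Q7 : QAxiom (∀' (∀' (x1 ·' S x0 ≐ (x1 ·' x0) +' x1)))
  Q8 : QAxiom (∀' (∀' ((x1 ≼ x0 ⇒' ∃' (x0 +' x2 ≐ x1))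
                     ∧' (∃' (x0 +' x2 ≐ x1) ⇒' x1 ≼ x0))))

ExtendsQ : Theory → Set
ExtendsQ T = (α : Sentence) → QAxiom α → T ⊢ α

_Consistent_ : ℕ → Theory → Set
n Consistent T = ¬ (Σ (Formula 1) λ ψ → IsΠ (n ∸ 1) ψ
                    × (T ⊢ ∃' ψ)
                    × ((k : ℕ) → T ⊢ ¬' (ψ [ num k ])))

T[_] : Formula 1 → Theory
T[ Ψ ] α = Ψ holdsAt ⌜ α ⌝

data Prog : ℕ → Set where
  Z    : {k : ℕ} → Prog k
  Succ : Prog 1
  Proj : {k : ℕ} → Fin k → Prog k
  Comp : {k m : ℕ} → Prog m → Vec (Prog k) m → Prog k
  Rec  : {k : ℕ} → Prog k → Prog (suc (suc k)) → Prog (suc k)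
  Mu   : {k : ℕ} → Prog (suc k) → Prog k
  Orc  : Prog 1

Oracle : Set₁
Oracle = ℕ → Set

data Eval (A : Oracle) : {k : ℕ} → Prog k → Vec ℕ k → ℕ → Set
data EvalV (A : Oracle) : {k m : ℕ} → Vec (Prog k) m → Vec ℕ k → Vec ℕ m → Set

data Eval A where
  eZ    : {k : ℕ} {xs : Vec ℕ k} → Eval A Z xs 0
  eSucc : {x : ℕ} → Eval A Succ (x ∷ []) (suc x)
  eProj : {k : ℕ} {i : Fin k} {xs : Vec ℕ k} → Eval A (Proj i) xs (Data.Vec.lookup xs i)
  eComp : {k m : ℕ} {f : Prog m} {gs : Vec (Prog k) m} {xs : Vec ℕ k} {ys : Vec ℕ m} {y : ℕ} →
          EvalV A gs xs ys → Eval A f ys y → Eval A (Comp f gs) xs y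
  eRec0 : {k : ℕ} {g : Prog k} {h : Prog (suc (suc k))} {xs : Vec ℕ k} {y : ℕ} →
          Eval A g xs y → Eval A (Rec g h) (0 ∷ xs) y
  eRecS : {k : ℕ} {g : Prog k} {h : Prog (suc (suc k))} {xs : Vec ℕ k} {n r y : ℕ} →
          Eval A (Rec g h) (n ∷ xs) r → Eval A h (n ∷ r ∷ xs) y →
          Eval A (Rec g h) (suc n ∷ xs) y
  eMu   : {k : ℕ} {f : Prog (suc k)} {xs : Vec ℕ k} {y : ℕ} →
          Eval A f (y ∷ xs) 0 →
          ((z : ℕ) → suc z ≤ y → Σ ℕ λ v → Eval A f (z ∷ xs) (suc v)) →
          Eval A (Mu f) xs y
  eOrc1 : {q : ℕ} → A q → Eval A Orc (q ∷ []) 1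
  eOrc0 : {q : ℕ} → ¬ A q → Eval A Orc (q ∷ []) 0

data EvalV A where
  []ᵉ  : {k : ℕ} {xs : Vec ℕ k} → EvalV A [] xs []
  _∷ᵉᵛ_ : {k m : ℕ} {g : Prog k} {gs : Vec (Prog k) m} {xs : Vec ℕ k} {y : ℕ} {ys : Vec ℕ m} →
          Eval A g xs y → EvalV A gs xs ys → EvalV A (g ∷ gs) xs (y ∷ ys)

codeP : {k : ℕ} → Prog k → ℕ
codePs : {k m : ℕ} → Vec (Prog k) m → ℕ
codeP {k} Z      = pair 0 k
codeP Succ       = pair 1 0
codeP {k} (Proj i) = pair 2 (pair k (toℕ i))
codeP (Comp f gs) = pair 3 (pair (codeP f) (codePs gs))
codeP (Rec g h)  = pair 4 (pair (codeP g) (codeP h))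
codeP (Mu f)     = pair 5 (codeP f)
codeP Orc        = pair 6 0
codePs []        = 0
codePs (g ∷ gs)  = suc (pair (codeP g) (codePs gs))

jump : Oracle → Oracle
jump A m = Σ (Prog 1) λ e → codeP e ≡ m × Σ ℕ λ y → Eval A e (m ∷ []) y

∅^ : ℕ → Oracle
∅^ zero    = λ _ → ⊥
∅^ (suc n) = jump (∅^ n)

RecursiveIn : Oracle → (ℕ → ℕ) → Set
RecursiveIn A f = Σ (Prog 1) λ P → (m : ℕ) → Eval A P (m ∷ []) (f m)

FindsIndependent : ℕ → (ℕ → ℕ) → Set
FindsIndependent n f =
  (Ψ : Formula 1) → IsΣ (suc n) Ψ → ExtendsQ T[ Ψ ] → n Consistent T[ Ψ ] →
  Σ Sentence λ σ → IsΠ (suc n) σ × f ⌜ Ψ ⌝ ≡ ⌜ σ ⌝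
                 × ¬ (T[ Ψ ] ⊢ σ) × ¬ (T[ Ψ ] ⊢ ¬' σ)

{-# OPTIONS --safe #-}

-- Suppose that f finds independent sentences. Call a sentence y ω-consistent if there is no p such that
-- Q + y proves ∃x p(x) and refutes p(k) for every k. This is a Π₃ property of y, and the graph of f is
-- Σₙ₊₁; as n ≥ 3, diagonalization yields a Σₙ₊₁ formula Ψ such that, for y = f(⌜Ψ⌝), the theory of Ψ is
-- Q + y if y is ω-consistent and Q + ¬y otherwise. In the first case this theory is n-consistent by
-- definition. In the second y is false, since true sentences are ω-consistent, so that Q + ¬y is true
-- in ℕ, hence n-consistent. In both cases the theory decides y.
--
-- Oracle computations, substitution and provability are generated by one finite system of Horn clauses
-- over ℕ. Relative to oracle answers defined by a Πₙ formula its least model is Σₙ₊₁: a derivation is a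
-- finite set of facts, coded by two numbers and checked by a Δ₀ formula.

module Submission where

open import Defs
open import Data.Nat
open import Data.Nat.Properties
open import Data.Fin using (Fin; zero; suc; toℕ; _↑ˡ_; _↑ʳ_; #_; splitAt)
open import Data.Fin.Properties using (toℕ-↑ˡ; toℕ-injective; toℕ<n; splitAt-↑ˡ)
open import Data.Vec using (Vec; []; _∷_; lookup; map; head)
open import Data.Vec.Properties using (lookup-map)
open import Data.Product using (Σ; _×_; _,_; proj₁; proj₂; ∃₂)
open import Data.Sum using (_⊎_; inj₁; inj₂; [_,_])
open import Data.Empty using (⊥; ⊥-elim)
open import Data.Unit using (⊤; tt)
open import Function using (_∘_; id)
open import Relation.Nullary using (¬_; yes; no)
open import Relation.Nullary.Decidable using (decidable-stable; True; toWitness)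
open import Relation.Binary.PropositionalEquality hiding ([_]; J)
open import Data.Nat.Divisibility
open import Data.Nat.Coprimality using (Coprime; coprime-divisor)
import Data.Nat.Coprimality as Coprime
open import Data.Nat.ListAction using (product)
open import Data.Nat.ListAction.Properties using (∈⇒∣product)
open import Data.List using (List; []; _∷_; _++_)
import Data.List as List
open import Data.List.Membership.Propositional using (_∈_)
open import Data.List.Membership.Propositional.Properties using (∈-map⁺; ∈-map⁻; ∈-++⁺ˡ; ∈-++⁺ʳ; ∈-++⁻)
open import Data.List.Membership.DecPropositional _≟_ using (_∈?_)
open import Data.List.Relation.Unary.Any using (here; there)
open import Data.Fin.Patterns
import Data.Vec as Vec
open import Relation.Binary using (tri<; tri≈; tri>)

-- Semantics and soundness

-- Testing ω-consistency instead of n-consistency lets p range over all formulas, so the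
-- arithmetized test does not mention the class Πₙ₋₁; and when the test fails, the falsity of y
-- replaces any proof-theoretic analysis of Q + ¬y. Arithmetized provability is accordingly compared
-- with `Prov` in one direction only: it contains `Prov`, and what it derives from a true sentence
-- is true in ℕ.
--
-- The obstacle is the complexity bound. A computation uses both positive answers of ∅⁽ⁿ⁾, which are
-- Σₙ, and negative ones, which are Πₙ. A positive answer therefore carries a witness of its Σₙ
-- statement as additional arguments, which leaves an inductive definition over a Πₙ base. In the
-- same way the failure of ω-consistency, a Σ₃ statement, carries the formula p.
--
-- The conclusion is a negation and truth in ℕ is stable, so classical case distinctions are made
-- under ¬¬.

infix 1 _⟺_
_⟺_ : Set → Set → Set
A ⟺ B = (A → B) × (B → A)

⟺-trans : {A B C : Set} → A ⟺ B → B ⟺ C → A ⟺ C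
⟺-trans (f , g) (h , k) = h ∘ f , g ∘ k

⟺-sym : {A B : Set} → A ⟺ B → B ⟺ A
⟺-sym (f , g) = g , f

return : {A : Set} → A → ¬ ¬ A
return a k = k a

infixl 1 _>>=_
_>>=_ : {A B : Set} → ¬ ¬ A → (A → ¬ ¬ B) → ¬ ¬ B
(m >>= f) k = m λ a → f a k

excluded-middle : (A : Set) → ¬ ¬ (A ⊎ ¬ A)
excluded-middle A k = k (inj₂ (k ∘ inj₁))

≡-stable : {m n : ℕ} → ¬ ¬ m ≡ n → m ≡ n
≡-stable {m} {n} = decidable-stable (m ≟ n)

-- Atoms are decidable, and ∨ and ∃ are interpreted as negations. This validates `DNE` and turns
-- every argument under ¬¬ into one about truth itself.
stable : {k : ℕ} (φ : Formula k) (ρ : Env k) → ¬ ¬ ⟦ φ ⟧ ρ → ⟦ φ ⟧ ρ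
stable (t ≐ u) ρ h = ≡-stable h
stable (t ≼ u) ρ h = decidable-stable (⟦ t ⟧ᵗ ρ ≤? ⟦ u ⟧ᵗ ρ) h
stable ⊥' ρ h = h id
stable (¬' φ) ρ h x = h λ n → n x
stable (φ ∧' ψ) ρ h = stable φ ρ (λ k → h (k ∘ proj₁)) , stable ψ ρ (λ k → h (k ∘ proj₂))
stable (φ ∨' ψ) ρ h x = h λ n → n x
stable (φ ⇒' ψ) ρ h x = stable ψ ρ λ k → h λ f → k (f x)
stable (∀' φ) ρ h n = stable φ (n ∷ᵉ ρ) λ k → h λ f → k (f n)
stable (∃' φ) ρ h x = h λ n → n x

-- Renaming, substitution and their effect on truth

renT-subT : {k l : ℕ} {r : Ren k l} {σ : Sub k l} → (∀ i → var (r i) ≡ σ i) →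
            ∀ t → renT r t ≡ subT σ t
renT-subT e (var i) = e i
renT-subT e zer = refl
renT-subT e (S t) = cong S (renT-subT e t)
renT-subT e (t +' u) = cong₂ _+'_ (renT-subT e t) (renT-subT e u)
renT-subT e (t ·' u) = cong₂ _·'_ (renT-subT e t) (renT-subT e u)

ext-var : {k l : ℕ} {r : Ren k l} {σ : Sub k l} → (∀ i → var (r i) ≡ σ i) →
          ∀ i → var (extR r i) ≡ extS σ i
ext-var e zero = refl
ext-var e (suc i) = cong wkT (e i)

renF-subF : {k l : ℕ} {r : Ren k l} {σ : Sub k l} → (∀ i → var (r i) ≡ σ i) →
            ∀ φ → renF r φ ≡ subF σ φ
renF-subF e (t ≐ u) = cong₂ _≐_ (renT-subT e t) (renT-subT e u)
renF-subF e (t ≼ u) = cong₂ _≼_ (renT-subT e t) (renT-subT e u)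
renF-subF e ⊥' = refl
renF-subF e (¬' φ) = cong ¬'_ (renF-subF e φ)
renF-subF e (φ ∧' ψ) = cong₂ _∧'_ (renF-subF e φ) (renF-subF e ψ)
renF-subF e (φ ∨' ψ) = cong₂ _∨'_ (renF-subF e φ) (renF-subF e ψ)
renF-subF e (φ ⇒' ψ) = cong₂ _⇒'_ (renF-subF e φ) (renF-subF e ψ)
renF-subF e (∀' φ) = cong ∀' (renF-subF (ext-var e) φ)
renF-subF e (∃' φ) = cong ∃' (renF-subF (ext-var e) φ)

subT-renT : {k l m : ℕ} {r : Ren k l} {σ : Sub l m} {τ : Sub k m} →
            (∀ i → σ (r i) ≡ τ i) → ∀ t → subT σ (renT r t) ≡ subT τ t
subT-renT e (var i) = e i
subT-renT e zer = refl
subT-renT e (S t) = cong S (subT-renT e t)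
subT-renT e (t +' u) = cong₂ _+'_ (subT-renT e t) (subT-renT e u)
subT-renT e (t ·' u) = cong₂ _·'_ (subT-renT e t) (subT-renT e u)

renT-after-subT : {k l m : ℕ} {σ : Sub k l} {r : Ren l m} {τ : Sub k m} →
                  (∀ i → renT r (σ i) ≡ τ i) → ∀ t → renT r (subT σ t) ≡ subT τ t
renT-after-subT e (var i) = e i
renT-after-subT e zer = refl
renT-after-subT e (S t) = cong S (renT-after-subT e t)
renT-after-subT e (t +' u) = cong₂ _+'_ (renT-after-subT e t) (renT-after-subT e u)
renT-after-subT e (t ·' u) = cong₂ _·'_ (renT-after-subT e t) (renT-after-subT e u)

-- `Δ₀` asks for bounds of the literal form `wkT t`; this commutation preserves that form when one
-- substitutes under a bounded quantifier.
subT-wkT : {k l : ℕ} (σ : Sub k l) (t : Term k) → subT (extS σ) (wkT t) ≡ wkT (subT σ t)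
subT-wkT σ t = trans (subT-renT (λ _ → refl) t) (sym (renT-after-subT (λ _ → refl) t))

renT-sem : {k l : ℕ} {r : Ren k l} {ρ : Env l} {ρ′ : Env k} → (∀ i → ρ (r i) ≡ ρ′ i) →
           ∀ t → ⟦ renT r t ⟧ᵗ ρ ≡ ⟦ t ⟧ᵗ ρ′
renT-sem e (var i) = e i
renT-sem e zer = refl
renT-sem e (S t) = cong suc (renT-sem e t)
renT-sem e (t +' u) = cong₂ _+_ (renT-sem e t) (renT-sem e u)
renT-sem e (t ·' u) = cong₂ _*_ (renT-sem e t) (renT-sem e u)

wkT-sem : {k : ℕ} {n : ℕ} {ρ : Env k} (t : Term k) → ⟦ wkT t ⟧ᵗ (n ∷ᵉ ρ) ≡ ⟦ t ⟧ᵗ ρ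
wkT-sem = renT-sem (λ _ → refl)

subT-sem : {k l : ℕ} {σ : Sub k l} {ρ : Env l} {ρ′ : Env k} → (∀ i → ⟦ σ i ⟧ᵗ ρ ≡ ρ′ i) →
           ∀ t → ⟦ subT σ t ⟧ᵗ ρ ≡ ⟦ t ⟧ᵗ ρ′
subT-sem e (var i) = e i
subT-sem e zer = refl
subT-sem e (S t) = cong suc (subT-sem e t)
subT-sem e (t +' u) = cong₂ _+_ (subT-sem e t) (subT-sem e u)
subT-sem e (t ·' u) = cong₂ _*_ (subT-sem e t) (subT-sem e u)

extS-sem : {k l n : ℕ} {σ : Sub k l} {ρ : Env l} {ρ′ : Env k} → (∀ i → ⟦ σ i ⟧ᵗ ρ ≡ ρ′ i) →
           ∀ i → ⟦ extS σ i ⟧ᵗ (n ∷ᵉ ρ) ≡ (n ∷ᵉ ρ′) i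
extS-sem e zero = refl
extS-sem {σ = σ} e (suc i) = trans (wkT-sem (σ i)) (e i)

≡-⟺ : {a b c d : ℕ} (R : ℕ → ℕ → Set) → a ≡ b → c ≡ d → R a c ⟺ R b d
≡-⟺ R refl refl = id , id

∀-⟺ : {P Q : ℕ → Set} → (∀ n → P n ⟺ Q n) → (∀ n → P n) ⟺ (∀ n → Q n)
∀-⟺ e = (λ f n → proj₁ (e n) (f n)) , λ f n → proj₂ (e n) (f n)

¬-⟺ : {A B : Set} → A ⟺ B → ¬ A ⟺ ¬ B
¬-⟺ (f , g) = (_∘ g) , (_∘ f)

×-⟺ : {A B C D : Set} → A ⟺ B → C ⟺ D → (A × C) ⟺ (B × D)
×-⟺ (f , g) (h , k) = (λ { (a , c) → f a , h c }) , λ { (b , d) → g b , k d }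

→-⟺ : {A B C D : Set} → A ⟺ B → C ⟺ D → (A → C) ⟺ (B → D)
→-⟺ (f , g) (h , k) = (λ u b → h (u (g b))) , λ u a → k (u (f a))

subF-sem : {k l : ℕ} {σ : Sub k l} {ρ : Env l} {ρ′ : Env k} → (∀ i → ⟦ σ i ⟧ᵗ ρ ≡ ρ′ i) →
           ∀ φ → ⟦ subF σ φ ⟧ ρ ⟺ ⟦ φ ⟧ ρ′
subF-sem e (t ≐ u) = ≡-⟺ _≡_ (subT-sem e t) (subT-sem e u)
subF-sem e (t ≼ u) = ≡-⟺ _≤_ (subT-sem e t) (subT-sem e u)
subF-sem e ⊥' = id , id
subF-sem e (¬' φ) = ¬-⟺ (subF-sem e φ)
subF-sem e (φ ∧' ψ) = ×-⟺ (subF-sem e φ) (subF-sem e ψ)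
subF-sem e (φ ∨' ψ) = ¬-⟺ (×-⟺ (¬-⟺ (subF-sem e φ)) (¬-⟺ (subF-sem e ψ)))
subF-sem e (φ ⇒' ψ) = →-⟺ (subF-sem e φ) (subF-sem e ψ)
subF-sem e (∀' φ) = ∀-⟺ λ n → subF-sem (extS-sem e) φ
subF-sem e (∃' φ) = ¬-⟺ (∀-⟺ λ n → ¬-⟺ (subF-sem (extS-sem e) φ))

renF-sem : {k l : ℕ} {r : Ren k l} {ρ : Env l} {ρ′ : Env k} → (∀ i → ρ (r i) ≡ ρ′ i) →
           ∀ φ → ⟦ renF r φ ⟧ ρ ⟺ ⟦ φ ⟧ ρ′
renF-sem {r = r} e φ rewrite renF-subF {r = r} {σ = var ∘ r} (λ _ → refl) φ = subF-sem e φ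

-- Environments are functions, so pointwise equality has to be transported by hand; the identity
-- substitution does this through `subF-sem`.
⟦⟧-cong : {k : ℕ} {ρ ρ′ : Env k} → (∀ i → ρ i ≡ ρ′ i) → ∀ φ → ⟦ φ ⟧ ρ ⟺ ⟦ φ ⟧ ρ′
⟦⟧-cong e φ = ⟺-trans (⟺-sym (subF-sem {σ = var} (λ _ → refl) φ)) (subF-sem e φ)

num-sem : {k : ℕ} (n : ℕ) {ρ : Env k} → ⟦ num n ⟧ᵗ ρ ≡ n
num-sem zero = refl
num-sem (suc n) = cong suc (num-sem n)

single-sem : {k : ℕ} (t : Term k) {ρ : Env k} → ∀ i → ⟦ single t i ⟧ᵗ ρ ≡ (⟦ t ⟧ᵗ ρ ∷ᵉ ρ) i
single-sem t zero = refl
single-sem t (suc i) = refl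

wkF-sem : {k : ℕ} {n : ℕ} {ρ : Env k} (φ : Formula k) → ⟦ wkF φ ⟧ (n ∷ᵉ ρ) ⟺ ⟦ φ ⟧ ρ
wkF-sem = renF-sem λ _ → refl

infix 9 _⟨_⟩
_⟨_⟩ : {k l : ℕ} → Formula k → Vec (Term l) k → Formula l
φ ⟨ ts ⟩ = subF (lookup ts) φ

⟨⟩-sem : {k l : ℕ} (φ : Formula k) (ts : Vec (Term l) k) {ρ : Env l} →
         ⟦ φ ⟨ ts ⟩ ⟧ ρ ⟺ ⟦ φ ⟧ (lookup (map (λ t → ⟦ t ⟧ᵗ ρ) ts))
⟨⟩-sem φ ts {ρ} = subF-sem (λ i → sym (lookup-map i (λ t → ⟦ t ⟧ᵗ ρ) ts)) φ

Valid : {k : ℕ} → Formula k → Set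
Valid {k} φ = (ρ : Env k) → ⟦ φ ⟧ ρ

sound : {T : Theory} → (∀ α → T α → Valid α) → {k : ℕ} {φ : Formula k} → Prov T k φ → Valid φ
sound hT (ax {α = α} a) ρ = proj₂ (renF-sem (λ ()) α) (hT α a (λ ()))
sound hT (A1 A B) ρ a b = a
sound hT (A2 A B C) ρ f g a = f a (g a)
sound hT (∧E₁ A B) ρ = proj₁
sound hT (∧E₂ A B) ρ = proj₂
sound hT (∧I A B) ρ = _,_
sound hT (∨I₁ A B) ρ a (na , nb) = na a
sound hT (∨I₂ A B) ρ b (na , nb) = nb b
sound hT (∨E A B C) ρ f g ab = stable C ρ λ k → ab (k ∘ f , k ∘ g)
sound hT (⊥E A) ρ ()
sound hT (¬E A) ρ = id
sound hT (¬I A) ρ = id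
sound hT (DNE A) ρ = stable A ρ
sound hT (∀E φ t) ρ f = proj₂ (subF-sem (single-sem t) φ) (f (⟦ t ⟧ᵗ ρ))
sound hT (∃I φ t) ρ a f = f (⟦ t ⟧ᵗ ρ) (proj₁ (subF-sem (single-sem t) φ) a)
sound hT (∀I {ψ = ψ} d) ρ a n = sound hT d (n ∷ᵉ ρ) (proj₂ (wkF-sem ψ) a)
sound hT (∃Elim {ψ = ψ} d) ρ e =
  stable ψ ρ λ k → e λ n a → k (proj₁ (wkF-sem ψ) (sound hT d (n ∷ᵉ ρ) a))
sound hT (≐refl t) ρ = refl
sound hT (≐subst s t φ) ρ e a =
  proj₂ (subF-sem (λ i → trans (single-sem t i) (cong (λ n → (n ∷ᵉ ρ) i) (sym e))) φ)
    (proj₁ (subF-sem (single-sem s) φ) a)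
sound hT (MP d e) ρ = sound hT d ρ (sound hT e ρ)

Q-valid : ∀ α → QAxiom α → Valid α
Q-valid _ Q1 ρ n ()
Q-valid _ Q2 ρ m n refl = refl
Q-valid _ Q3 ρ zero h = ⊥-elim (h refl)
Q-valid _ Q3 ρ (suc n) h k = k n refl
Q-valid _ Q4 ρ n = +-identityʳ n
Q-valid _ Q5 ρ m n = +-suc m n
Q-valid _ Q6 ρ n = *-zeroʳ n
Q-valid _ Q7 ρ m n = trans (*-suc m n) (+-comm m (m * n))
Q-valid _ Q8 ρ m n =
  (λ m≤n k → k (n ∸ m) (m∸n+n≡m m≤n)) ,
  (λ k → decidable-stable (m ≤? n) λ m≰n → k λ d e → m≰n (subst (m ≤_) e (m≤n+m m d)))

[num]-sem : {k : ℕ} (φ : Formula (suc k)) (n : ℕ) {ρ : Env k} → ⟦ φ [ num n ] ⟧ ρ ⟺ ⟦ φ ⟧ (n ∷ᵉ ρ)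
[num]-sem φ n {ρ} =
  subF-sem (λ i → trans (single-sem (num n) i) (cong (λ m → (m ∷ᵉ ρ) i) (num-sem n))) φ

-- Every element of ℕ is the value of a numeral, so in ℕ a true ∃x ψ(x) cannot have all its numeral
-- instances false.
sound-consistent : (n : ℕ) {T : Theory} → (∀ α → T α → Valid α) → n Consistent T
sound-consistent n hT (ψ , _ , d , e) =
  sound hT d ε λ k a → sound hT (e k) ε (proj₂ ([num]-sem ψ k) a)
  where
  ε : Env 0
  ε ()

-- The arithmetical hierarchy

Δ₀-sub : {k l : ℕ} (σ : Sub k l) {φ : Formula k} → Δ₀ φ → Δ₀ (subF σ φ)
Δ₀-sub σ (atom-≐ t u) = atom-≐ _ _
Δ₀-sub σ (atom-≼ t u) = atom-≼ _ _
Δ₀-sub σ d-⊥ = d-⊥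
Δ₀-sub σ (d-¬ d) = d-¬ (Δ₀-sub σ d)
Δ₀-sub σ (d-∧ d e) = d-∧ (Δ₀-sub σ d) (Δ₀-sub σ e)
Δ₀-sub σ (d-∨ d e) = d-∨ (Δ₀-sub σ d) (Δ₀-sub σ e)
Δ₀-sub σ (d-⇒ d e) = d-⇒ (Δ₀-sub σ d) (Δ₀-sub σ e)
Δ₀-sub σ (d-∀≤ t d) rewrite subT-wkT σ t = d-∀≤ (subT σ t) (Δ₀-sub (extS σ) d)
Δ₀-sub σ (d-∃≤ t d) rewrite subT-wkT σ t = d-∃≤ (subT σ t) (Δ₀-sub (extS σ) d)

IsΣ-sub : {n k l : ℕ} (σ : Sub k l) {φ : Formula k} → IsΣ n φ → IsΣ n (subF σ φ)
IsΠ-sub : {n k l : ℕ} (σ : Sub k l) {φ : Formula k} → IsΠ n φ → IsΠ n (subF σ φ)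
IsΣ-sub σ (σ₀ d) = σ₀ (Δ₀-sub σ d)
IsΣ-sub σ (σΠ p) = σΠ (IsΠ-sub σ p)
IsΣ-sub σ (σ∃ s) = σ∃ (IsΣ-sub (extS σ) s)
IsΠ-sub σ (π₀ d) = π₀ (Δ₀-sub σ d)
IsΠ-sub σ (πΣ s) = πΣ (IsΣ-sub σ s)
IsΠ-sub σ (π∀ p) = π∀ (IsΠ-sub (extS σ) p)

IsΣ-suc : {n k : ℕ} {φ : Formula k} → IsΣ n φ → IsΣ (suc n) φ
IsΠ-suc : {n k : ℕ} {φ : Formula k} → IsΠ n φ → IsΠ (suc n) φ
IsΣ-suc (σ₀ d) = σΠ (π₀ d)
IsΣ-suc (σΠ p) = σΠ (IsΠ-suc p)
IsΣ-suc (σ∃ s) = σ∃ (IsΣ-suc s)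
IsΠ-suc (π₀ d) = πΣ (σ₀ d)
IsΠ-suc (πΣ s) = πΣ (IsΣ-suc s)
IsΠ-suc (π∀ p) = π∀ (IsΠ-suc p)

-- Predicates definable in a class

Pred : ℕ → Set₁
Pred k = Env k → Set

infix 4 _≈_
_≈_ : {k : ℕ} → Pred k → Pred k → Set
P ≈ Q = ∀ ρ → P ρ ⟺ Q ρ

-- The classes are syntactic and admit prenex formulas only; a conjunction of Πₙ formulas, for
-- instance, need not be Πₙ. Complexity is therefore tracked for predicates, up to equivalence of
-- the defining formula.
record Definable {k : ℕ} (C : Formula k → Set) (P : Pred k) : Set where
  constructor def
  field
    formula : Formula k
    class   : C formula
    sem     : ⟦ formula ⟧ ≈ P

open Definable public

Δ-Def : {k : ℕ} → Pred k → Set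
Δ-Def = Definable Δ₀

Σ-Def Π-Def : ℕ → {k : ℕ} → Pred k → Set
Σ-Def n = Definable (IsΣ n)
Π-Def n = Definable (IsΠ n)

conv : {k : ℕ} {C : Formula k → Set} {P Q : Pred k} → P ≈ Q → Definable C P → Definable C Q
conv e (def φ c s) = def φ c λ ρ → ⟺-trans (s ρ) (e ρ)

Definable-stable : {k : ℕ} {C : Formula k → Set} {P : Pred k} → Definable C P →
                   ∀ ρ → ¬ ¬ P ρ → P ρ
Definable-stable (def φ _ s) ρ h = proj₁ (s ρ) (stable φ ρ λ k → h (k ∘ proj₂ (s ρ)))

_[_]ᵖ : {k l : ℕ} → Pred k → Vec (Term l) k → Pred l
(P [ ts ]ᵖ) ρ = P (lookup (map (λ t → ⟦ t ⟧ᵗ ρ) ts))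

substitute : {k l : ℕ} {C : Formula k → Set} {C′ : Formula l → Set} {P : Pred k} →
             (∀ σ {φ} → C φ → C′ (subF σ φ)) →
             Definable C P → (ts : Vec (Term l) k) → Definable C′ (P [ ts ]ᵖ)
substitute sub (def φ c s) ts =
  def (φ ⟨ ts ⟩) (sub (lookup ts) c) λ ρ → ⟺-trans (⟨⟩-sem φ ts) (s _)

Δ-sub : {k l : ℕ} {P : Pred k} → Δ-Def P → (ts : Vec (Term l) k) → Δ-Def (P [ ts ]ᵖ)
Δ-sub = substitute (λ σ → Δ₀-sub σ)

Σ-sub : {n k l : ℕ} {P : Pred k} → Σ-Def n P → (ts : Vec (Term l) k) → Σ-Def n (P [ ts ]ᵖ)
Σ-sub = substitute (λ σ → IsΣ-sub σ)

Π-sub : {n k l : ℕ} {P : Pred k} → Π-Def n P → (ts : Vec (Term l) k) → Π-Def n (P [ ts ]ᵖ)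
Π-sub = substitute (λ σ → IsΠ-sub σ)

infixr 2 _∨ᶜ_
_∨ᶜ_ : Set → Set → Set
A ∨ᶜ B = ¬ (¬ A × ¬ B)

∃ᶜ : (ℕ → Set) → Set
∃ᶜ P = ¬ (∀ n → ¬ P n)

≐Δ : {k : ℕ} (t u : Term k) → Δ-Def (λ ρ → ⟦ t ⟧ᵗ ρ ≡ ⟦ u ⟧ᵗ ρ)
≐Δ t u = def (t ≐ u) (atom-≐ t u) λ ρ → id , id

≼Δ : {k : ℕ} (t u : Term k) → Δ-Def (λ ρ → ⟦ t ⟧ᵗ ρ ≤ ⟦ u ⟧ᵗ ρ)
≼Δ t u = def (t ≼ u) (atom-≼ t u) λ ρ → id , id

¬Δ : {k : ℕ} {P : Pred k} → Δ-Def P → Δ-Def (λ ρ → ¬ P ρ)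
¬Δ (def φ c s) = def (¬' φ) (d-¬ c) λ ρ → ¬-⟺ (s ρ)

×Δ : {k : ℕ} {P Q : Pred k} → Δ-Def P → Δ-Def Q → Δ-Def (λ ρ → P ρ × Q ρ)
×Δ (def φ c s) (def ψ d t) = def (φ ∧' ψ) (d-∧ c d) λ ρ → ×-⟺ (s ρ) (t ρ)

∨Δ : {k : ℕ} {P Q : Pred k} → Δ-Def P → Δ-Def Q → Δ-Def (λ ρ → P ρ ∨ᶜ Q ρ)
∨Δ (def φ c s) (def ψ d t) = def (φ ∨' ψ) (d-∨ c d) λ ρ → ¬-⟺ (×-⟺ (¬-⟺ (s ρ)) (¬-⟺ (t ρ)))

→Δ : {k : ℕ} {P Q : Pred k} → Δ-Def P → Δ-Def Q → Δ-Def (λ ρ → P ρ → Q ρ)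
→Δ (def φ c s) (def ψ d t) = def (φ ⇒' ψ) (d-⇒ c d) λ ρ → →-⟺ (s ρ) (t ρ)

∀≤Δ : {k : ℕ} (t : Term k) {P : Pred (suc k)} → Δ-Def P →
      Δ-Def (λ ρ → ∀ n → n ≤ ⟦ t ⟧ᵗ ρ → P (n ∷ᵉ ρ))
∀≤Δ t (def φ c s) = def (∀' (var zero ≼ wkT t ⇒' φ)) (d-∀≤ t c)
  λ ρ → ∀-⟺ λ n → →-⟺ (≡-⟺ _≤_ refl (wkT-sem t)) (s _)

∃≤Δ : {k : ℕ} (t : Term k) {P : Pred (suc k)} → Δ-Def P →
      Δ-Def (λ ρ → ∃ᶜ λ n → n ≤ ⟦ t ⟧ᵗ ρ × P (n ∷ᵉ ρ))
∃≤Δ t (def φ c s) = def (∃' (var zero ≼ wkT t ∧' φ)) (d-∃≤ t c)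
  λ ρ → ¬-⟺ (∀-⟺ λ n → ¬-⟺ (×-⟺ (≡-⟺ _≤_ refl (wkT-sem t)) (s _)))

Δ₀⇒Π : (n : ℕ) {k : ℕ} {φ : Formula k} → Δ₀ φ → IsΠ n φ
Δ₀⇒Π zero d = π₀ d
Δ₀⇒Π (suc n) d = IsΠ-suc (Δ₀⇒Π n d)

Δ⇒Π : {n k : ℕ} {P : Pred k} → Δ-Def P → Π-Def n P
Δ⇒Π {n} (def φ c s) = def φ (Δ₀⇒Π n c) s

Σ⇒Π : {n k : ℕ} {P : Pred k} → Σ-Def n P → Π-Def (suc n) P
Σ⇒Π (def φ c s) = def φ (πΣ c) s

Π⇒Σ : {n k : ℕ} {P : Pred k} → Π-Def n P → Σ-Def (suc n) P
Π⇒Σ (def φ c s) = def φ (σΠ c) s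

Π-suc : {n k : ℕ} {P : Pred k} → Π-Def n P → Π-Def (suc n) P
Π-suc (def φ c s) = def φ (IsΠ-suc c) s

∀Π : {n k : ℕ} {P : Pred (suc k)} → Π-Def (suc n) P → Π-Def (suc n) (λ ρ → ∀ m → P (m ∷ᵉ ρ))
∀Π (def φ c s) = def (∀' φ) (π∀ c) λ ρ → ∀-⟺ λ n → s _

∃Σ : {n k : ℕ} {P : Pred (suc k)} → Σ-Def (suc n) P → Σ-Def (suc n) (λ ρ → ∃ᶜ λ m → P (m ∷ᵉ ρ))
∃Σ (def φ c s) = def (∃' φ) (σ∃ c) λ ρ → ¬-⟺ (∀-⟺ λ n → ¬-⟺ (s _))

-- Only the quantifier prefix is dualized; on the matrix, negation is a Δ₀ connective.
dualΣ : {n k : ℕ} {φ : Formula k} → IsΣ n φ → Π-Def n (λ ρ → ¬ ⟦ φ ⟧ ρ)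
dualΠ : {n k : ℕ} {φ : Formula k} → IsΠ n φ → Σ-Def n (λ ρ → ¬ ⟦ φ ⟧ ρ)
dualΣ (σ₀ d) = def (¬' _) (π₀ (d-¬ d)) λ ρ → id , id
dualΣ (σΠ p) = Σ⇒Π (dualΠ p)
dualΣ (σ∃ s) = conv (λ ρ → (λ f g → g f) , λ h n x → h λ f → f n x) (∀Π (dualΣ s))
dualΠ (π₀ d) = def (¬' _) (σ₀ (d-¬ d)) λ ρ → id , id
dualΠ (πΣ s) = Π⇒Σ (dualΣ s)
dualΠ (π∀ {φ = φ} p) =
  conv (λ ρ → (λ h f → h λ n x → x (f n)) , λ h g → h λ n → stable φ _ (g n)) (∃Σ (dualΠ p))

¬Π : {n k : ℕ} {P : Pred k} → Π-Def n P → Σ-Def n (λ ρ → ¬ P ρ)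
¬Π (def φ c s) = conv (λ ρ → ¬-⟺ (s ρ)) (dualΠ c)

-- Conjunction and disjunction are brought to prenex form together: quantifiers can be pulled out
-- of either argument in the same way.
data Connective : Set where
  conj disj : Connective

⟪_⟫ : Connective → Set → Set → Set
⟪ conj ⟫ A B = A × B
⟪ disj ⟫ A B = A ∨ᶜ B

⟪⟫-Δ : (c : Connective) {k : ℕ} {φ ψ : Formula k} → Δ₀ φ → Δ₀ ψ → Δ-Def (λ ρ → ⟪ c ⟫ (⟦ φ ⟧ ρ) (⟦ ψ ⟧ ρ))
⟪⟫-Δ conj d e = def _ (d-∧ d e) λ ρ → id , id
⟪⟫-Δ disj d e = def _ (d-∨ d e) λ ρ → id , id

⟪⟫-sym : (c : Connective) {A B : Set} → ⟪ c ⟫ A B ⟺ ⟪ c ⟫ B A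
⟪⟫-sym conj = (λ (a , b) → b , a) , λ (a , b) → b , a
⟪⟫-sym disj = (λ h (a , b) → h (b , a)) , λ h (a , b) → h (b , a)

⟪⟫-cong : (c : Connective) {A B A′ B′ : Set} → A ⟺ A′ → B ⟺ B′ → ⟪ c ⟫ A B ⟺ ⟪ c ⟫ A′ B′
⟪⟫-cong conj e f = ×-⟺ e f
⟪⟫-cong disj e f = ¬-⟺ (×-⟺ (¬-⟺ e) (¬-⟺ f))

∀-pull : (c : Connective) {A : ℕ → Set} {B : Set} → (∀ n → ¬ ¬ A n → A n) →
         (∀ n → ⟪ c ⟫ (A n) B) ⟺ ⟪ c ⟫ (∀ n → A n) B
-- The argument 0 only serves to show that the range of the quantifier is inhabited.
∀-pull conj st = (λ f → (λ n → proj₁ (f n)) , proj₂ (f 0)) , λ (f , b) n → f n , b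
∀-pull disj st = (λ f (g , nb) → g λ n → st n λ na → f n (na , nb)) ,
               λ h n (na , nb) → h ((λ f → na (f n)) , nb)

∃-pull : (c : Connective) {A : ℕ → Set} {B : Set} → (¬ ¬ B → B) →
         (∃ᶜ λ n → ⟪ c ⟫ (A n) B) ⟺ ⟪ c ⟫ (∃ᶜ A) B
∃-pull conj st = (λ h → (λ g → h λ n (a , b) → g n a) , st (λ nb → h λ n (a , b) → nb b)) ,
                λ (h , b) g → h λ n a → g n (a , b)
∃-pull disj st = (λ h (g , nb) → g λ f → h λ n k → k (f n , nb)) ,
               λ h g → h ((λ f → f λ n a → g n λ (na , _) → na a) , λ b → g 0 λ (_ , nb) → nb b)

wk : {k : ℕ} → Sub k (suc k)
wk i = var (suc i)

wk-sem : {k n : ℕ} {ρ : Env k} (φ : Formula k) → ⟦ subF wk φ ⟧ (n ∷ᵉ ρ) ⟺ ⟦ φ ⟧ ρ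
wk-sem = subF-sem λ _ → refl

-- The outer block of the first argument is stripped, then that of the second, and only then does
-- the level drop; so equal blocks merge and the level does not rise. `⟪⟫-ΣΠ` and `⟪⟫-ΠΣ` are the
-- states in which the first block has been stripped and the second has not.
⟪⟫-Π  : (c : Connective) (n : ℕ) {k : ℕ} {φ ψ : Formula k} → IsΠ n φ → IsΠ n ψ →
        Π-Def n (λ ρ → ⟪ c ⟫ (⟦ φ ⟧ ρ) (⟦ ψ ⟧ ρ))
⟪⟫-Σ  : (c : Connective) (n : ℕ) {k : ℕ} {φ ψ : Formula k} → IsΣ n φ → IsΣ n ψ →
        Σ-Def n (λ ρ → ⟪ c ⟫ (⟦ φ ⟧ ρ) (⟦ ψ ⟧ ρ))
⟪⟫-ΣΠ : (c : Connective) (n : ℕ) {k : ℕ} {φ ψ : Formula k} → IsΣ n φ → IsΠ (suc n) ψ →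
        Π-Def (suc n) (λ ρ → ⟪ c ⟫ (⟦ φ ⟧ ρ) (⟦ ψ ⟧ ρ))
⟪⟫-ΠΣ : (c : Connective) (n : ℕ) {k : ℕ} {φ ψ : Formula k} → IsΠ n φ → IsΣ (suc n) ψ →
        Σ-Def (suc n) (λ ρ → ⟪ c ⟫ (⟦ φ ⟧ ρ) (⟦ ψ ⟧ ρ))
⟪⟫-Π c zero (π₀ d) (π₀ e) = Δ⇒Π (⟪⟫-Δ c d e)
⟪⟫-Π c (suc n) (πΣ s) q = ⟪⟫-ΣΠ c n s q
⟪⟫-Π c (suc n) {ψ = ψ} (π∀ {φ = φ} p) q =
  conv (λ ρ → ⟺-trans (∀-⟺ λ m → ⟪⟫-cong c (id , id) (wk-sem ψ)) (∀-pull c λ m → stable φ _))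
    (∀Π (⟪⟫-Π c (suc n) p (IsΠ-sub wk q)))
⟪⟫-ΣΠ c n s (πΣ t) = Σ⇒Π (⟪⟫-Σ c n s t)
⟪⟫-ΣΠ c n {φ = φ} s (π∀ {φ = ψ} q) =
  conv (λ ρ → ⟺-trans (∀-⟺ λ m → ⟺-trans (⟪⟫-cong c (wk-sem φ) (id , id)) (⟪⟫-sym c))
                (⟺-trans (∀-pull c λ m → stable ψ _) (⟪⟫-sym c)))
    (∀Π (⟪⟫-ΣΠ c n (IsΣ-sub wk s) q))
⟪⟫-Σ c zero (σ₀ d) (σ₀ e) = def _ (σ₀ (class (⟪⟫-Δ c d e))) (sem (⟪⟫-Δ c d e))
⟪⟫-Σ c (suc n) (σΠ p) t = ⟪⟫-ΠΣ c n p t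
⟪⟫-Σ c (suc n) {ψ = ψ} (σ∃ {φ = φ} s) t =
  conv (λ ρ → ⟺-trans (¬-⟺ (∀-⟺ λ m → ¬-⟺ (⟪⟫-cong c (id , id) (wk-sem ψ)))) (∃-pull c (stable ψ ρ)))
    (∃Σ (⟪⟫-Σ c (suc n) s (IsΣ-sub wk t)))
⟪⟫-ΠΣ c n p (σΠ q) = Π⇒Σ (⟪⟫-Π c n p q)
⟪⟫-ΠΣ c n {φ = φ} p (σ∃ {φ = ψ} t) =
  conv (λ ρ → ⟺-trans (¬-⟺ (∀-⟺ λ m → ¬-⟺ (⟺-trans (⟪⟫-cong c (wk-sem φ) (id , id)) (⟪⟫-sym c))))
                (⟺-trans (∃-pull c (stable φ ρ)) (⟪⟫-sym c)))
    (∃Σ (⟪⟫-ΠΣ c n (IsΠ-sub wk p) t))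

×Π : {n k : ℕ} {P Q : Pred k} → Π-Def n P → Π-Def n Q → Π-Def n (λ ρ → P ρ × Q ρ)
×Π (def φ c s) (def ψ d t) = conv (λ ρ → ×-⟺ (s ρ) (t ρ)) (⟪⟫-Π conj _ c d)

→Π : {n k : ℕ} {P Q : Pred k} → Δ-Def P → Π-Def n Q → Π-Def n (λ ρ → P ρ → Q ρ)
→Π {n} {P = P} {Q} D E =
  conv (λ ρ → ⟺-trans (⟪⟫-cong disj (sem (¬Δ D) ρ) (sem E ρ))
                ((λ h p → Definable-stable E ρ λ nq → h ((λ np → np p) , nq)) ,
                 λ f (nnp , nq) → nnp λ p → nq (f p)))
    (⟪⟫-Π disj _ (Δ₀⇒Π n (class (¬Δ D))) (class E))

-- At a positive level the bound becomes a Δ₀ antecedent under an ordinary ∀, which Π absorbs; level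
-- 0 has to keep the quantifier bounded. This is why oracle answers are kept Πₙ: checking a
-- derivation places them under bounded universal quantifiers.
∀≤Π : {n k : ℕ} (t : Term k) {P : Pred (suc k)} → Π-Def n P →
      Π-Def n (λ ρ → ∀ m → m ≤ ⟦ t ⟧ᵗ ρ → P (m ∷ᵉ ρ))
∀≤Π {zero} t (def φ (π₀ d) s) = Δ⇒Π (∀≤Δ t (def φ d s))
∀≤Π {suc n} t D =
  conv (λ ρ → ∀-⟺ λ m → →-⟺ (≡-⟺ _≤_ refl (wkT-sem t)) (id , id))
    (∀Π (→Π (≼Δ (var zero) (wkT t)) D))

-- Definability of inductive definitions

-- A finite set of numbers ≤ N is coded by (α , β): its elements are the x with 1 + (x+1)β ∣ α.
-- For β = N! these moduli are pairwise coprime, so that every finite set has a code.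
modulus : ℕ → ℕ → ℕ
modulus β x = suc (suc x * β)

∣n! : (n m : ℕ) → 1 ≤ m → m ≤ n → m ∣ n !
∣n! n (suc m) _ m≤n = ∣-trans (m∣m*n (m !)) (m≤n⇒m!∣n! m≤n)

-- A common divisor d divides the difference (y ∸ x) · β. It is coprime to β, since each modulus is
-- 1 modulo β, so it divides y ∸ x. As 0 < y ∸ x ≤ N, this in turn divides N! = β, and d = 1.
modulus-coprime-< : (N x y : ℕ) → x < y → y ≤ N → Coprime (modulus (N !) x) (modulus (N !) y)
modulus-coprime-< N x y x<y y≤N {d} (d∣x , d∣y) = ∣1⇒≡1 (coprime-to-β (∣-refl , d∣β))
  where
  β = N !
  split : modulus β y ≡ modulus β x + (y ∸ x) * β
  split = cong suc (trans (cong (λ z → suc z * β) (sym (m+[n∸m]≡n (<⇒≤ x<y))))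
                          (*-distribʳ-+ β (suc x) (y ∸ x)))
  d∣diff : d ∣ (y ∸ x) * β
  d∣diff = ∣m+n∣m⇒∣n (subst (d ∣_) split d∣y) d∣x
  coprime-to-β : ∀ {e} → e ∣ d × e ∣ β → e ∣ 1
  coprime-to-β {e} (e∣d , e∣β) =
    ∣m+n∣m⇒∣n (subst (e ∣_) (+-comm 1 (suc x * β)) (∣-trans e∣d d∣x)) (∣n⇒∣m*n (suc x) e∣β)
  d∣β : d ∣ β
  d∣β = ∣-trans
    (coprime-divisor {n = β} (λ (e∣d , e∣β) → ∣1⇒≡1 (coprime-to-β (e∣d , e∣β)))
      (subst (d ∣_) (*-comm (y ∸ x) β) d∣diff))
    (∣n! N (y ∸ x) (m<n⇒0<n∸m x<y) (≤-trans (m∸n≤m y x) y≤N))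

modulus-coprime : (N x y : ℕ) → ¬ x ≡ y → x ≤ N → y ≤ N → Coprime (modulus (N !) x) (modulus (N !) y)
modulus-coprime N x y x≢y x≤N y≤N with <-cmp x y
... | tri< x<y _ _ = modulus-coprime-< N x y x<y y≤N
... | tri≈ _ x≡y _ = ⊥-elim (x≢y x≡y)
... | tri> _ _ y<x = Coprime.sym (modulus-coprime-< N y x y<x x≤N)

-- If x ∉ L, coprimality lets the factors be dropped from the product one after another until the
-- modulus of x divides 1; but it exceeds 1, because N! is positive.
∣product-modulus : (N x : ℕ) (L : List ℕ) → (∀ {y} → y ∈ L → y ≤ N) → x ≤ N →
                   modulus (N !) x ∣ product (List.map (modulus (N !)) L) → x ∈ L
∣product-modulus N x L L≤N x≤N div with x ∈? L
... | yes x∈L = x∈L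
... | no x∉L = ⊥-elim (1≢modulus (∣1⇒≡1 (divides-one L id div)))
  where
  1≢modulus : ¬ modulus (N !) x ≡ 1
  1≢modulus e = 1+n≢0 (m*n≡0⇒m≡0 (suc x) (N !) {{≢-nonZero (m<n⇒n≢0 (1≤n! N))}} (suc-injective e))
  divides-one : (K : List ℕ) → (∀ {y} → y ∈ K → y ∈ L) →
                modulus (N !) x ∣ product (List.map (modulus (N !)) K) → modulus (N !) x ∣ 1
  divides-one [] _ h = h
  divides-one (y ∷ K) K⊆L h = divides-one K (K⊆L ∘ there)
    (coprime-divisor
      (modulus-coprime N x y (λ x≡y → x∉L (subst (_∈ L) (sym x≡y) (K⊆L (here refl))))
        x≤N (L≤N (K⊆L (here refl)))) h)

finite-set-code : (N : ℕ) (L : List ℕ) → (∀ {y} → y ∈ L → y ≤ N) →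
                  ∃₂ λ α β → ∀ x → x ≤ N → modulus β x ∣ α ⟺ x ∈ L
finite-set-code N L L≤N = product (List.map (modulus (N !)) L) , N ! , λ x x≤N →
  ∣product-modulus N x L L≤N x≤N , λ x∈L → ∈⇒∣product (∈-map⁺ (modulus (N !)) x∈L)

-- A pairing that is a term of the language, in contrast to the exponential `pair`. The value lies
-- between (x + y)² and (x + y + 1)², which determines x + y and then x.
pp : ℕ → ℕ → ℕ
pp x y = (x + y) * (x + y) + x

pp-≤ˡ : ∀ x y → x ≤ pp x y
pp-≤ˡ x y = m≤n+m x _

n≤n*n : ∀ n → n ≤ n * n
n≤n*n zero = z≤n
n≤n*n (suc n) = m≤m*n (suc n) (suc n)

pp-≤ʳ : ∀ x y → y ≤ pp x y
pp-≤ʳ x y = ≤-trans (m≤n+m y x) (≤-trans (n≤n*n (x + y)) (m≤m+n _ x))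

pp-< : ∀ x y x′ y′ → x + y < x′ + y′ → pp x y < pp x′ y′
pp-< x y x′ y′ lt = begin-strict
  (x + y) * (x + y) + x             ≤⟨ +-monoʳ-≤ ((x + y) * (x + y)) (m≤m+n x y) ⟩
  (x + y) * (x + y) + (x + y)       ≡⟨ +-comm ((x + y) * (x + y)) (x + y) ⟩
  suc (x + y) * (x + y)             <⟨ *-monoʳ-< (suc (x + y)) ≤-refl ⟩
  suc (x + y) * suc (x + y)         ≤⟨ *-mono-≤ lt lt ⟩
  (x′ + y′) * (x′ + y′)             ≤⟨ m≤m+n _ x′ ⟩
  (x′ + y′) * (x′ + y′) + x′        ∎
  where open ≤-Reasoning

pp-injective : ∀ x y x′ y′ → pp x y ≡ pp x′ y′ → x ≡ x′ × y ≡ y′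
pp-injective x y x′ y′ e with <-cmp (x + y) (x′ + y′)
... | tri< lt _ _ = ⊥-elim (<⇒≢ (pp-< x y x′ y′ lt) e)
... | tri> _ _ gt = ⊥-elim (<⇒≢ (pp-< x′ y′ x y gt) (sym e))
... | tri≈ _ s≡s _ = x≡x′ , +-cancelˡ-≡ x y y′ (trans s≡s (cong (_+ y′) (sym x≡x′)))
  where
  x≡x′ : x ≡ x′
  x≡x′ = +-cancelˡ-≡ ((x + y) * (x + y)) x x′ (trans e (cong (λ s → s * s + x′) (sym s≡s)))

-- A tag and four arguments, as many as a positive oracle answer carries: the query and the three
-- numbers N, α, β that code a derivation.
Fact : Set
Fact = Vec ℕ 5

tuple : {n : ℕ} → ℕ → Vec ℕ n → ℕ
tuple h [] = h
tuple h (x ∷ xs) = pp h (tuple x xs)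

tuple-≤ʰ : {n : ℕ} (h : ℕ) (xs : Vec ℕ n) → h ≤ tuple h xs
tuple-≤ʰ h [] = ≤-refl
tuple-≤ʰ h (x ∷ xs) = pp-≤ˡ h _

tuple-≤ : {n : ℕ} (h : ℕ) (xs : Vec ℕ n) (i : Fin n) → lookup xs i ≤ tuple h xs
tuple-≤ h (x ∷ xs) zero = ≤-trans (tuple-≤ʰ x xs) (pp-≤ʳ h _)
tuple-≤ h (x ∷ xs) (suc i) = ≤-trans (tuple-≤ x xs i) (pp-≤ʳ h _)

tuple-injective : {n : ℕ} (h h′ : ℕ) (xs xs′ : Vec ℕ n) → tuple h xs ≡ tuple h′ xs′ → h ≡ h′ × xs ≡ xs′
tuple-injective h h′ [] [] e = e , refl
tuple-injective h h′ (x ∷ xs) (x′ ∷ xs′) e with pp-injective h _ h′ _ e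
... | h≡ , e′ with tuple-injective x x′ xs xs′ e′
...   | x≡ , xs≡ = h≡ , cong₂ _∷_ x≡ xs≡

ppT : {k : ℕ} → Term k → Term k → Term k
ppT t u = (t +' u) ·' (t +' u) +' t

tupleT : {k n : ℕ} → Term k → Vec (Term k) n → Term k
tupleT t [] = t
tupleT t (u ∷ us) = ppT t (tupleT u us)

tupleT-sem : {k n : ℕ} (t : Term k) (us : Vec (Term k) n) {ρ : Env k} →
             ⟦ tupleT t us ⟧ᵗ ρ ≡ tuple (⟦ t ⟧ᵗ ρ) (map (λ u → ⟦ u ⟧ᵗ ρ) us)
tupleT-sem t [] = refl
tupleT-sem t (u ∷ us) {ρ} = cong (pp (⟦ t ⟧ᵗ ρ)) (tupleT-sem u us)

-- Membership of the fact f, with height h, in the finite set coded by (α , β).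
Mem : (N α β h : ℕ) → Fact → Set
Mem N α β h f = tuple h f ≤ N × modulus β (tuple h f) ∣ α

-- Divisibility is a bounded search, since the quotient is at most the dividend. The variables are
-- the height, the five entries of the fact, and then N, α, β.
memΔ : Δ-Def {9} λ ρ →
  Mem (ρ 6F) (ρ 7F) (ρ 8F) (ρ 0F) (ρ 1F ∷ ρ 2F ∷ ρ 3F ∷ ρ 4F ∷ ρ 5F ∷ [])
memΔ = conv (λ ρ → ×-⟺ (≡-⟺ _≤_ (tupleT-sem t ts {ρ}) refl) (equiv ρ))
  (×Δ (≼Δ T (var 6F))
      (∃≤Δ (var 7F) (≐Δ (var 0F ·' S (S (wkT T) ·' var 9F)) (var 8F))))
  where
  t : Term 9
  t = var 0F
  ts : Vec (Term 9) 5
  ts = var 1F ∷ var 2F ∷ var 3F ∷ var 4F ∷ var 5F ∷ []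
  T : Term 9
  T = tupleT t ts
  equiv : ∀ ρ → (∃ᶜ λ q → q ≤ ρ 7F × q * suc (suc (⟦ wkT T ⟧ᵗ (q ∷ᵉ ρ)) * ρ 8F) ≡ ρ 7F) ⟺
          modulus (ρ 8F) (tuple (ρ 0F) (ρ 1F ∷ ρ 2F ∷ ρ 3F ∷ ρ 4F ∷ ρ 5F ∷ [])) ∣ ρ 7F
  equiv ρ = (λ h → decidable-stable (_ ∣? _) λ n → h λ q (_ , e) → n (divides q (sym e))) ,
            λ { (divides q e) n → n q (subst (q ≤_) (sym e) (m≤m*n q _) , sym e) }

-- Formulas in which facts occur only positively. Hence `Sat` is strictly positive in the set of
-- facts, its least fixed point is a data type, and each of its members depends on finitely many
-- facts.
data Pos (v : ℕ) : Set where
  eq   : Term v → Term v → Pos v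
  fact : Vec (Term v) 5 → Pos v
  _&_  : Pos v → Pos v → Pos v
  _or_ : Pos v → Pos v → Pos v
  ex   : Pos (suc v) → Pos v

Sat : (Fact → Set) → {v : ℕ} → Pos v → Env v → Set
Sat X (eq t u) ρ = ⟦ t ⟧ᵗ ρ ≡ ⟦ u ⟧ᵗ ρ
Sat X (fact ts) ρ = X (map (λ t → ⟦ t ⟧ᵗ ρ) ts)
Sat X (p & q) ρ = Sat X p ρ × Sat X q ρ
Sat X (p or q) ρ = Sat X p ρ ⊎ Sat X q ρ
Sat X (ex p) ρ = Σ ℕ λ n → Sat X p (n ∷ᵉ ρ)

-- The facts with tag ≤ 3 are the answers of an oracle O; the others are generated by J.
module Inductive (J : Pos 5) (O : Pred 5) where

  data I : Fact → Set where
    base : {f : Fact} → head f ≤ 3 → O (lookup f) → I f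
    rule : {f : Fact} → 3 < head f → Sat I J (lookup f) → I f

  module _ (M : Fact → Set)
           (base′ : ∀ f → head f ≤ 3 → O (lookup f) → M f)
           (rule′ : ∀ f → 3 < head f → Sat M J (lookup f) → M f) where

    I-ind : ∀ {f} → I f → M f
    I-ind-Sat : ∀ {v} (p : Pos v) {ρ} → Sat I p ρ → Sat M p ρ
    I-ind (base l o) = base′ _ l o
    I-ind (rule l s) = rule′ _ l (I-ind-Sat J s)
    I-ind-Sat (eq t u) e = e
    I-ind-Sat (fact ts) i = I-ind i
    I-ind-Sat (p & q) (a , b) = I-ind-Sat p a , I-ind-Sat q b
    I-ind-Sat (p or q) (inj₁ a) = inj₁ (I-ind-Sat p a)
    I-ind-Sat (p or q) (inj₂ b) = inj₂ (I-ind-Sat q b)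
    I-ind-Sat (ex p) (n , a) = n , I-ind-Sat p a

-- The last four variables are N, α, β and a height h: existential witnesses are bounded by N and
-- facts are looked up, with a smaller height, in the set coded by (α , β).
belowΔ : Δ-Def {9} λ ρ → ∃ᶜ λ h → h ≤ ρ 8F ×
  (h < ρ 8F × Mem (ρ 5F) (ρ 6F) (ρ 7F) h (ρ 0F ∷ ρ 1F ∷ ρ 2F ∷ ρ 3F ∷ ρ 4F ∷ []))
belowΔ = ∃≤Δ (var 8F) (×Δ (≼Δ (S (var 0F)) (var 9F))
  (Δ-sub memΔ (var 0F ∷ var 1F ∷ var 2F ∷ var 3F ∷ var 4F ∷ var 5F ∷ var 6F ∷ var 7F ∷ var 8F ∷ [])))

fact-args : {v : ℕ} → Vec (Term v) 5 → Vec (Term (v + 4)) 9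
fact-args {v} ts = map (renT (_↑ˡ 4)) ts Vec.++
  (var (v ↑ʳ 0F) ∷ var (v ↑ʳ 1F) ∷ var (v ↑ʳ 2F) ∷ var (v ↑ʳ 3F) ∷ [])

bounded : {v : ℕ} → Pos v → Formula (v + 4)
bounded (eq t u) = renT (_↑ˡ 4) t ≐ renT (_↑ˡ 4) u
bounded (fact ts) = formula belowΔ ⟨ fact-args ts ⟩
bounded (p & q) = bounded p ∧' bounded q
bounded (p or q) = bounded p ∨' bounded q
bounded {v} (ex p) = ∃' (var zero ≼ wkT (var (v ↑ʳ 0F)) ∧' bounded p)

bounded-Δ₀ : {v : ℕ} (p : Pos v) → Δ₀ (bounded p)
bounded-Δ₀ (eq t u) = atom-≐ _ _
bounded-Δ₀ (fact ts) = Δ₀-sub (lookup (fact-args ts)) (class belowΔ)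
bounded-Δ₀ (p & q) = d-∧ (bounded-Δ₀ p) (bounded-Δ₀ q)
bounded-Δ₀ (p or q) = d-∨ (bounded-Δ₀ p) (bounded-Δ₀ q)
bounded-Δ₀ (ex p) = d-∃≤ _ (bounded-Δ₀ p)

Below : (N α β h : ℕ) → Fact → Set
Below N α β h f = ∃ᶜ λ h′ → h′ ≤ h × (h′ < h × Mem N α β h′ f)

bounded-fact : {v : ℕ} (ts : Vec (Term v) 5) {ρ : Env (v + 4)} {ρ′ : Env v} {N α β h : ℕ} →
               (∀ i → ρ (i ↑ˡ 4) ≡ ρ′ i) →
               (∀ j → ρ (v ↑ʳ j) ≡ lookup (N ∷ α ∷ β ∷ h ∷ []) j) →
               ⟦ bounded (fact ts) ⟧ ρ ⟺ Below N α β h (map (λ t → ⟦ t ⟧ᵗ ρ′) ts)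
bounded-fact ts@(t₀ ∷ t₁ ∷ t₂ ∷ t₃ ∷ t₄ ∷ []) {ρ} {ρ′} {N} {α} {β} {h} e e′ =
  ⟺-trans (subF-sem {σ = lookup (fact-args ts)} {ρ} {env}
    (λ { 0F → renT-sem e t₀ ; 1F → renT-sem e t₁ ; 2F → renT-sem e t₂ ; 3F → renT-sem e t₃
       ; 4F → renT-sem e t₄ ; 5F → e′ 0F ; 6F → e′ 1F ; 7F → e′ 2F ; 8F → e′ 3F })
    (formula belowΔ)) (sem belowΔ env)
  where
  env : Env 9
  env = lookup (⟦ t₀ ⟧ᵗ ρ′ ∷ ⟦ t₁ ⟧ᵗ ρ′ ∷ ⟦ t₂ ⟧ᵗ ρ′ ∷ ⟦ t₃ ⟧ᵗ ρ′ ∷ ⟦ t₄ ⟧ᵗ ρ′ ∷ N ∷ α ∷ β ∷ h ∷ [])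

↑ˡ-∷ᵉ : {v : ℕ} (n : ℕ) {ρ : Env (v + 4)} {ρ′ : Env v} → (∀ i → ρ (i ↑ˡ 4) ≡ ρ′ i) →
        ∀ i → (n ∷ᵉ ρ) (i ↑ˡ 4) ≡ (n ∷ᵉ ρ′) i
↑ˡ-∷ᵉ n e zero = refl
↑ˡ-∷ᵉ n e (suc i) = e i

bounded-sound : {X : Fact → Set} {v : ℕ} (p : Pos v) {ρ : Env (v + 4)} {ρ′ : Env v} {N α β h : ℕ} →
                (∀ i → ρ (i ↑ˡ 4) ≡ ρ′ i) →
                (∀ j → ρ (v ↑ʳ j) ≡ lookup (N ∷ α ∷ β ∷ h ∷ []) j) →
                (∀ f → Below N α β h f → ¬ ¬ X f) →
                ⟦ bounded p ⟧ ρ → ¬ ¬ Sat X p ρ′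
bounded-sound (eq t u) e e′ below s = return (trans (sym (renT-sem e t)) (trans s (renT-sem e u)))
bounded-sound (fact ts) e e′ below s = below _ (proj₁ (bounded-fact ts e e′) s)
bounded-sound (p & q) e e′ below (s , s′) = do
  a ← bounded-sound p e e′ below s
  b ← bounded-sound q e e′ below s′
  return (a , b)
bounded-sound (p or q) e e′ below s k =
  s ((λ s₁ → bounded-sound p e e′ below s₁ (k ∘ inj₁)) , λ s₂ → bounded-sound q e e′ below s₂ (k ∘ inj₂))
bounded-sound (ex p) e e′ below s k =
  s λ n (_ , s′) → bounded-sound p (↑ˡ-∷ᵉ n e) e′ below s′ λ a → k (n , a)

Listed : Set
Listed = List (ℕ × Fact)

-- The constructive counterpart of `bounded`: facts come from a list and have height below h,
-- witnesses are at most N. It is monotone in the list and in both bounds, so the derivations of two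
-- conjuncts can be merged.
SatIn : Listed → (N h : ℕ) {v : ℕ} → Pos v → Env v → Set
SatIn L N h (eq t u) ρ = ⟦ t ⟧ᵗ ρ ≡ ⟦ u ⟧ᵗ ρ
SatIn L N h (fact ts) ρ = Σ ℕ λ h′ → h′ < h × (h′ , map (λ t → ⟦ t ⟧ᵗ ρ) ts) ∈ L
SatIn L N h (p & q) ρ = SatIn L N h p ρ × SatIn L N h q ρ
SatIn L N h (p or q) ρ = SatIn L N h p ρ ⊎ SatIn L N h q ρ
SatIn L N h (ex p) ρ = Σ ℕ λ n → n ≤ N × SatIn L N h p (n ∷ᵉ ρ)

SatIn-mono : {L L′ : Listed} {N N′ h h′ : ℕ} → (∀ {x} → x ∈ L → x ∈ L′) → N ≤ N′ → h ≤ h′ →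
             {v : ℕ} (p : Pos v) {ρ : Env v} → SatIn L N h p ρ → SatIn L′ N′ h′ p ρ
SatIn-mono l n h (eq t u) e = e
SatIn-mono l n h (fact ts) (h″ , h″< , m) = h″ , ≤-trans h″< h , l m
SatIn-mono l n h (p & q) (a , b) = SatIn-mono l n h p a , SatIn-mono l n h q b
SatIn-mono l n h (p or q) (inj₁ a) = inj₁ (SatIn-mono l n h p a)
SatIn-mono l n h (p or q) (inj₂ b) = inj₂ (SatIn-mono l n h q b)
SatIn-mono l n h (ex p) (m , m≤ , a) = m , ≤-trans m≤ n , SatIn-mono l n h p a

bounded-complete : {L : Listed} {v : ℕ} (p : Pos v) {ρ : Env (v + 4)} {ρ′ : Env v} {N α β h : ℕ} →
                   (∀ i → ρ (i ↑ˡ 4) ≡ ρ′ i) →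
                   (∀ j → ρ (v ↑ʳ j) ≡ lookup (N ∷ α ∷ β ∷ h ∷ []) j) →
                   (∀ {h f} → (h , f) ∈ L → Mem N α β h f) →
                   SatIn L N h p ρ′ → ⟦ bounded p ⟧ ρ
bounded-complete (eq t u) e e′ m s = trans (renT-sem e t) (trans s (sym (renT-sem e u)))
bounded-complete (fact ts) e e′ m (h′ , h′<h , i) =
  proj₂ (bounded-fact ts e e′) λ k → k h′ (<⇒≤ h′<h , h′<h , m i)
bounded-complete (p & q) e e′ m (a , b) = bounded-complete p e e′ m a , bounded-complete q e e′ m b
bounded-complete (p or q) e e′ m (inj₁ a) (k , _) = k (bounded-complete p e e′ m a)
bounded-complete (p or q) e e′ m (inj₂ b) (_ , k) = k (bounded-complete q e e′ m b)
bounded-complete (ex p) e e′ m (n , n≤N , a) k =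
  k n (subst (n ≤_) (sym (e′ 0F)) n≤N , bounded-complete p (↑ˡ-∷ᵉ n e) e′ m a)

module Definability (J : Pos 5) {n : ℕ} {O : Pred 5} (OΠ : Π-Def n O) where

  open Inductive J O

  -- Membership of the fact and the correctness of all rule steps are Δ₀, as every number that
  -- occurs is bounded by N; the oracle condition is the only Πₙ part and is kept apart. Since each
  -- rule step refers to smaller heights, a set of facts cannot justify itself circularly.
  record Derivation (N α β : ℕ) (f : Fact) : Set where
    constructor derivation
    field
      member : ∃ᶜ λ h → h ≤ N × Mem N α β h f
      steps  : ∀ h → h ≤ N → ∀ r → r ≤ N → ∀ a → a ≤ N → ∀ b → b ≤ N → ∀ c → c ≤ N → ∀ d → d ≤ N →
               Mem N α β h (r ∷ a ∷ b ∷ c ∷ d ∷ []) →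
               r ≤ 3 ∨ᶜ ⟦ bounded J ⟧ (lookup (r ∷ a ∷ b ∷ c ∷ d ∷ N ∷ α ∷ β ∷ h ∷ []))
      oracle : ∀ h → h ≤ N → ∀ r → r ≤ N → ∀ a → a ≤ N → ∀ b → b ≤ N → ∀ c → c ≤ N → ∀ d → d ≤ N →
               Mem N α β h (r ∷ a ∷ b ∷ c ∷ d ∷ []) →
               r ≤ 3 → O (lookup (r ∷ a ∷ b ∷ c ∷ d ∷ []))

  DerivationΠ : Π-Def n {8} λ ρ →
    Derivation (ρ 7F) (ρ 5F) (ρ 6F) (ρ 0F ∷ ρ 1F ∷ ρ 2F ∷ ρ 3F ∷ ρ 4F ∷ [])
  DerivationΠ = conv
    (λ ρ → (λ (m , s , o) → derivation m s o) , λ (derivation m s o) → m , s , o)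
    (×Π (Δ⇒Π memberΔ) (×Π (Δ⇒Π stepsΔ) oracleΠ))
    where
    v : {k : ℕ} (m : ℕ) {m<k : True (suc m ≤? k)} → Term k
    v {k} m {m<k} = var (#_ m {k} {m<k})
    -- Inside `steps` and `oracle` the quantified h, r, a, b, c, d are the variables 5, ..., 0; thus
    -- α, β, N, which are 5, 6, 7 outside, become 11, 12, 13.
    fact-vars : Vec (Term 14) 5
    fact-vars = v 4 ∷ v 3 ∷ v 2 ∷ v 1 ∷ v 0 ∷ []
    mem′ : Δ-Def {14} λ ρ → Mem (ρ (# 13)) (ρ (# 11)) (ρ (# 12)) (ρ 5F)
                              (ρ 4F ∷ ρ 3F ∷ ρ 2F ∷ ρ 1F ∷ ρ 0F ∷ [])
    mem′ = Δ-sub memΔ (v 5 ∷ v 4 ∷ v 3 ∷ v 2 ∷ v 1 ∷ v 0 ∷ v 13 ∷ v 11 ∷ v 12 ∷ [])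
    bounded′ : Δ-Def {14} λ ρ → ⟦ bounded J ⟧ (lookup
      (ρ 4F ∷ ρ 3F ∷ ρ 2F ∷ ρ 1F ∷ ρ 0F ∷ ρ (# 13) ∷ ρ (# 11) ∷ ρ (# 12) ∷ ρ 5F ∷ []))
    bounded′ = Δ-sub (def (bounded J) (bounded-Δ₀ J) λ ρ → id , id)
      (v 4 ∷ v 3 ∷ v 2 ∷ v 1 ∷ v 0 ∷ v 13 ∷ v 11 ∷ v 12 ∷ v 5 ∷ [])
    memberΔ = ∃≤Δ (v 7) (Δ-sub memΔ
      (v 0 ∷ v 1 ∷ v 2 ∷ v 3 ∷ v 4 ∷ v 5 ∷ v 8 ∷ v 6 ∷ v 7 ∷ []))
    stepsΔ = ∀≤Δ (v 7) (∀≤Δ (v 8) (∀≤Δ (v 9) (∀≤Δ (v 10) (∀≤Δ (v 11) (∀≤Δ (v 12)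
      (→Δ mem′ (∨Δ (≼Δ (v 4) (num 3)) bounded′)))))))
    oracleΠ = ∀≤Π (v 7) (∀≤Π (v 8) (∀≤Π (v 9) (∀≤Π (v 10) (∀≤Π (v 11) (∀≤Π (v 12)
      (→Π mem′ (→Π (≼Δ (v 4) (num 3)) (Π-sub OΠ fact-vars))))))))

  module _ {N α β : ℕ} {f : Fact} (D : Derivation N α β f) where
    open Derivation D

    -- Induction on a strict bound b for the height: the facts that justify a coded fact are lower.
    -- The conclusion stays under ¬¬ because `∨ᶜ` and `∃ᶜ` yield no witnesses.
    member-sound : ∀ b h f → h < b → Mem N α β h f → ¬ ¬ I f
    member-sound (suc b) h f@(r ∷ a₁ ∷ a₂ ∷ a₃ ∷ a₄ ∷ []) (s≤s h≤b) m@(t≤N , _) k =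
      [ (λ r≤3 → k (base r≤3
          (oracle h h≤N r (le 0F) a₁ (le 1F) a₂ (le 2F) a₃ (le 3F) a₄ (le 4F) m r≤3)))
      , (λ 3<r → steps h h≤N r (le 0F) a₁ (le 1F) a₂ (le 2F) a₃ (le 3F) a₄ (le 4F) m
          ( <⇒≱ 3<r
          , λ s → bounded-sound J {N = N} {α} {β} {h}
              (λ { 0F → refl ; 1F → refl ; 2F → refl ; 3F → refl ; 4F → refl })
              (λ { 0F → refl ; 1F → refl ; 2F → refl ; 3F → refl })
              (λ g below k′ → below λ h′ (_ , h′<h , m′) →
                member-sound b h′ g (≤-trans h′<h h≤b) m′ k′)
              s (k ∘ rule 3<r)))
      ] (≤-<-connex r 3)
      where
      h≤N : h ≤ N
      h≤N = ≤-trans (tuple-≤ʰ h f) t≤N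
      le : ∀ i → lookup f i ≤ N
      le i = ≤-trans (tuple-≤ h f i) t≤N

    Derivation-sound : ¬ ¬ I f
    Derivation-sound k = member λ h (_ , m) → member-sound (suc h) h f ≤-refl m k

  Justified : Listed → ℕ → Set
  Justified L N = ∀ {h f} → (h , f) ∈ L →
    tuple h f ≤ N × (head f ≤ 3 × O (lookup f) ⊎ 3 < head f × SatIn L N h J (lookup f))

  Justified-mono : ∀ {L L′ N N′} → (∀ {x} → x ∈ L → x ∈ L′) → N ≤ N′ → Justified L N →
    ∀ {h f} → (h , f) ∈ L → tuple h f ≤ N′ × (head f ≤ 3 × O (lookup f) ⊎ 3 < head f × SatIn L′ N′ h J (lookup f))
  Justified-mono l n j i with j i
  ... | t≤N , inj₁ b = ≤-trans t≤N n , inj₁ b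
  ... | t≤N , inj₂ (3< , s) = ≤-trans t≤N n , inj₂ (3< , SatIn-mono l n ≤-refl J s)

  -- Flattens the derivation tree. `list-Sat` returns an h strictly above the heights of the
  -- premises used, and the concluded fact is entered at this height; N grows to bound all witnesses
  -- and all tuples.
  list : ∀ {f} → I f → Σ Listed λ L → Σ ℕ λ N → Justified L N × Σ ℕ λ h → (h , f) ∈ L
  list-Sat : ∀ {v} (p : Pos v) {ρ} → Sat I p ρ →
             Σ Listed λ L → Σ ℕ λ N → Justified L N × Σ ℕ λ h → SatIn L N h p ρ
  list {f} (base l o) = (0 , f) ∷ [] , tuple 0 f ,
    (λ { (here refl) → ≤-refl , inj₁ (l , o) }) , 0 , here refl
  list {f} (rule 3< s) with list-Sat J s
  ... | L , N , j , h , s′ = (h , f) ∷ L , N ⊔ tuple h f ,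
    (λ { (here refl) → m≤n⊔m N _ , inj₂ (3< , SatIn-mono there (m≤m⊔n N _) ≤-refl J s′)
       ; (there i) → Justified-mono there (m≤m⊔n N _) j i }) , h , here refl
  list-Sat (eq t u) e = [] , 0 , (λ ()) , 0 , e
  list-Sat (fact ts) i with list i
  ... | L , N , j , h , m = L , N , j , suc h , h , ≤-refl , m
  list-Sat (p & q) (a , b) with list-Sat p a | list-Sat q b
  ... | L , N , j , h , s | L′ , N′ , j′ , h′ , s′ = L ++ L′ , N ⊔ N′ , J″ , h ⊔ h′ ,
    SatIn-mono ∈-++⁺ˡ (m≤m⊔n N N′) (m≤m⊔n h h′) p s ,
    SatIn-mono (∈-++⁺ʳ L) (m≤n⊔m N N′) (m≤n⊔m h h′) q s′
    where
    J″ : Justified (L ++ L′) (N ⊔ N′)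
    J″ i with ∈-++⁻ L i
    ... | inj₁ i′ = Justified-mono ∈-++⁺ˡ (m≤m⊔n N N′) j i′
    ... | inj₂ i′ = Justified-mono (∈-++⁺ʳ L) (m≤n⊔m N N′) j′ i′
  list-Sat (p or q) (inj₁ a) with list-Sat p a
  ... | L , N , j , h , s = L , N , j , h , inj₁ s
  list-Sat (p or q) (inj₂ b) with list-Sat q b
  ... | L , N , j , h , s = L , N , j , h , inj₂ s
  list-Sat (ex p) (n , a) with list-Sat p a
  ... | L , N , j , h , s = L , N ⊔ n , Justified-mono id (m≤m⊔n N n) j , h ,
    n , m≤n⊔m N n , SatIn-mono id (m≤m⊔n N n) ≤-refl p s

  Derivation-complete : ∀ {f} → I f → Σ ℕ λ N → Σ ℕ λ α → Σ ℕ λ β → Derivation N α β f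
  Derivation-complete {f} i with list i
  ... | L , N , j , h , m = N , α , β , derivation
    (λ k → k h (≤-trans (tuple-≤ʰ h f) (proj₁ (j m)) , to-Mem m))
    (λ h′ _ r _ a _ b _ c _ d _ m′ → step-case (proj₂ (j (from-Mem h′ (r ∷ a ∷ b ∷ c ∷ d ∷ []) m′))))
    (λ h′ _ r _ a _ b _ c _ d _ m′ → oracle-case (proj₂ (j (from-Mem h′ (r ∷ a ∷ b ∷ c ∷ d ∷ []) m′))))
    where
    tuples = List.map (λ (h , f) → tuple h f) L
    code = finite-set-code N tuples λ i′ → case-≤ i′
      where
      case-≤ : ∀ {y} → y ∈ tuples → y ≤ N
      case-≤ i′ with ∈-map⁻ (λ (h , f) → tuple h f) i′
      ... | (h′ , f′) , i″ , refl = proj₁ (j i″)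
    α = proj₁ code
    β = proj₁ (proj₂ code)
    to-Mem : ∀ {h f} → (h , f) ∈ L → Mem N α β h f
    to-Mem i′ = proj₁ (j i′) ,
      proj₂ (proj₂ (proj₂ code) _ (proj₁ (j i′))) (∈-map⁺ (λ (h , f) → tuple h f) i′)
    from-Mem : ∀ h f → Mem N α β h f → (h , f) ∈ L
    from-Mem h f (t≤N , d)
      with ∈-map⁻ (λ (h , f) → tuple h f) (proj₁ (proj₂ (proj₂ code) _ t≤N) d)
    ... | (h′ , f′) , i″ , e with tuple-injective h h′ f f′ e
    ...   | refl , refl = i″
    step-case : ∀ {h r a b c d} → let f = r ∷ a ∷ b ∷ c ∷ d ∷ [] in
      r ≤ 3 × O (lookup f) ⊎ 3 < r × SatIn L N h J (lookup f) →
      r ≤ 3 ∨ᶜ ⟦ bounded J ⟧ (lookup (r ∷ a ∷ b ∷ c ∷ d ∷ N ∷ α ∷ β ∷ h ∷ []))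
    step-case (inj₁ (r≤3 , _)) (k , _) = k r≤3
    step-case {h} (inj₂ (_ , s)) (_ , k) = k (bounded-complete J {N = N} {α} {β} {h}
      (λ { 0F → refl ; 1F → refl ; 2F → refl ; 3F → refl ; 4F → refl })
      (λ { 0F → refl ; 1F → refl ; 2F → refl ; 3F → refl })
      to-Mem s)
    oracle-case : ∀ {h r a b c d} → let f = r ∷ a ∷ b ∷ c ∷ d ∷ [] in
      r ≤ 3 × O (lookup f) ⊎ 3 < r × SatIn L N h J (lookup f) → r ≤ 3 → O (lookup f)
    oracle-case (inj₁ (_ , o)) _ = o
    oracle-case (inj₂ (3<r , _)) r≤3 = ⊥-elim (<⇒≱ 3<r r≤3)

-- Horn clauses

pair-zero : ∀ b → pair 0 b ≡ suc (b + b)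
pair-zero b = trans (+-identityʳ _) (cong (λ c → suc (b + c)) (+-identityʳ b))

pair-suc : ∀ a b → pair (suc a) b ≡ pair a b + pair a b
pair-suc a b = trans (*-assoc 2 (2 ^ a) (suc (2 * b))) (cong (pair a b +_) (+-identityʳ _))

pair-injective : ∀ a b c d → pair a b ≡ pair c d → a ≡ c × b ≡ d
pair-injective zero b zero d e =
  refl , *-cancelˡ-≡ b d 2 (suc-injective (trans (sym (*-identityˡ _)) (trans e (*-identityˡ _))))
pair-injective zero b (suc c) d e =
  ⊥-elim (even≢odd (pair c d) b
    (trans (sym (*-assoc 2 (2 ^ c) (suc (2 * d)))) (trans (sym e) (*-identityˡ _))))
pair-injective (suc a) b zero d e =
  ⊥-elim (even≢odd (pair a b) d
    (trans (sym (*-assoc 2 (2 ^ a) (suc (2 * b)))) (trans e (*-identityˡ _))))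
pair-injective (suc a) b (suc c) d e
  with pair-injective a b c d (*-cancelˡ-≡ (pair a b) (pair c d) 2
         (trans (sym (*-assoc 2 (2 ^ a) (suc (2 * b)))) (trans e (*-assoc 2 (2 ^ c) (suc (2 * d))))))
... | refl , b≡d = refl , b≡d

-- An opaque copy of pair: the codes are iterated exponentials and must never be evaluated.
infixr 6 _∙_
opaque
  _∙_ : ℕ → ℕ → ℕ
  _∙_ = pair

  ∙≡pair : ∀ a b → a ∙ b ≡ pair a b
  ∙≡pair a b = refl

∙-injective : ∀ {a b c d} → a ∙ b ≡ c ∙ d → a ≡ c × b ≡ d
∙-injective {a} {b} {c} {d} e =
  pair-injective a b c d (trans (sym (∙≡pair a b)) (trans e (∙≡pair c d)))

infixr 6 _⊙_
infixl 7 _⊞_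
data Tm (v : ℕ) : Set where
  `   : Fin v → Tm v
  lit : ℕ → Tm v
  sc  : Tm v → Tm v
  _⊞_ : Tm v → Tm v → Tm v
  _⊙_ : Tm v → Tm v → Tm v

⟦_⟧ᵐ : {v : ℕ} → Tm v → Vec ℕ v → ℕ
⟦ ` i ⟧ᵐ xs = lookup xs i
⟦ lit n ⟧ᵐ xs = n
⟦ sc t ⟧ᵐ xs = suc (⟦ t ⟧ᵐ xs)
⟦ t ⊞ u ⟧ᵐ xs = ⟦ t ⟧ᵐ xs + ⟦ u ⟧ᵐ xs
⟦ t ⊙ u ⟧ᵐ xs = ⟦ t ⟧ᵐ xs ∙ ⟦ u ⟧ᵐ xs

data Atom (v : ℕ) : Set where
  atom : ℕ → Vec (Tm v) 4 → Atom v

tag : {v : ℕ} → Atom v → ℕ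
tag (atom r _) = r

infix 4 _⊨_at_ _⊨*_at_
_⊨_at_ : (Fact → Set) → {v : ℕ} → Atom v → Vec ℕ v → Set
X ⊨ atom r ts at xs = X (r ∷ map (λ t → ⟦ t ⟧ᵐ xs) ts)

_⊨*_at_ : (Fact → Set) → {v : ℕ} → List (Atom v) → Vec ℕ v → Set
X ⊨* [] at xs = ⊤
X ⊨* q ∷ qs at xs = X ⊨ q at xs × X ⊨* qs at xs

record Clause : Set where
  constructor clause
  field
    {arity}    : ℕ
    conclusion : Atom arity
    premises   : List (Atom arity)
    large      : 3 < tag conclusion

open Clause public

infix 1 _⇐_
_⇐_ : {v : ℕ} (q : Atom v) → List (Atom v) → {3<q : True (4 ≤? tag q)} → Clause
(q ⇐ qs) {3<q} = clause q qs (toWitness 3<q)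

-- Says that z is the value of the clause term, naming the values of subterms by existential
-- quantifiers. As `_∙_` is exponential and no term of arithmetic, ⊙ is expressed by a fact with tag
-- 4, generated in the same induction.
is : {v w : ℕ} → (Fin v → Term w) → Tm v → Term w → Pos w
is σ (` i) z = eq z (σ i)
is σ (lit n) z = eq z (num n)
is σ (sc t) z = ex (is (wkT ∘ σ) t (var 0F) & eq (wkT z) (S (var 0F)))
is σ (t ⊞ u) z = ex (ex (is (wkT ∘ wkT ∘ σ) t (var 1F) & (is (wkT ∘ wkT ∘ σ) u (var 0F) &
  eq (wkT (wkT z)) (var 1F +' var 0F))))
is σ (t ⊙ u) z = ex (ex (is (wkT ∘ wkT ∘ σ) t (var 1F) & (is (wkT ∘ wkT ∘ σ) u (var 0F) &
  fact (num 4 ∷ var 1F ∷ var 0F ∷ wkT (wkT z) ∷ zer ∷ []))))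

atomPos : {v w : ℕ} → (Fin v → Term w) → Atom v → Pos w
atomPos σ (atom r (a ∷ b ∷ c ∷ d ∷ [])) = ex (ex (ex (ex
  (is σ⁴ a (var 3F) & (is σ⁴ b (var 2F) & (is σ⁴ c (var 1F) & (is σ⁴ d (var 0F) &
    fact (num r ∷ var 3F ∷ var 2F ∷ var 1F ∷ var 0F ∷ []))))))))
  where
  σ⁴ = wkT ∘ wkT ∘ wkT ∘ wkT ∘ σ

atomsPos : {v w : ℕ} → (Fin v → Term w) → List (Atom v) → Pos w
atomsPos σ [] = eq zer zer
atomsPos σ (q ∷ qs) = atomPos σ q & atomsPos σ qs

matchPos : {v w : ℕ} → (Fin v → Term w) → Atom v → Vec (Term w) 5 → Pos w
matchPos σ (atom r (a ∷ b ∷ c ∷ d ∷ [])) (z ∷ z₁ ∷ z₂ ∷ z₃ ∷ z₄ ∷ []) =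
  eq z (num r) & (is σ a z₁ & (is σ b z₂ & (is σ c z₃ & is σ d z₄)))

exs : (v : ℕ) {w : ℕ} → Pos (v + w) → Pos w
exs zero p = p
exs (suc v) p = exs v (ex p)

infixr 5 _∷*_
_∷*_ : {v w : ℕ} → Vec ℕ v → Env w → Env (v + w)
[] ∷* ρ = ρ
(x ∷ xs) ∷* ρ = x ∷ᵉ (xs ∷* ρ)

∷*-↑ˡ : {v w : ℕ} (xs : Vec ℕ v) (ρ : Env w) (i : Fin v) → (xs ∷* ρ) (i ↑ˡ w) ≡ lookup xs i
∷*-↑ˡ (x ∷ xs) ρ zero = refl
∷*-↑ˡ (x ∷ xs) ρ (suc i) = ∷*-↑ˡ xs ρ i

∷*-↑ʳ : {v w : ℕ} (xs : Vec ℕ v) (ρ : Env w) (j : Fin w) → (xs ∷* ρ) (v ↑ʳ j) ≡ ρ j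
∷*-↑ʳ [] ρ j = refl
∷*-↑ʳ (x ∷ xs) ρ j = ∷*-↑ʳ xs ρ j

clausePos : Clause → Pos 5
clausePos c = exs v
  (matchPos (λ i → var (i ↑ˡ 5)) (conclusion c)
    (var (v ↑ʳ 0F) ∷ var (v ↑ʳ 1F) ∷ var (v ↑ʳ 2F) ∷ var (v ↑ʳ 3F) ∷ var (v ↑ʳ 4F) ∷ [])
   & atomsPos (λ i → var (i ↑ˡ 5)) (premises c))
  where
  v = arity c

-- Tag 4 is the graph of the pairing function: pair 0 b = 1 + 2b and pair (1 + a) b = 2 pair a b.
pairPos : Pos 5
pairPos = eq (var 0F) (num 4) &
  ((eq (var 1F) zer & eq (var 3F) (S (var 2F +' var 2F)))
   or ex (ex (eq (var 3F) (S (var 1F)) &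
        (eq (var 5F) (var 0F +' var 0F) &
         fact (num 4 ∷ var 1F ∷ var 4F ∷ var 0F ∷ zer ∷ [])))))

anyOf : (n : ℕ) → (Fin n → Pos 5) → Pos 5
anyOf zero p = eq zer (S zer)
anyOf (suc n) p = p zero or anyOf n (p ∘ suc)

record Agrees {v w : ℕ} (σ : Fin v → Term w) (ρ : Env w) (xs : Vec ℕ v) : Set where
  constructor agrees
  field
    agree : ∀ i → ⟦ σ i ⟧ᵗ ρ ≡ lookup xs i

open Agrees public

agrees-wk : {v w n : ℕ} (σ : Fin v → Term w) {ρ : Env w} {xs : Vec ℕ v} →
            Agrees σ ρ xs → Agrees (wkT ∘ σ) (n ∷ᵉ ρ) xs
agrees-wk σ e = agrees λ i → trans (wkT-sem (σ i)) (agree e i)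

∷*-agrees : {v w : ℕ} (xs : Vec ℕ v) {ρ : Env w} → Agrees (λ i → var (i ↑ˡ w)) (xs ∷* ρ) xs
∷*-agrees xs {ρ} = agrees (∷*-↑ˡ xs ρ)

wk²-sem : {w m n : ℕ} {ρ : Env w} (z : Term w) → ⟦ wkT (wkT z) ⟧ᵗ (m ∷ᵉ (n ∷ᵉ ρ)) ≡ ⟦ z ⟧ᵗ ρ
wk²-sem z = trans (wkT-sem (wkT z)) (wkT-sem z)

module _ {X : Fact → Set} where

  exs-intro : {v w : ℕ} (p : Pos (v + w)) (xs : Vec ℕ v) {ρ : Env w} →
              Sat X p (xs ∷* ρ) → Sat X (exs v p) ρ
  exs-intro p [] s = s
  exs-intro p (x ∷ xs) s = exs-intro (ex p) xs (x , s)

  exs-elim : (v : ℕ) {w : ℕ} (p : Pos (v + w)) {ρ : Env w} → Sat X (exs v p) ρ →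
             Σ (Vec ℕ v) λ xs → Sat X p (xs ∷* ρ)
  exs-elim zero p s = [] , s
  exs-elim (suc v) p s with exs-elim v (ex p) s
  ... | xs , x , s′ = x ∷ xs , s′

  anyOf-intro : (n : ℕ) {p : Fin n → Pos 5} (i : Fin n) {ρ : Env 5} → Sat X (p i) ρ → Sat X (anyOf n p) ρ
  anyOf-intro (suc n) zero s = inj₁ s
  anyOf-intro (suc n) (suc i) s = inj₂ (anyOf-intro n i s)

  anyOf-elim : (n : ℕ) {p : Fin n → Pos 5} {ρ : Env 5} → Sat X (anyOf n p) ρ → Σ (Fin n) λ i → Sat X (p i) ρ
  anyOf-elim zero ()
  anyOf-elim (suc n) (inj₁ s) = zero , s
  anyOf-elim (suc n) (inj₂ s) with anyOf-elim n s
  ... | i , s′ = suc i , s′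

  module _ (pairs : ∀ a b → X (4 ∷ a ∷ b ∷ a ∙ b ∷ 0 ∷ [])) where

    is-intro : {v w : ℕ} (σ : Fin v → Term w) {ρ : Env w} {xs : Vec ℕ v} → Agrees σ ρ xs →
               (t : Tm v) {z : Term w} → ⟦ z ⟧ᵗ ρ ≡ ⟦ t ⟧ᵐ xs → Sat X (is σ t z) ρ
    is-intro σ e (` i) h = trans h (sym (agree e i))
    is-intro σ e (lit n) h = trans h (sym (num-sem n))
    is-intro σ e (sc t) {z} h = _ , is-intro (wkT ∘ σ) (agrees-wk σ e) t refl , trans (wkT-sem z) h
    is-intro σ e (t ⊞ u) {z} h = _ , _ ,
      is-intro _ (agrees-wk (wkT ∘ σ) (agrees-wk σ e)) t refl ,
      is-intro _ (agrees-wk (wkT ∘ σ) (agrees-wk σ e)) u refl , trans (wk²-sem z) h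
    is-intro σ e (t ⊙ u) {z} h = _ , _ ,
      is-intro _ (agrees-wk (wkT ∘ σ) (agrees-wk σ e)) t refl ,
      is-intro _ (agrees-wk (wkT ∘ σ) (agrees-wk σ e)) u refl ,
      subst (λ c → X (4 ∷ _ ∷ _ ∷ c ∷ 0 ∷ [])) (sym (trans (wk²-sem z) h)) (pairs _ _)

    atom-intro : {v w : ℕ} (σ : Fin v → Term w) {ρ : Env w} {xs : Vec ℕ v} → Agrees σ ρ xs →
                 (q : Atom v) → X ⊨ q at xs → Sat X (atomPos σ q) ρ
    atom-intro σ e (atom r (a ∷ b ∷ c ∷ d ∷ [])) h = _ , _ , _ , _ ,
      is-intro _ e⁴ a refl , is-intro _ e⁴ b refl , is-intro _ e⁴ c refl , is-intro _ e⁴ d refl ,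
      subst (λ r → X (r ∷ _)) (sym (num-sem r)) h
      where
      e⁴ = agrees-wk (wkT ∘ wkT ∘ wkT ∘ σ) (agrees-wk (wkT ∘ wkT ∘ σ) (agrees-wk (wkT ∘ σ) (agrees-wk σ e)))

    atoms-intro : {v w : ℕ} (σ : Fin v → Term w) {ρ : Env w} {xs : Vec ℕ v} → Agrees σ ρ xs →
                  (qs : List (Atom v)) → X ⊨* qs at xs → Sat X (atomsPos σ qs) ρ
    atoms-intro σ e [] h = refl
    atoms-intro σ e (q ∷ qs) (h , hs) = atom-intro σ e q h , atoms-intro σ e qs hs

  module _ (pairs : ∀ a b c d → X (4 ∷ a ∷ b ∷ c ∷ d ∷ []) → c ≡ a ∙ b) where

    is-elim : {v w : ℕ} (σ : Fin v → Term w) {ρ : Env w} {xs : Vec ℕ v} → Agrees σ ρ xs →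
              (t : Tm v) {z : Term w} → Sat X (is σ t z) ρ → ⟦ z ⟧ᵗ ρ ≡ ⟦ t ⟧ᵐ xs
    is-elim σ e (` i) h = trans h (agree e i)
    is-elim σ e (lit n) h = trans h (num-sem n)
    is-elim σ e (sc t) {z} (_ , s , h) =
      trans (sym (wkT-sem z)) (trans h (cong suc (is-elim _ (agrees-wk σ e) t s)))
    is-elim σ e (t ⊞ u) {z} (_ , _ , s , s′ , h) = trans (sym (wk²-sem z)) (trans h (cong₂ _+_
      (is-elim _ (agrees-wk (wkT ∘ σ) (agrees-wk σ e)) t s)
      (is-elim _ (agrees-wk (wkT ∘ σ) (agrees-wk σ e)) u s′)))
    is-elim σ e (t ⊙ u) {z} (_ , _ , s , s′ , h) =
      trans (sym (wk²-sem z)) (trans (pairs _ _ _ _ h) (cong₂ _∙_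
        (is-elim _ (agrees-wk (wkT ∘ σ) (agrees-wk σ e)) t s)
        (is-elim _ (agrees-wk (wkT ∘ σ) (agrees-wk σ e)) u s′)))

    atom-elim : {v w : ℕ} (σ : Fin v → Term w) {ρ : Env w} {xs : Vec ℕ v} → Agrees σ ρ xs →
                (q : Atom v) → Sat X (atomPos σ q) ρ → X ⊨ q at xs
    atom-elim σ {xs = xs} e (atom r (a ∷ b ∷ c ∷ d ∷ [])) (_ , _ , _ , _ , s₁ , s₂ , s₃ , s₄ , h) =
      subst X (cong₂ _∷_ (num-sem r) (cong₂ _∷_ (is-elim _ e⁴ a s₁) (cong₂ _∷_ (is-elim _ e⁴ b s₂)
        (cong₂ _∷_ (is-elim _ e⁴ c s₃) (cong (_∷ []) (is-elim _ e⁴ d s₄)))))) h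
      where
      e⁴ : ∀ {k l m n} → Agrees (wkT ∘ wkT ∘ wkT ∘ wkT ∘ σ) (k ∷ᵉ (l ∷ᵉ (m ∷ᵉ (n ∷ᵉ _)))) xs
      e⁴ = agrees-wk (wkT ∘ wkT ∘ wkT ∘ σ) (agrees-wk (wkT ∘ wkT ∘ σ) (agrees-wk (wkT ∘ σ) (agrees-wk σ e)))

    atoms-elim : {v w : ℕ} (σ : Fin v → Term w) {ρ : Env w} {xs : Vec ℕ v} → Agrees σ ρ xs →
                 (qs : List (Atom v)) → Sat X (atomsPos σ qs) ρ → X ⊨* qs at xs
    atoms-elim σ e [] s = tt
    atoms-elim σ e (q ∷ qs) (s , s′) = atom-elim σ e q s , atoms-elim σ e qs s′

module Horn {n : ℕ} (cl : Fin n → Clause) (O : Pred 5) where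

  opaque
    J : Pos 5
    J = pairPos or anyOf n (clausePos ∘ cl)

    J-intro : {X : Fact → Set} {ρ : Env 5} → Sat X (pairPos or anyOf n (clausePos ∘ cl)) ρ → Sat X J ρ
    J-intro s = s

    J-elim : {X : Fact → Set} {ρ : Env 5} → Sat X J ρ → Sat X (pairPos or anyOf n (clausePos ∘ cl)) ρ
    J-elim s = s

  open Inductive J O

  pair-fact : ∀ a b → I (4 ∷ a ∷ b ∷ a ∙ b ∷ 0 ∷ [])
  pair-fact zero b = rule ≤-refl (J-intro (inj₁ (refl , inj₁ (refl , trans (∙≡pair 0 b) (pair-zero b)))))
  pair-fact (suc a) b = rule ≤-refl (J-intro (inj₁ (refl , inj₂ (a , a ∙ b , refl ,
    trans (∙≡pair (suc a) b) (trans (pair-suc a b) (sym (cong₂ _+_ (∙≡pair a b) (∙≡pair a b)))) ,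
    pair-fact a b))))

  derive : (i : Fin n) (xs : Vec ℕ (arity (cl i))) →
           I ⊨* premises (cl i) at xs → I ⊨ conclusion (cl i) at xs
  derive i xs hs = go (conclusion (cl i)) (large (cl i)) λ f s →
    anyOf-intro n i (exs-intro _ xs (s , atoms-intro pair-fact _ (∷*-agrees xs) (premises (cl i)) hs))
    where
    v = arity (cl i)
    go : (q : Atom v) → 3 < tag q →
         (∀ f → Sat I (matchPos (λ i → var (i ↑ˡ 5)) q (map (λ j → var (v ↑ʳ j)) (0F ∷ 1F ∷ 2F ∷ 3F ∷ 4F ∷ [])))
                     (xs ∷* lookup f) →
                  Sat I (anyOf n (clausePos ∘ cl)) (lookup f)) →
         I ⊨ q at xs
    go (atom r (a ∷ b ∷ c ∷ d ∷ [])) 3<r k = rule 3<r (J-intro (inj₂ (k f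
      ( trans (∷*-↑ʳ xs _ 0F) (sym (num-sem r))
      , at 1F a refl , at 2F b refl , at 3F c refl , at 4F d refl))))
      where
      f : Fact
      f = r ∷ ⟦ a ⟧ᵐ xs ∷ ⟦ b ⟧ᵐ xs ∷ ⟦ c ⟧ᵐ xs ∷ ⟦ d ⟧ᵐ xs ∷ []
      at : ∀ j (t : Tm v) → lookup f j ≡ ⟦ t ⟧ᵐ xs →
           Sat I (is (λ i → var (i ↑ˡ 5)) t (var (v ↑ʳ j))) (xs ∷* lookup f)
      at j t e = is-intro pair-fact _ (∷*-agrees xs) t (trans (∷*-↑ʳ xs _ j) e)

  module _ (M : Fact → Set)
           (pairs→ : ∀ a b c d → M (4 ∷ a ∷ b ∷ c ∷ d ∷ []) → c ≡ a ∙ b)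
           (pairs← : ∀ a b c d → c ≡ a ∙ b → M (4 ∷ a ∷ b ∷ c ∷ d ∷ []))
           (base′ : ∀ f → head f ≤ 3 → O (lookup f) → M f)
           (step : ∀ i xs → M ⊨* premises (cl i) at xs → M ⊨ conclusion (cl i) at xs) where

    -- Induction over the encoded operator is reduced to closure under each clause on actual
    -- numbers. The premises are available only as facts of M, and `pairs→` is what recovers the
    -- values of ⊙ from them.
    horn-induction : ∀ {f} → I f → M f
    horn-induction = I-ind M base′ λ f l s → rule′ f (J-elim s)
      where
      rule′ : ∀ f → Sat M (pairPos or anyOf n (clausePos ∘ cl)) (lookup f) → M f
      rule′ (r ∷ a ∷ b ∷ c ∷ d ∷ []) (inj₁ (refl , inj₁ (refl , e))) =
        pairs← _ _ _ _ (trans e (sym (trans (∙≡pair 0 b) (pair-zero b))))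
      rule′ (r ∷ a ∷ b ∷ c ∷ d ∷ []) (inj₁ (refl , inj₂ (a′ , c′ , refl , e , h))) =
        pairs← _ _ _ _ (trans e (trans (cong₂ _+_ e′ e′) (sym (trans (∙≡pair (suc a′) b) (pair-suc a′ b)))))
        where
        e′ : c′ ≡ pair a′ b
        e′ = trans (pairs→ _ _ _ _ h) (∙≡pair a′ b)
      rule′ f@(r ∷ a ∷ b ∷ c ∷ d ∷ []) (inj₂ s) with anyOf-elim n s
      ... | i , s′ with exs-elim (arity (cl i)) _ s′
      ...   | xs , m , ps = go (conclusion (cl i)) m
                (step i xs (atoms-elim pairs→ _ (∷*-agrees xs) (premises (cl i)) ps))
        where
        v = arity (cl i)
        ρ : Env (v + 5)
        ρ = xs ∷* lookup f
        at : ∀ {y} j (t : Tm v) → Sat M (is (λ i → var (i ↑ˡ 5)) t (var (v ↑ʳ j))) ρ →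
             y ≡ ⟦ t ⟧ᵐ xs → y ≡ lookup f j
        at j t s e = trans e (trans (sym (is-elim pairs→ _ (∷*-agrees xs) t s)) (∷*-↑ʳ xs (lookup f) j))
        go : (q : Atom v) →
             Sat M (matchPos (λ i → var (i ↑ˡ 5)) q
               (var (v ↑ʳ 0F) ∷ var (v ↑ʳ 1F) ∷ var (v ↑ʳ 2F) ∷ var (v ↑ʳ 3F) ∷ var (v ↑ʳ 4F) ∷ [])) ρ →
             M ⊨ q at xs → M f
        go (atom r′ (a′ ∷ b′ ∷ c′ ∷ d′ ∷ [])) (e₀ , s₁ , s₂ , s₃ , s₄) = subst M
          (cong₂ _∷_ (trans (sym (trans e₀ (num-sem r′))) (∷*-↑ʳ xs (lookup f) 0F))
          (cong₂ _∷_ (at 1F a′ s₁ refl) (cong₂ _∷_ (at 2F b′ s₂ refl)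
          (cong₂ _∷_ (at 3F c′ s₃ refl) (cong (_∷ []) (at 4F d′ s₄ refl))))))

-- Clauses for computation, substitution and provability

-- The codes of Defs, written with the opaque pairing function.
cT : {k : ℕ} → Term k → ℕ
cT (var i) = 0 ∙ toℕ i
cT zer = 1 ∙ 0
cT (S t) = 2 ∙ cT t
cT (t +' u) = 3 ∙ cT t ∙ cT u
cT (t ·' u) = 4 ∙ cT t ∙ cT u

cF : {k : ℕ} → Formula k → ℕ
cF (t ≐ u) = 0 ∙ cT t ∙ cT u
cF (t ≼ u) = 1 ∙ cT t ∙ cT u
cF ⊥' = 2 ∙ 0
cF (¬' φ) = 3 ∙ cF φ
cF (φ ∧' ψ) = 4 ∙ cF φ ∙ cF ψ
cF (φ ∨' ψ) = 5 ∙ cF φ ∙ cF ψ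
cF (φ ⇒' ψ) = 6 ∙ cF φ ∙ cF ψ
cF (∀' φ) = 7 ∙ cF φ
cF (∃' φ) = 8 ∙ cF φ

cP : {k : ℕ} → Prog k → ℕ
cPs : {k m : ℕ} → Vec (Prog k) m → ℕ
cP {k} Z = 0 ∙ k
cP Succ = 1 ∙ 0
cP {k} (Proj i) = 2 ∙ k ∙ toℕ i
cP (Comp f gs) = 3 ∙ cP f ∙ cPs gs
cP (Rec g h) = 4 ∙ cP g ∙ cP h
cP (Mu f) = 5 ∙ cP f
cP Orc = 6 ∙ 0
cPs [] = 0
cPs (g ∷ gs) = suc (cP g ∙ cPs gs)

∙-cong : ∀ {a b b′} → b ≡ b′ → a ∙ b ≡ pair a b′
∙-cong {a} {b} refl = ∙≡pair a b

∙∙-cong : ∀ {n a a′ b b′} → a ≡ a′ → b ≡ b′ → n ∙ a ∙ b ≡ pair n (pair a′ b′)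
∙∙-cong {n} {a} {b = b} refl refl = ∙-cong (∙≡pair a b)

cT≡ : {k : ℕ} (t : Term k) → cT t ≡ ⌜ t ⌝ᵗ
cT≡ (var i) = ∙≡pair _ _
cT≡ zer = ∙≡pair _ _
cT≡ (S t) = ∙-cong (cT≡ t)
cT≡ (t +' u) = ∙∙-cong (cT≡ t) (cT≡ u)
cT≡ (t ·' u) = ∙∙-cong (cT≡ t) (cT≡ u)

cF≡ : {k : ℕ} (φ : Formula k) → cF φ ≡ ⌜ φ ⌝
cF≡ (t ≐ u) = ∙∙-cong (cT≡ t) (cT≡ u)
cF≡ (t ≼ u) = ∙∙-cong (cT≡ t) (cT≡ u)
cF≡ ⊥' = ∙≡pair _ _
cF≡ (¬' φ) = ∙-cong (cF≡ φ)
cF≡ (φ ∧' ψ) = ∙∙-cong (cF≡ φ) (cF≡ ψ)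
cF≡ (φ ∨' ψ) = ∙∙-cong (cF≡ φ) (cF≡ ψ)
cF≡ (φ ⇒' ψ) = ∙∙-cong (cF≡ φ) (cF≡ ψ)
cF≡ (∀' φ) = ∙-cong (cF≡ φ)
cF≡ (∃' φ) = ∙-cong (cF≡ φ)

cP≡ : {k : ℕ} (e : Prog k) → cP e ≡ codeP e
cPs≡ : {k m : ℕ} (es : Vec (Prog k) m) → cPs es ≡ codePs es
cP≡ Z = ∙≡pair _ _
cP≡ Succ = ∙≡pair _ _
cP≡ (Proj i) = ∙∙-cong refl refl
cP≡ (Comp f gs) = ∙∙-cong (cP≡ f) (cPs≡ gs)
cP≡ (Rec g h) = ∙∙-cong (cP≡ g) (cP≡ h)
cP≡ (Mu f) = ∙-cong (cP≡ f)
cP≡ Orc = ∙≡pair _ _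
cPs≡ [] = refl
cPs≡ (g ∷ gs) = cong suc (trans (cong (_∙ cPs gs) (cP≡ g)) (∙-cong (cPs≡ gs)))

cV : {n : ℕ} → Vec ℕ n → ℕ
cV [] = 0
cV (x ∷ xs) = suc (x ∙ cV xs)

-- The substitutions which occur in the calculus: weakening, instantiation, and these under binders.
data Desc : ℕ → ℕ → Set where
  weaken : {k : ℕ} → Desc k (suc k)
  inst   : {k : ℕ} → Term k → Desc (suc k) k
  under  : {k l : ℕ} → Desc k l → Desc (suc k) (suc l)

sub : {k l : ℕ} → Desc k l → Sub k l
sub weaken = wk
sub (inst t) = single t
sub (under D) = extS (sub D)

cD : {k l : ℕ} → Desc k l → ℕ
cD weaken = 0 ∙ 0
cD (inst t) = 1 ∙ cT t
cD (under D) = 2 ∙ cD D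

wkF≡sub : {k : ℕ} (φ : Formula k) → subF wk φ ≡ wkF φ
wkF≡sub φ = sym (renF-subF (λ _ → refl) φ)

wkT≡sub : {k : ℕ} (t : Term k) → subT wk t ≡ wkT t
wkT≡sub t = sym (renT-subT (λ _ → refl) t)

-- Codes record de Bruijn indices and not scopes. So a sentence keeps its code under `closedF`, and
-- a formula moves to a larger scope without changing its code.
cT-renT : {k l : ℕ} {r : Ren k l} → (∀ i → toℕ (r i) ≡ toℕ i) → ∀ t → cT (renT r t) ≡ cT t
cT-renT e (var i) = cong (0 ∙_) (e i)
cT-renT e zer = refl
cT-renT e (S t) = cong (2 ∙_) (cT-renT e t)
cT-renT e (t +' u) = cong₂ (λ a b → 3 ∙ a ∙ b) (cT-renT e t) (cT-renT e u)
cT-renT e (t ·' u) = cong₂ (λ a b → 4 ∙ a ∙ b) (cT-renT e t) (cT-renT e u)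

cF-renF : {k l : ℕ} {r : Ren k l} → (∀ i → toℕ (r i) ≡ toℕ i) → ∀ φ → cF (renF r φ) ≡ cF φ
cF-renF e (t ≐ u) = cong₂ (λ a b → 0 ∙ a ∙ b) (cT-renT e t) (cT-renT e u)
cF-renF e (t ≼ u) = cong₂ (λ a b → 1 ∙ a ∙ b) (cT-renT e t) (cT-renT e u)
cF-renF e ⊥' = refl
cF-renF e (¬' φ) = cong (3 ∙_) (cF-renF e φ)
cF-renF e (φ ∧' ψ) = cong₂ (λ a b → 4 ∙ a ∙ b) (cF-renF e φ) (cF-renF e ψ)
cF-renF e (φ ∨' ψ) = cong₂ (λ a b → 5 ∙ a ∙ b) (cF-renF e φ) (cF-renF e ψ)
cF-renF e (φ ⇒' ψ) = cong₂ (λ a b → 6 ∙ a ∙ b) (cF-renF e φ) (cF-renF e ψ)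
cF-renF e (∀' φ) = cong (7 ∙_) (cF-renF (λ { zero → refl ; (suc i) → cong suc (e i) }) φ)
cF-renF e (∃' φ) = cong (8 ∙_) (cF-renF (λ { zero → refl ; (suc i) → cong suc (e i) }) φ)

infixr 6 _◂_
_◂_ : {v : ℕ} → ℕ → Tm v → Tm v
n ◂ t = lit n ⊙ t

consᵐ : {v : ℕ} → Tm v → Tm v → Tm v
consᵐ t u = sc (t ⊙ u)

infixr 6 _⇒ᵐ_
_⇒ᵐ_ : {v : ℕ} → Tm v → Tm v → Tm v
t ⇒ᵐ u = 6 ◂ t ⊙ u

wkᵐ : {v : ℕ} → Tm v
wkᵐ = 0 ◂ lit 0

rel₁ : {v : ℕ} → ℕ → Tm v → Atom v
rel₁ r a = atom r (a ∷ lit 0 ∷ lit 0 ∷ lit 0 ∷ [])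

rel₂ : {v : ℕ} → ℕ → Tm v → Tm v → Atom v
rel₂ r a b = atom r (a ∷ b ∷ lit 0 ∷ lit 0 ∷ [])

rel₃ : {v : ℕ} → ℕ → Tm v → Tm v → Tm v → Atom v
rel₃ r a b c = atom r (a ∷ b ∷ c ∷ lit 0 ∷ [])

-- Tags 0 and 1 answer oracle queries (0 together with a witness); tags 2 and 3 assert that a sentence
-- is ω-consistent over Q, respectively that some formula shows the contrary.
pattern Lookup xs i y  = 5 ∷ xs ∷ i ∷ y ∷ 0 ∷ []
pattern Evals e xs y   = 6 ∷ e ∷ xs ∷ y ∷ 0 ∷ []
pattern Evals* es xs ys = 7 ∷ es ∷ xs ∷ ys ∷ 0 ∷ []
pattern NoZero e xs y  = 8 ∷ e ∷ xs ∷ y ∷ 0 ∷ []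
pattern Program k e    = 9 ∷ k ∷ e ∷ 0 ∷ 0 ∷ []
pattern Programs k m es = 10 ∷ k ∷ m ∷ es ∷ 0 ∷ []
pattern Halts m        = 11 ∷ m ∷ 0 ∷ 0 ∷ 0 ∷ []
pattern SubVar s i t   = 12 ∷ s ∷ i ∷ t ∷ 0 ∷ []
pattern SubTerm s t u  = 13 ∷ s ∷ t ∷ u ∷ 0 ∷ []
pattern SubForm s φ ψ  = 14 ∷ s ∷ φ ∷ ψ ∷ 0 ∷ []
pattern Numeral n t    = 15 ∷ n ∷ t ∷ 0 ∷ 0 ∷ []
pattern QAx φ          = 16 ∷ φ ∷ 0 ∷ 0 ∷ 0 ∷ []
pattern Proves α φ     = 17 ∷ α ∷ φ ∷ 0 ∷ 0 ∷ []
pattern Refutes α ψ n  = 18 ∷ α ∷ ψ ∷ n ∷ 0 ∷ []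
pattern Axiom φ θ e    = 19 ∷ φ ∷ θ ∷ e ∷ 0 ∷ []

lookupᵃ evalᵃ evalsᵃ noZeroᵃ programsᵃ subVarᵃ subTermᵃ subFormᵃ refutesᵃ axiomᵃ :
  {v : ℕ} → Tm v → Tm v → Tm v → Atom v
lookupᵃ = rel₃ 5
evalᵃ = rel₃ 6
evalsᵃ = rel₃ 7
noZeroᵃ = rel₃ 8
programsᵃ = rel₃ 10
subVarᵃ = rel₃ 12
subTermᵃ = rel₃ 13
subFormᵃ = rel₃ 14
refutesᵃ = rel₃ 18
axiomᵃ = rel₃ 19

programᵃ numeralᵃ provesᵃ : {v : ℕ} → Tm v → Tm v → Atom v
programᵃ = rel₂ 9
numeralᵃ = rel₂ 15
provesᵃ = rel₂ 17

haltsᵃ qaxᵃ : {v : ℕ} → Tm v → Atom v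
haltsᵃ = rel₁ 11
qaxᵃ = rel₁ 16

infix 1 _▹_⇐_
_▹_⇐_ : (v : ℕ) (q : Atom v) → List (Atom v) → {3<q : True (4 ≤? tag q)} → Clause
(v ▹ q ⇐ qs) {3<q} = (q ⇐ qs) {3<q}

pattern v0 = ` zero
pattern v1 = ` (suc zero)
pattern v2 = ` (suc (suc zero))
pattern v3 = ` (suc (suc (suc zero)))
pattern v4 = ` (suc (suc (suc (suc zero))))
pattern v5 = ` (suc (suc (suc (suc (suc zero)))))
pattern v6 = ` (suc (suc (suc (suc (suc (suc zero))))))
pattern v7 = ` (suc (suc (suc (suc (suc (suc (suc zero)))))))

quoteT : {k v : ℕ} → Term k → Tm v
quoteT (var i) = 0 ◂ lit (toℕ i)
quoteT zer = 1 ◂ lit 0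
quoteT (S t) = 2 ◂ quoteT t
quoteT (t +' u) = 3 ◂ quoteT t ⊙ quoteT u
quoteT (t ·' u) = 4 ◂ quoteT t ⊙ quoteT u

quoteF : {k v : ℕ} → Formula k → Tm v
quoteF (t ≐ u) = 0 ◂ quoteT t ⊙ quoteT u
quoteF (t ≼ u) = 1 ◂ quoteT t ⊙ quoteT u
quoteF ⊥' = 2 ◂ lit 0
quoteF (¬' φ) = 3 ◂ quoteF φ
quoteF (φ ∧' ψ) = 4 ◂ quoteF φ ⊙ quoteF ψ
quoteF (φ ∨' ψ) = 5 ◂ quoteF φ ⊙ quoteF ψ
quoteF (φ ⇒' ψ) = 6 ◂ quoteF φ ⊙ quoteF ψ
quoteF (∀' φ) = 7 ◂ quoteF φ
quoteF (∃' φ) = 8 ◂ quoteF φ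

quoteT-code : {k v : ℕ} (t : Term k) (xs : Vec ℕ v) → ⟦ quoteT t ⟧ᵐ xs ≡ cT t
quoteT-code (var i) xs = refl
quoteT-code zer xs = refl
quoteT-code (S t) xs = cong (2 ∙_) (quoteT-code t xs)
quoteT-code (t +' u) xs = cong₂ (λ a b → 3 ∙ a ∙ b) (quoteT-code t xs) (quoteT-code u xs)
quoteT-code (t ·' u) xs = cong₂ (λ a b → 4 ∙ a ∙ b) (quoteT-code t xs) (quoteT-code u xs)

quoteF-code : {k v : ℕ} (φ : Formula k) (xs : Vec ℕ v) → ⟦ quoteF φ ⟧ᵐ xs ≡ cF φ
quoteF-code (t ≐ u) xs = cong₂ (λ a b → 0 ∙ a ∙ b) (quoteT-code t xs) (quoteT-code u xs)
quoteF-code (t ≼ u) xs = cong₂ (λ a b → 1 ∙ a ∙ b) (quoteT-code t xs) (quoteT-code u xs)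
quoteF-code ⊥' xs = refl
quoteF-code (¬' φ) xs = cong (3 ∙_) (quoteF-code φ xs)
quoteF-code (φ ∧' ψ) xs = cong₂ (λ a b → 4 ∙ a ∙ b) (quoteF-code φ xs) (quoteF-code ψ xs)
quoteF-code (φ ∨' ψ) xs = cong₂ (λ a b → 5 ∙ a ∙ b) (quoteF-code φ xs) (quoteF-code ψ xs)
quoteF-code (φ ⇒' ψ) xs = cong₂ (λ a b → 6 ∙ a ∙ b) (quoteF-code φ xs) (quoteF-code ψ xs)
quoteF-code (∀' φ) xs = cong (7 ∙_) (quoteF-code φ xs)
quoteF-code (∃' φ) xs = cong (8 ∙_) (quoteF-code φ xs)

qaxiom : {α : Sentence} → QAxiom α → Clause
qaxiom {α} _ = 0 ▹ qaxᵃ (quoteF α) ⇐ []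

infixr 6 _⇒ˢ_
-- Read both as clause terms and as formulas, so that the twelve propositional axioms share one
-- soundness argument.
data Schema : Set where
  mv            : Fin 3 → Schema
  ⊥ˢ            : Schema
  ¬ˢ            : Schema → Schema
  _∧ˢ_ _∨ˢ_ _⇒ˢ_ : Schema → Schema → Schema

infixr 7 _∧ˢ_ _∨ˢ_

instantiate : {k : ℕ} → (Fin 3 → Formula k) → Schema → Formula k
instantiate θ (mv i) = θ i
instantiate θ ⊥ˢ = ⊥'
instantiate θ (¬ˢ s) = ¬' instantiate θ s
instantiate θ (s ∧ˢ t) = instantiate θ s ∧' instantiate θ t
instantiate θ (s ∨ˢ t) = instantiate θ s ∨' instantiate θ t
instantiate θ (s ⇒ˢ t) = instantiate θ s ⇒' instantiate θ t

-- Variable 0 of the clause is the additional axiom of the theory, 1 to 3 are the codes of the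
-- metavariables, 4 to 6 those of their weakenings.
schemaᵐ : Schema → Tm 7
schemaᵐ (mv i) = ` (suc (i Data.Fin.↑ˡ 3))
schemaᵐ ⊥ˢ = 2 ◂ lit 0
schemaᵐ (¬ˢ s) = 3 ◂ schemaᵐ s
schemaᵐ (s ∧ˢ t) = 4 ◂ schemaᵐ s ⊙ schemaᵐ t
schemaᵐ (s ∨ˢ t) = 5 ◂ schemaᵐ s ⊙ schemaᵐ t
schemaᵐ (s ⇒ˢ t) = 6 ◂ schemaᵐ s ⊙ schemaᵐ t

-- A premise subFormᵃ wkᵐ φ φ′ only serves to say that φ is the code of a formula.
propositional : Schema → Clause
propositional s = 7 ▹ provesᵃ v0 (schemaᵐ s) ⇐
  subFormᵃ wkᵐ v1 v4 ∷ subFormᵃ wkᵐ v2 v5 ∷ subFormᵃ wkᵐ v3 v6 ∷ []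

A B C : Schema
A = mv (# 0)
B = mv (# 1)
C = mv (# 2)

schema-A1 schema-A2 schema-∧E₁ schema-∧E₂ schema-∧I schema-∨I₁ schema-∨I₂ schema-∨E schema-⊥E
  schema-¬E schema-¬I schema-DNE : Schema
schema-A1 = A ⇒ˢ B ⇒ˢ A
schema-A2 = (A ⇒ˢ B ⇒ˢ C) ⇒ˢ (A ⇒ˢ B) ⇒ˢ A ⇒ˢ C
schema-∧E₁ = A ∧ˢ B ⇒ˢ A
schema-∧E₂ = A ∧ˢ B ⇒ˢ B
schema-∧I = A ⇒ˢ B ⇒ˢ A ∧ˢ B
schema-∨I₁ = A ⇒ˢ A ∨ˢ B
schema-∨I₂ = B ⇒ˢ A ∨ˢ B
schema-∨E = (A ⇒ˢ C) ⇒ˢ (B ⇒ˢ C) ⇒ˢ A ∨ˢ B ⇒ˢ C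
schema-⊥E = ⊥ˢ ⇒ˢ A
schema-¬E = ¬ˢ A ⇒ˢ A ⇒ˢ ⊥ˢ
schema-¬I = (A ⇒ˢ ⊥ˢ) ⇒ˢ ¬ˢ A
schema-DNE = ¬ˢ (¬ˢ A) ⇒ˢ A

pattern lookup-zero = zero
pattern lookup-suc = suc lookup-zero
pattern eval-Z = suc lookup-suc
pattern eval-Succ = suc eval-Z
pattern eval-Proj = suc eval-Succ
pattern eval-Comp = suc eval-Proj
pattern eval-Rec0 = suc eval-Comp
pattern eval-RecS = suc eval-Rec0
pattern eval-Mu = suc eval-RecS
pattern eval-Orc1 = suc eval-Mu
pattern eval-Orc0 = suc eval-Orc1
pattern evals-[] = suc eval-Orc0
pattern evals-∷ = suc evals-[]
pattern noZero-zero = suc evals-∷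
pattern noZero-suc = suc noZero-zero
pattern program-Z = suc noZero-suc
pattern program-Succ = suc program-Z
pattern program-Proj = suc program-Succ
pattern program-Comp = suc program-Proj
pattern program-Rec = suc program-Comp
pattern program-Mu = suc program-Rec
pattern program-Orc = suc program-Mu
pattern programs-[] = suc program-Orc
pattern programs-∷ = suc programs-[]
pattern halts = suc programs-∷
pattern weaken-var = suc halts
pattern inst-zero = suc weaken-var
pattern inst-suc = suc inst-zero
pattern under-zero = suc inst-suc
pattern under-suc = suc under-zero
pattern sub-var = suc under-suc
pattern sub-zer = suc sub-var
pattern sub-S = suc sub-zer
pattern sub-+ = suc sub-S
pattern sub-· = suc sub-+
pattern sub-≐ = suc sub-·
pattern sub-≼ = suc sub-≐
pattern sub-⊥ = suc sub-≼
pattern sub-¬ = suc sub-⊥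
pattern sub-∧ = suc sub-¬
pattern sub-∨ = suc sub-∧
pattern sub-⇒ = suc sub-∨
pattern sub-∀ = suc sub-⇒
pattern sub-∃ = suc sub-∀
pattern num-zero = suc sub-∃
pattern num-suc = suc num-zero
pattern axiom-Q1 = suc num-suc
pattern axiom-Q2 = suc axiom-Q1
pattern axiom-Q3 = suc axiom-Q2
pattern axiom-Q4 = suc axiom-Q3
pattern axiom-Q5 = suc axiom-Q4
pattern axiom-Q6 = suc axiom-Q5
pattern axiom-Q7 = suc axiom-Q6
pattern axiom-Q8 = suc axiom-Q7
pattern proves-self = suc axiom-Q8
pattern proves-Q = suc proves-self
pattern proves-A1 = suc proves-Q
pattern proves-A2 = suc proves-A1
pattern proves-∧E₁ = suc proves-A2
pattern proves-∧E₂ = suc proves-∧E₁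
pattern proves-∧I = suc proves-∧E₂
pattern proves-∨I₁ = suc proves-∧I
pattern proves-∨I₂ = suc proves-∨I₁
pattern proves-∨E = suc proves-∨I₂
pattern proves-⊥E = suc proves-∨E
pattern proves-¬E = suc proves-⊥E
pattern proves-¬I = suc proves-¬E
pattern proves-DNE = suc proves-¬I
pattern proves-∀E = suc proves-DNE
pattern proves-∃I = suc proves-∀E
pattern proves-∀I = suc proves-∃I
pattern proves-∃Elim = suc proves-∀I
pattern proves-≐refl = suc proves-∃Elim
pattern proves-≐subst = suc proves-≐refl
pattern proves-MP = suc proves-≐subst
pattern refutes = suc proves-MP
pattern axiom-Q = suc refutes
pattern axiom-pos = suc axiom-Q
pattern axiom-neg = suc axiom-pos

clauses : Fin 79 → Clause
clauses lookup-zero = 2 ▹ lookupᵃ (consᵐ v0 v1) (lit 0) v0 ⇐ []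
clauses lookup-suc = 4 ▹ lookupᵃ (consᵐ v0 v1) (sc v2) v3 ⇐ lookupᵃ v1 v2 v3 ∷ []
clauses eval-Z = 2 ▹ evalᵃ (0 ◂ v0) v1 (lit 0) ⇐ []
clauses eval-Succ = 1 ▹ evalᵃ (1 ◂ lit 0) (consᵐ v0 (lit 0)) (sc v0) ⇐ []
clauses eval-Proj = 4 ▹ evalᵃ (2 ◂ v0 ⊙ v1) v2 v3 ⇐ lookupᵃ v2 v1 v3 ∷ []
clauses eval-Comp = 5 ▹ evalᵃ (3 ◂ v0 ⊙ v1) v2 v3 ⇐ evalsᵃ v1 v2 v4 ∷ evalᵃ v0 v4 v3 ∷ []
clauses eval-Rec0 = 4 ▹ evalᵃ (4 ◂ v0 ⊙ v1) (consᵐ (lit 0) v2) v3 ⇐ evalᵃ v0 v2 v3 ∷ []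
clauses eval-RecS = 6 ▹ evalᵃ (4 ◂ v0 ⊙ v1) (consᵐ (sc v2) v3) v4 ⇐
  evalᵃ (4 ◂ v0 ⊙ v1) (consᵐ v2 v3) v5 ∷ evalᵃ v1 (consᵐ v2 (consᵐ v5 v3)) v4 ∷ []
clauses eval-Mu = 3 ▹ evalᵃ (5 ◂ v0) v1 v2 ⇐ evalᵃ v0 (consᵐ v2 v1) (lit 0) ∷ noZeroᵃ v0 v1 v2 ∷ []
clauses eval-Orc1 = 4 ▹ evalᵃ (6 ◂ lit 0) (consᵐ v0 (lit 0)) (lit 1) ⇐ atom 0 (v0 ∷ v1 ∷ v2 ∷ v3 ∷ []) ∷ []
clauses eval-Orc0 = 1 ▹ evalᵃ (6 ◂ lit 0) (consᵐ v0 (lit 0)) (lit 0) ⇐ rel₁ 1 v0 ∷ []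
clauses evals-[] = 1 ▹ evalsᵃ (lit 0) v0 (lit 0) ⇐ []
clauses evals-∷ = 5 ▹ evalsᵃ (consᵐ v0 v1) v2 (consᵐ v3 v4) ⇐ evalᵃ v0 v2 v3 ∷ evalsᵃ v1 v2 v4 ∷ []
clauses noZero-zero = 2 ▹ noZeroᵃ v0 v1 (lit 0) ⇐ []
clauses noZero-suc = 4 ▹ noZeroᵃ v0 v1 (sc v2) ⇐ noZeroᵃ v0 v1 v2 ∷ evalᵃ v0 (consᵐ v2 v1) (sc v3) ∷ []
clauses program-Z = 1 ▹ programᵃ v0 (0 ◂ v0) ⇐ []
clauses program-Succ = 0 ▹ programᵃ (lit 1) (1 ◂ lit 0) ⇐ []
-- Writing the arity as i + 1 + j expresses that the index i lies below it.
clauses program-Proj = 2 ▹ programᵃ (sc (v0 ⊞ v1)) (2 ◂ sc (v0 ⊞ v1) ⊙ v0) ⇐ []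
clauses program-Comp = 4 ▹ programᵃ v0 (3 ◂ v1 ⊙ v2) ⇐ programsᵃ v0 v3 v2 ∷ programᵃ v3 v1 ∷ []
clauses program-Rec = 3 ▹ programᵃ (sc v0) (4 ◂ v1 ⊙ v2) ⇐ programᵃ v0 v1 ∷ programᵃ (sc (sc v0)) v2 ∷ []
clauses program-Mu = 2 ▹ programᵃ v0 (5 ◂ v1) ⇐ programᵃ (sc v0) v1 ∷ []
clauses program-Orc = 0 ▹ programᵃ (lit 1) (6 ◂ lit 0) ⇐ []
clauses programs-[] = 1 ▹ programsᵃ v0 (lit 0) (lit 0) ⇐ []
clauses programs-∷ = 4 ▹ programsᵃ v0 (sc v1) (consᵐ v2 v3) ⇐ programᵃ v0 v2 ∷ programsᵃ v0 v1 v3 ∷ []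
-- Evaluation facts are meaningful only for codes of programs, whereas membership in the jump has to
-- produce a program; the first premise supplies one, of arity 1.
clauses halts = 2 ▹ haltsᵃ v0 ⇐ programᵃ (lit 1) v0 ∷ evalᵃ v0 (consᵐ v0 (lit 0)) v1 ∷ []
clauses weaken-var = 1 ▹ subVarᵃ wkᵐ v0 (0 ◂ sc v0) ⇐ []
clauses inst-zero = 1 ▹ subVarᵃ (1 ◂ v0) (lit 0) v0 ⇐ []
clauses inst-suc = 2 ▹ subVarᵃ (1 ◂ v0) (sc v1) (0 ◂ v1) ⇐ []
clauses under-zero = 1 ▹ subVarᵃ (2 ◂ v0) (lit 0) (0 ◂ lit 0) ⇐ []
clauses under-suc = 4 ▹ subVarᵃ (2 ◂ v0) (sc v1) v3 ⇐ subVarᵃ v0 v1 v2 ∷ subTermᵃ wkᵐ v2 v3 ∷ []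
clauses sub-var = 3 ▹ subTermᵃ v0 (0 ◂ v1) v2 ⇐ subVarᵃ v0 v1 v2 ∷ []
clauses sub-zer = 1 ▹ subTermᵃ v0 (1 ◂ lit 0) (1 ◂ lit 0) ⇐ []
clauses sub-S = 3 ▹ subTermᵃ v0 (2 ◂ v1) (2 ◂ v2) ⇐ subTermᵃ v0 v1 v2 ∷ []
clauses sub-+ = 5 ▹ subTermᵃ v0 (3 ◂ v1 ⊙ v2) (3 ◂ v3 ⊙ v4) ⇐ subTermᵃ v0 v1 v3 ∷ subTermᵃ v0 v2 v4 ∷ []
clauses sub-· = 5 ▹ subTermᵃ v0 (4 ◂ v1 ⊙ v2) (4 ◂ v3 ⊙ v4) ⇐ subTermᵃ v0 v1 v3 ∷ subTermᵃ v0 v2 v4 ∷ []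
clauses sub-≐ = 5 ▹ subFormᵃ v0 (0 ◂ v1 ⊙ v2) (0 ◂ v3 ⊙ v4) ⇐ subTermᵃ v0 v1 v3 ∷ subTermᵃ v0 v2 v4 ∷ []
clauses sub-≼ = 5 ▹ subFormᵃ v0 (1 ◂ v1 ⊙ v2) (1 ◂ v3 ⊙ v4) ⇐ subTermᵃ v0 v1 v3 ∷ subTermᵃ v0 v2 v4 ∷ []
clauses sub-⊥ = 1 ▹ subFormᵃ v0 (2 ◂ lit 0) (2 ◂ lit 0) ⇐ []
clauses sub-¬ = 3 ▹ subFormᵃ v0 (3 ◂ v1) (3 ◂ v2) ⇐ subFormᵃ v0 v1 v2 ∷ []
clauses sub-∧ = 5 ▹ subFormᵃ v0 (4 ◂ v1 ⊙ v2) (4 ◂ v3 ⊙ v4) ⇐ subFormᵃ v0 v1 v3 ∷ subFormᵃ v0 v2 v4 ∷ []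
clauses sub-∨ = 5 ▹ subFormᵃ v0 (5 ◂ v1 ⊙ v2) (5 ◂ v3 ⊙ v4) ⇐ subFormᵃ v0 v1 v3 ∷ subFormᵃ v0 v2 v4 ∷ []
clauses sub-⇒ = 5 ▹ subFormᵃ v0 (6 ◂ v1 ⊙ v2) (6 ◂ v3 ⊙ v4) ⇐ subFormᵃ v0 v1 v3 ∷ subFormᵃ v0 v2 v4 ∷ []
clauses sub-∀ = 3 ▹ subFormᵃ v0 (7 ◂ v1) (7 ◂ v2) ⇐ subFormᵃ (2 ◂ v0) v1 v2 ∷ []
clauses sub-∃ = 3 ▹ subFormᵃ v0 (8 ◂ v1) (8 ◂ v2) ⇐ subFormᵃ (2 ◂ v0) v1 v2 ∷ []
clauses num-zero = 0 ▹ numeralᵃ (lit 0) (1 ◂ lit 0) ⇐ []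
clauses num-suc = 2 ▹ numeralᵃ (sc v0) (2 ◂ v1) ⇐ numeralᵃ v0 v1 ∷ []
clauses axiom-Q1 = qaxiom Q1
clauses axiom-Q2 = qaxiom Q2
clauses axiom-Q3 = qaxiom Q3
clauses axiom-Q4 = qaxiom Q4
clauses axiom-Q5 = qaxiom Q5
clauses axiom-Q6 = qaxiom Q6
clauses axiom-Q7 = qaxiom Q7
clauses axiom-Q8 = qaxiom Q8
clauses proves-self = 1 ▹ provesᵃ v0 v0 ⇐ []
clauses proves-Q = 2 ▹ provesᵃ v0 v1 ⇐ qaxᵃ v1 ∷ []
clauses proves-A1 = propositional schema-A1
clauses proves-A2 = propositional schema-A2
clauses proves-∧E₁ = propositional schema-∧E₁
clauses proves-∧E₂ = propositional schema-∧E₂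
clauses proves-∧I = propositional schema-∧I
clauses proves-∨I₁ = propositional schema-∨I₁
clauses proves-∨I₂ = propositional schema-∨I₂
clauses proves-∨E = propositional schema-∨E
clauses proves-⊥E = propositional schema-⊥E
clauses proves-¬E = propositional schema-¬E
clauses proves-¬I = propositional schema-¬I
clauses proves-DNE = propositional schema-DNE
clauses proves-∀E = 5 ▹ provesᵃ v0 ((7 ◂ v1) ⇒ᵐ v3) ⇐ subFormᵃ (1 ◂ v2) v1 v3 ∷ subTermᵃ wkᵐ v2 v4 ∷ []
clauses proves-∃I = 5 ▹ provesᵃ v0 (v3 ⇒ᵐ (8 ◂ v1)) ⇐ subFormᵃ (1 ◂ v2) v1 v3 ∷ subTermᵃ wkᵐ v2 v4 ∷ []
clauses proves-∀I = 5 ▹ provesᵃ v0 (v1 ⇒ᵐ (7 ◂ v2)) ⇐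
  subFormᵃ wkᵐ v1 v3 ∷ subFormᵃ wkᵐ v2 v4 ∷ provesᵃ v0 (v3 ⇒ᵐ v2) ∷ []
clauses proves-∃Elim = 5 ▹ provesᵃ v0 ((8 ◂ v2) ⇒ᵐ v1) ⇐
  subFormᵃ wkᵐ v1 v3 ∷ subFormᵃ wkᵐ v2 v4 ∷ provesᵃ v0 (v2 ⇒ᵐ v3) ∷ []
clauses proves-≐refl = 3 ▹ provesᵃ v0 (0 ◂ v1 ⊙ v1) ⇐ subTermᵃ wkᵐ v1 v2 ∷ []
clauses proves-≐subst = 8 ▹ provesᵃ v0 ((0 ◂ v1 ⊙ v2) ⇒ᵐ v4 ⇒ᵐ v5) ⇐
  subTermᵃ wkᵐ v1 v6 ∷ subTermᵃ wkᵐ v2 v7 ∷ subFormᵃ (1 ◂ v1) v3 v4 ∷ subFormᵃ (1 ◂ v2) v3 v5 ∷ []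
clauses proves-MP = 4 ▹ provesᵃ v0 v2 ⇐ provesᵃ v0 (v1 ⇒ᵐ v2) ∷ provesᵃ v0 v1 ∷ subFormᵃ wkᵐ v1 v3 ∷ []
clauses refutes = 6 ▹ refutesᵃ v0 v1 v2 ⇐ subFormᵃ wkᵐ v1 v3 ∷ provesᵃ v0 (8 ◂ v1) ∷
  numeralᵃ v2 v4 ∷ subFormᵃ (1 ◂ v4) v1 v5 ∷ provesᵃ v0 (3 ◂ v5) ∷ []
clauses axiom-Q = 3 ▹ axiomᵃ v0 v1 v2 ⇐ qaxᵃ v0 ∷ []
-- If v1 codes a formula θ of two variables, v3 codes the numeral of that code and v4 the formula
-- obtained by substituting this numeral in θ. The program v2 is thus run on a diagonal instance,
-- and its value v0 becomes an axiom.
clauses axiom-pos = 5 ▹ axiomᵃ v0 v1 v2 ⇐ numeralᵃ v1 v3 ∷ subFormᵃ (1 ◂ v3) v1 v4 ∷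
  evalᵃ v2 (consᵐ v4 (lit 0)) v0 ∷ rel₁ 2 v0 ∷ []
clauses axiom-neg = 6 ▹ axiomᵃ (3 ◂ v0) v1 v2 ⇐ numeralᵃ v1 v3 ∷ subFormᵃ (1 ◂ v3) v1 v4 ∷
  evalᵃ v2 (consᵐ v4 (lit 0)) v0 ∷ rel₂ 3 v0 v5 ∷ []

-- Completeness of the clauses

module Complete (O : Pred 5) where

  open Horn clauses O public
  open Inductive J O public

  lookup-complete : ∀ {k} (xs : Vec ℕ k) i → I (Lookup (cV xs) (toℕ i) (lookup xs i))
  lookup-complete (x ∷ xs) zero = derive lookup-zero (x ∷ cV xs ∷ []) tt
  lookup-complete (x ∷ xs) (suc i) =
    derive lookup-suc (x ∷ cV xs ∷ toℕ i ∷ lookup xs i ∷ []) (lookup-complete xs i , tt)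

  program-complete : ∀ {k} (e : Prog k) → I (Program k (cP e))
  programs-complete : ∀ {k m} (es : Vec (Prog k) m) → I (Programs k m (cPs es))
  program-complete {k} Z = derive program-Z (k ∷ []) tt
  program-complete Succ = derive program-Succ [] tt
  program-complete {k} (Proj i) =
    subst (λ k → I (Program k (2 ∙ k ∙ toℕ i))) (m+[n∸m]≡n (toℕ<n i))
      (derive program-Proj (toℕ i ∷ k ∸ suc (toℕ i) ∷ []) tt)
  program-complete {k} (Comp {m = m} f gs) =
    derive program-Comp (k ∷ cP f ∷ cPs gs ∷ m ∷ []) (programs-complete gs , program-complete f , tt)
  program-complete {suc k} (Rec g h) =
    derive program-Rec (k ∷ cP g ∷ cP h ∷ []) (program-complete g , program-complete h , tt)
  program-complete {k} (Mu f) = derive program-Mu (k ∷ cP f ∷ []) (program-complete f , tt)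
  program-complete Orc = derive program-Orc [] tt
  programs-complete {k} [] = derive programs-[] (k ∷ []) tt
  programs-complete {k} (_∷_ {m} g gs) =
    derive programs-∷ (k ∷ m ∷ cP g ∷ cPs gs ∷ []) (program-complete g , programs-complete gs , tt)

  module _ {A : Oracle}
           (orc1 : ∀ q → A q → ¬ ¬ Σ ℕ λ a → Σ ℕ λ b → Σ ℕ λ c → I (0 ∷ q ∷ a ∷ b ∷ c ∷ []))
           (orc0 : ∀ q → ¬ A q → I (1 ∷ q ∷ 0 ∷ 0 ∷ 0 ∷ [])) where

    eval-complete : ∀ {k} {e : Prog k} {xs y} → Eval A e xs y → ¬ ¬ I (Evals (cP e) (cV xs) y)
    evals-complete : ∀ {k m} {es : Vec (Prog k) m} {xs ys} → EvalV A es xs ys →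
                     ¬ ¬ I (Evals* (cPs es) (cV xs) (cV ys))
    noZero-complete : ∀ {k} {e : Prog (suc k)} {xs} y →
      ((z : ℕ) → suc z ≤ y → Σ ℕ λ v → Eval A e (z ∷ xs) (suc v)) → ¬ ¬ I (NoZero (cP e) (cV xs) y)
    eval-complete {k} (eZ {xs = xs}) = return (derive eval-Z (k ∷ cV xs ∷ []) tt)
    eval-complete (eSucc {x}) = return (derive eval-Succ (x ∷ []) tt)
    eval-complete {k} (eProj {i = i} {xs}) = return
      (derive eval-Proj (k ∷ toℕ i ∷ cV xs ∷ lookup xs i ∷ []) (lookup-complete xs i , tt))
    eval-complete (eComp {f = f} {gs} {xs} {ys} {y} ds d) = do
      is ← evals-complete ds
      i ← eval-complete d
      return (derive eval-Comp (cP f ∷ cPs gs ∷ cV xs ∷ y ∷ cV ys ∷ []) (is , i , tt))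
    eval-complete (eRec0 {g = g} {h} {xs} {y} d) = do
      i ← eval-complete d
      return (derive eval-Rec0 (cP g ∷ cP h ∷ cV xs ∷ y ∷ []) (i , tt))
    eval-complete (eRecS {g = g} {h} {xs} {n} {r} {y} d d′) = do
      i ← eval-complete d
      j ← eval-complete d′
      return (derive eval-RecS (cP g ∷ cP h ∷ n ∷ cV xs ∷ y ∷ r ∷ []) (i , j , tt))
    eval-complete (eMu {f = f} {xs} {y} d ds) = do
      i ← eval-complete d
      j ← noZero-complete y ds
      return (derive eval-Mu (cP f ∷ cV xs ∷ y ∷ []) (i , j , tt))
    eval-complete (eOrc1 {q} a) = do
      (b , c , d , i) ← orc1 q a
      return (derive eval-Orc1 (q ∷ b ∷ c ∷ d ∷ []) (i , tt))
    eval-complete (eOrc0 {q} na) = return (derive eval-Orc0 (q ∷ []) (orc0 q na , tt))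
    evals-complete ([]ᵉ {xs = xs}) = return (derive evals-[] (cV xs ∷ []) tt)
    evals-complete (_∷ᵉᵛ_ {g = g} {gs} {xs} {y} {ys} d ds) = do
      i ← eval-complete d
      is ← evals-complete ds
      return (derive evals-∷ (cP g ∷ cPs gs ∷ cV xs ∷ y ∷ cV ys ∷ []) (i , is , tt))
    noZero-complete {e = e} {xs} zero ds = return (derive noZero-zero (cP e ∷ cV xs ∷ []) tt)
    noZero-complete {e = e} {xs} (suc y) ds = do
      i ← noZero-complete y (λ z z<y → ds z (m≤n⇒m≤1+n z<y))
      j ← eval-complete (proj₂ (ds y ≤-refl))
      return (derive noZero-suc (cP e ∷ cV xs ∷ y ∷ proj₁ (ds y ≤-refl) ∷ []) (i , j , tt))

    halts-complete : ∀ {m} → jump A m → ¬ ¬ I (Halts m)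
    halts-complete (e , refl , y , d) = do
      i ← eval-complete d
      return (subst (λ m → I (Halts m)) (cP≡ e) (derive halts (cP e ∷ y ∷ [])
        (program-complete e , subst (λ m → I (Evals (cP e) (cV (m ∷ [])) y)) (sym (cP≡ e)) i , tt)))

  SubVarComplete : ∀ {k l} → Desc k l → Set
  SubVarComplete {k} D = ∀ (i : Fin k) → I (SubVar (cD D) (toℕ i) (cT (sub D i)))

  -- The variable case is a hypothesis because the variable case of `under` already uses weakening
  -- of whole terms; weakening is settled first, then all descriptions.
  subTerm-from : ∀ {k l} (D : Desc k l) → SubVarComplete D →
                 ∀ t → I (SubTerm (cD D) (cT t) (cT (subT (sub D) t)))
  subTerm-from D h (var i) = derive sub-var (cD D ∷ toℕ i ∷ cT (sub D i) ∷ []) (h i , tt)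
  subTerm-from D h zer = derive sub-zer (cD D ∷ []) tt
  subTerm-from D h (S t) =
    derive sub-S (cD D ∷ cT t ∷ cT (subT (sub D) t) ∷ []) (subTerm-from D h t , tt)
  subTerm-from D h (t +' u) =
    derive sub-+ (cD D ∷ cT t ∷ cT u ∷ cT (subT (sub D) t) ∷ cT (subT (sub D) u) ∷ [])
      (subTerm-from D h t , subTerm-from D h u , tt)
  subTerm-from D h (t ·' u) =
    derive sub-· (cD D ∷ cT t ∷ cT u ∷ cT (subT (sub D) t) ∷ cT (subT (sub D) u) ∷ [])
      (subTerm-from D h t , subTerm-from D h u , tt)

  weaken-complete : ∀ {k} → SubVarComplete (weaken {k})
  weaken-complete i = derive weaken-var (toℕ i ∷ []) tt

  subVar-complete : ∀ {k l} (D : Desc k l) → SubVarComplete D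
  subVar-complete weaken i = weaken-complete i
  subVar-complete (inst t) zero = derive inst-zero (cT t ∷ []) tt
  subVar-complete (inst t) (suc i) = derive inst-suc (cT t ∷ toℕ i ∷ []) tt
  subVar-complete (under D) zero = derive under-zero (cD D ∷ []) tt
  subVar-complete (under D) (suc i) =
    derive under-suc (cD D ∷ toℕ i ∷ cT (sub D i) ∷ cT (wkT (sub D i)) ∷ [])
      ( subVar-complete D i
      , subst (λ t → I (SubTerm (0 ∙ 0) (cT (sub D i)) (cT t))) (wkT≡sub (sub D i))
          (subTerm-from weaken weaken-complete (sub D i))
      , tt)

  subTerm-complete : ∀ {k l} (D : Desc k l) t → I (SubTerm (cD D) (cT t) (cT (subT (sub D) t)))
  subTerm-complete D = subTerm-from D (subVar-complete D)

  subForm-complete : ∀ {k l} (D : Desc k l) φ → I (SubForm (cD D) (cF φ) (cF (subF (sub D) φ)))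
  subForm-complete D (t ≐ u) =
    derive sub-≐ (cD D ∷ cT t ∷ cT u ∷ cT (subT (sub D) t) ∷ cT (subT (sub D) u) ∷ [])
      (subTerm-complete D t , subTerm-complete D u , tt)
  subForm-complete D (t ≼ u) =
    derive sub-≼ (cD D ∷ cT t ∷ cT u ∷ cT (subT (sub D) t) ∷ cT (subT (sub D) u) ∷ [])
      (subTerm-complete D t , subTerm-complete D u , tt)
  subForm-complete D ⊥' = derive sub-⊥ (cD D ∷ []) tt
  subForm-complete D (¬' φ) =
    derive sub-¬ (cD D ∷ cF φ ∷ cF (subF (sub D) φ) ∷ []) (subForm-complete D φ , tt)
  subForm-complete D (φ ∧' ψ) =
    derive sub-∧ (cD D ∷ cF φ ∷ cF ψ ∷ cF (subF (sub D) φ) ∷ cF (subF (sub D) ψ) ∷ [])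
      (subForm-complete D φ , subForm-complete D ψ , tt)
  subForm-complete D (φ ∨' ψ) =
    derive sub-∨ (cD D ∷ cF φ ∷ cF ψ ∷ cF (subF (sub D) φ) ∷ cF (subF (sub D) ψ) ∷ [])
      (subForm-complete D φ , subForm-complete D ψ , tt)
  subForm-complete D (φ ⇒' ψ) =
    derive sub-⇒ (cD D ∷ cF φ ∷ cF ψ ∷ cF (subF (sub D) φ) ∷ cF (subF (sub D) ψ) ∷ [])
      (subForm-complete D φ , subForm-complete D ψ , tt)
  subForm-complete D (∀' φ) =
    derive sub-∀ (cD D ∷ cF φ ∷ cF (subF (extS (sub D)) φ) ∷ []) (subForm-complete (under D) φ , tt)
  subForm-complete D (∃' φ) =
    derive sub-∃ (cD D ∷ cF φ ∷ cF (subF (extS (sub D)) φ) ∷ []) (subForm-complete (under D) φ , tt)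

  wkF-complete : ∀ {k} (φ : Formula k) → I (SubForm (0 ∙ 0) (cF φ) (cF (wkF φ)))
  wkF-complete φ = subst (λ ψ → I (SubForm (0 ∙ 0) (cF φ) (cF ψ))) (wkF≡sub φ) (subForm-complete weaken φ)

  wkT-complete : ∀ {k} (t : Term k) → I (SubTerm (0 ∙ 0) (cT t) (cT (wkT t)))
  wkT-complete t = subst (λ u → I (SubTerm (0 ∙ 0) (cT t) (cT u))) (wkT≡sub t) (subTerm-complete weaken t)

  numeral-complete : ∀ {k} n → I (Numeral n (cT (num {k} n)))
  numeral-complete zero = derive num-zero [] tt
  numeral-complete {k} (suc n) = derive num-suc (n ∷ cT (num {k} n) ∷ []) (numeral-complete {k} n , tt)

  qax-complete : ∀ {α} → QAxiom α → I (QAx (cF α))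
  qax-complete {α} q = subst (λ n → I (QAx n)) (quoteF-code α []) (go q)
    where
    go : ∀ {α} → QAxiom α → I (QAx (⟦ quoteF α ⟧ᵐ []))
    go Q1 = derive axiom-Q1 [] tt
    go Q2 = derive axiom-Q2 [] tt
    go Q3 = derive axiom-Q3 [] tt
    go Q4 = derive axiom-Q4 [] tt
    go Q5 = derive axiom-Q5 [] tt
    go Q6 = derive axiom-Q6 [] tt
    go Q7 = derive axiom-Q7 [] tt
    go Q8 = derive axiom-Q8 [] tt

  module _ (y : ℕ) {T : Theory} (axioms : ∀ α → T α → ¬ ¬ I (Proves y (cF α))) where

    codes : ∀ {k} → Formula k → Formula k → Formula k → Vec ℕ 7
    codes A B C = y ∷ cF A ∷ cF B ∷ cF C ∷ cF (wkF A) ∷ cF (wkF B) ∷ cF (wkF C) ∷ []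

    formulas : ∀ {k} (A B C : Formula k) → I ⊨* premises (clauses proves-A2) at codes A B C
    formulas A B C = wkF-complete A , wkF-complete B , wkF-complete C , tt

    -- T is any theory whose axioms are derivable from the number y. It will be the diagonal theory,
    -- whose axioms can be sorted into those of Q and y only under ¬¬.
    proves-complete : ∀ {k} {φ : Formula k} → Prov T k φ → ¬ ¬ I (Proves y (cF φ))
    proves-complete (ax {α = α} a) =
      subst (λ n → ¬ ¬ I (Proves y n)) (sym (cF-renF (λ ()) α)) (axioms α a)
    proves-complete (A1 A B) = return (derive proves-A1 (codes A B A) (formulas A B A))
    proves-complete (A2 A B C) = return (derive proves-A2 (codes A B C) (formulas A B C))
    proves-complete (∧E₁ A B) = return (derive proves-∧E₁ (codes A B A) (formulas A B A))
    proves-complete (∧E₂ A B) = return (derive proves-∧E₂ (codes A B A) (formulas A B A))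
    proves-complete (∧I A B) = return (derive proves-∧I (codes A B A) (formulas A B A))
    proves-complete (∨I₁ A B) = return (derive proves-∨I₁ (codes A B A) (formulas A B A))
    proves-complete (∨I₂ A B) = return (derive proves-∨I₂ (codes A B A) (formulas A B A))
    proves-complete (∨E A B C) = return (derive proves-∨E (codes A B C) (formulas A B C))
    proves-complete (⊥E A) = return (derive proves-⊥E (codes A A A) (formulas A A A))
    proves-complete (¬E A) = return (derive proves-¬E (codes A A A) (formulas A A A))
    proves-complete (¬I A) = return (derive proves-¬I (codes A A A) (formulas A A A))
    proves-complete (DNE A) = return (derive proves-DNE (codes A A A) (formulas A A A))
    proves-complete (∀E φ t) = return
      (derive proves-∀E (y ∷ cF φ ∷ cT t ∷ cF (φ [ t ]) ∷ cT (wkT t) ∷ [])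
        (subForm-complete (inst t) φ , wkT-complete t , tt))
    proves-complete (∃I φ t) = return
      (derive proves-∃I (y ∷ cF φ ∷ cT t ∷ cF (φ [ t ]) ∷ cT (wkT t) ∷ [])
        (subForm-complete (inst t) φ , wkT-complete t , tt))
    proves-complete (∀I {ψ = ψ} {φ} d) = do
      i ← proves-complete d
      return (derive proves-∀I (y ∷ cF ψ ∷ cF φ ∷ cF (wkF ψ) ∷ cF (wkF φ) ∷ [])
        (wkF-complete ψ , wkF-complete φ , i , tt))
    proves-complete (∃Elim {ψ = ψ} {φ} d) = do
      i ← proves-complete d
      return (derive proves-∃Elim (y ∷ cF ψ ∷ cF φ ∷ cF (wkF ψ) ∷ cF (wkF φ) ∷ [])
        (wkF-complete ψ , wkF-complete φ , i , tt))
    proves-complete (≐refl t) = return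
      (derive proves-≐refl (y ∷ cT t ∷ cT (wkT t) ∷ []) (wkT-complete t , tt))
    proves-complete (≐subst s t φ) = return
      (derive proves-≐subst
        (y ∷ cT s ∷ cT t ∷ cF φ ∷ cF (φ [ s ]) ∷ cF (φ [ t ]) ∷ cT (wkT s) ∷ cT (wkT t) ∷ [])
        (wkT-complete s , wkT-complete t , subForm-complete (inst s) φ , subForm-complete (inst t) φ , tt))
    proves-complete (MP {A = A} {B} d e) = do
      i ← proves-complete d
      j ← proves-complete e
      return (derive proves-MP (y ∷ cF A ∷ cF B ∷ cF (wkF A) ∷ []) (i , j , wkF-complete A , tt))

    refutes-complete : (ψ : Formula 1) → T ⊢ ∃' ψ → (n : ℕ) → T ⊢ ¬' (ψ [ num n ]) →
                       ¬ ¬ I (Refutes y (cF ψ) n)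
    refutes-complete ψ d n e = do
      i ← proves-complete d
      j ← proves-complete e
      return (derive refutes (y ∷ cF ψ ∷ n ∷ cF (wkF ψ) ∷ cT (num {0} n) ∷ cF (ψ [ num n ]) ∷ [])
        (wkF-complete ψ , i , numeral-complete {0} n , subForm-complete (inst (num n)) ψ , j , tt))

-- Soundness of the clauses

data ShapeT {k : ℕ} : ℕ → ℕ → Term k → Set where
  is-var : ∀ {b} (i : Fin k) → toℕ i ≡ b → ShapeT 0 b (var i)
  is-zer : ∀ {b} → ShapeT 1 b zer
  is-S   : ∀ {b} t → cT t ≡ b → ShapeT 2 b (S t)
  is-+   : ∀ {b} t u → cT t ∙ cT u ≡ b → ShapeT 3 b (t +' u)
  is-·   : ∀ {b} t u → cT t ∙ cT u ≡ b → ShapeT 4 b (t ·' u)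

shapeT : {k n b : ℕ} (t : Term k) → cT t ≡ n ∙ b → ShapeT n b t
shapeT (var i) e with ∙-injective e
... | refl , e′ = is-var i e′
shapeT zer e with ∙-injective e
... | refl , e′ = is-zer
shapeT (S t) e with ∙-injective e
... | refl , e′ = is-S t e′
shapeT (t +' u) e with ∙-injective e
... | refl , e′ = is-+ t u e′
shapeT (t ·' u) e with ∙-injective e
... | refl , e′ = is-· t u e′

data ShapeF {k : ℕ} : ℕ → ℕ → Formula k → Set where
  is-≐ : ∀ {b} t u → cT t ∙ cT u ≡ b → ShapeF 0 b (t ≐ u)
  is-≼ : ∀ {b} t u → cT t ∙ cT u ≡ b → ShapeF 1 b (t ≼ u)
  is-⊥ : ∀ {b} → ShapeF 2 b ⊥'
  is-¬ : ∀ {b} φ → cF φ ≡ b → ShapeF 3 b (¬' φ)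
  is-∧ : ∀ {b} φ ψ → cF φ ∙ cF ψ ≡ b → ShapeF 4 b (φ ∧' ψ)
  is-∨ : ∀ {b} φ ψ → cF φ ∙ cF ψ ≡ b → ShapeF 5 b (φ ∨' ψ)
  is-⇒ : ∀ {b} φ ψ → cF φ ∙ cF ψ ≡ b → ShapeF 6 b (φ ⇒' ψ)
  is-∀ : ∀ {b} φ → cF φ ≡ b → ShapeF 7 b (∀' φ)
  is-∃ : ∀ {b} φ → cF φ ≡ b → ShapeF 8 b (∃' φ)

shapeF : {k n b : ℕ} (φ : Formula k) → cF φ ≡ n ∙ b → ShapeF n b φ
shapeF (t ≐ u) e with ∙-injective e
... | refl , e′ = is-≐ t u e′
shapeF (t ≼ u) e with ∙-injective e
... | refl , e′ = is-≼ t u e′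
shapeF ⊥' e with ∙-injective e
... | refl , e′ = is-⊥
shapeF (¬' φ) e with ∙-injective e
... | refl , e′ = is-¬ φ e′
shapeF (φ ∧' ψ) e with ∙-injective e
... | refl , e′ = is-∧ φ ψ e′
shapeF (φ ∨' ψ) e with ∙-injective e
... | refl , e′ = is-∨ φ ψ e′
shapeF (φ ⇒' ψ) e with ∙-injective e
... | refl , e′ = is-⇒ φ ψ e′
shapeF (∀' φ) e with ∙-injective e
... | refl , e′ = is-∀ φ e′
shapeF (∃' φ) e with ∙-injective e
... | refl , e′ = is-∃ φ e′

data ShapeP : {k : ℕ} → ℕ → ℕ → Prog k → Set where
  is-Z    : ∀ {k b} → ShapeP {k} 0 b Z
  is-Succ : ∀ {b} → ShapeP 1 b Succ
  is-Proj : ∀ {k b} (i : Fin k) → k ∙ toℕ i ≡ b → ShapeP 2 b (Proj i)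
  is-Comp : ∀ {k m b} (f : Prog m) (gs : Vec (Prog k) m) → cP f ∙ cPs gs ≡ b → ShapeP 3 b (Comp f gs)
  is-Rec  : ∀ {k b} (g : Prog k) h → cP g ∙ cP h ≡ b → ShapeP 4 b (Rec g h)
  is-Mu   : ∀ {k b} (f : Prog (suc k)) → cP f ≡ b → ShapeP 5 b (Mu f)
  is-Orc  : ∀ {b} → ShapeP 6 b Orc

shapeP : {k n b : ℕ} (e : Prog k) → cP e ≡ n ∙ b → ShapeP n b e
shapeP Z e with ∙-injective e
... | refl , e′ = is-Z
shapeP Succ e with ∙-injective e
... | refl , e′ = is-Succ
shapeP (Proj i) e with ∙-injective e
... | refl , e′ = is-Proj i e′
shapeP (Comp f gs) e with ∙-injective e
... | refl , e′ = is-Comp f gs e′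
shapeP (Rec g h) e with ∙-injective e
... | refl , e′ = is-Rec g h e′
shapeP (Mu f) e with ∙-injective e
... | refl , e′ = is-Mu f e′
shapeP Orc e with ∙-injective e
... | refl , e′ = is-Orc

data ShapeD : {k l : ℕ} → ℕ → ℕ → Desc k l → Set where
  is-weaken : ∀ {k b} → ShapeD {k} 0 b weaken
  is-inst   : ∀ {k b} (t : Term k) → cT t ≡ b → ShapeD 1 b (inst t)
  is-under  : ∀ {k l b} (D : Desc k l) → cD D ≡ b → ShapeD 2 b (under D)

shapeD : {k l n b : ℕ} (D : Desc k l) → cD D ≡ n ∙ b → ShapeD n b D
shapeD weaken e with ∙-injective e
... | refl , e′ = is-weaken
shapeD (inst t) e with ∙-injective e
... | refl , e′ = is-inst t e′
shapeD (under D) e with ∙-injective e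
... | refl , e′ = is-under D e′

cV-∷ : {k x xs : ℕ} (v : Vec ℕ (suc k)) → cV v ≡ suc (x ∙ xs) → head v ≡ x × cV (Data.Vec.tail v) ≡ xs
cV-∷ (x ∷ v) e = ∙-injective (suc-injective e)

cT-injective : {k : ℕ} (t u : Term k) → cT t ≡ cT u → t ≡ u
cT-injective (var i) u e with shapeT u (sym e)
... | is-var j e′ = cong var (sym (toℕ-injective e′))
cT-injective zer u e with shapeT u (sym e)
... | is-zer = refl
cT-injective (S t) u e with shapeT u (sym e)
... | is-S u′ e′ = cong S (cT-injective t u′ (sym e′))
cT-injective (t +' t′) u e with shapeT u (sym e)
... | is-+ u′ u″ e′ with ∙-injective e′
...   | e₁ , e₂ = cong₂ _+'_ (cT-injective t u′ (sym e₁)) (cT-injective t′ u″ (sym e₂))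
cT-injective (t ·' t′) u e with shapeT u (sym e)
... | is-· u′ u″ e′ with ∙-injective e′
...   | e₁ , e₂ = cong₂ _·'_ (cT-injective t u′ (sym e₁)) (cT-injective t′ u″ (sym e₂))

cF-injective : {k : ℕ} (φ ψ : Formula k) → cF φ ≡ cF ψ → φ ≡ ψ
cF-injective (t ≐ t′) ψ e with shapeF ψ (sym e)
... | is-≐ u u′ e′ with ∙-injective e′
...   | e₁ , e₂ = cong₂ _≐_ (cT-injective t u (sym e₁)) (cT-injective t′ u′ (sym e₂))
cF-injective (t ≼ t′) ψ e with shapeF ψ (sym e)
... | is-≼ u u′ e′ with ∙-injective e′
...   | e₁ , e₂ = cong₂ _≼_ (cT-injective t u (sym e₁)) (cT-injective t′ u′ (sym e₂))
cF-injective ⊥' ψ e with shapeF ψ (sym e)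
... | is-⊥ = refl
cF-injective (¬' φ) ψ e with shapeF ψ (sym e)
... | is-¬ ψ′ e′ = cong ¬'_ (cF-injective φ ψ′ (sym e′))
cF-injective (φ ∧' φ′) ψ e with shapeF ψ (sym e)
... | is-∧ ψ′ ψ″ e′ with ∙-injective e′
...   | e₁ , e₂ = cong₂ _∧'_ (cF-injective φ ψ′ (sym e₁)) (cF-injective φ′ ψ″ (sym e₂))
cF-injective (φ ∨' φ′) ψ e with shapeF ψ (sym e)
... | is-∨ ψ′ ψ″ e′ with ∙-injective e′
...   | e₁ , e₂ = cong₂ _∨'_ (cF-injective φ ψ′ (sym e₁)) (cF-injective φ′ ψ″ (sym e₂))
cF-injective (φ ⇒' φ′) ψ e with shapeF ψ (sym e)
... | is-⇒ ψ′ ψ″ e′ with ∙-injective e′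
...   | e₁ , e₂ = cong₂ _⇒'_ (cF-injective φ ψ′ (sym e₁)) (cF-injective φ′ ψ″ (sym e₂))
cF-injective (∀' φ) ψ e with shapeF ψ (sym e)
... | is-∀ ψ′ e′ = cong ∀' (cF-injective φ ψ′ (sym e′))
cF-injective (∃' φ) ψ e with shapeF ψ (sym e)
... | is-∃ ψ′ e′ = cong ∃' (cF-injective φ ψ′ (sym e′))

-- The clauses do not record scopes; a code denotes a term or formula in every large enough scope.
WfT WfF : ℕ → Set
WfT a = Σ ℕ λ K → ∀ k → K ≤ k → Σ (Term k) λ t → cT t ≡ a
WfF a = Σ ℕ λ K → ∀ k → K ≤ k → Σ (Formula k) λ φ → cF φ ≡ a

ValidCode : ℕ → Set
ValidCode z = ∀ k (φ : Formula k) → cF φ ≡ z → Valid φ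

-- A formula in scope k is moved to scope k + K with the same code; the K additional variables are
-- given the value 0.
validCode-from : {z : ℕ} (K : ℕ) → (∀ k → K ≤ k → (φ : Formula k) → cF φ ≡ z → Valid φ) → ValidCode z
validCode-from K h k φ e ρ =
  proj₁ (renF-sem (λ i → cong [ ρ , (λ _ → 0) ] (splitAt-↑ˡ k i K)) φ)
    (h (k + K) (m≤n+m K k) (renF (_↑ˡ K) φ) (trans (cF-renF (λ i → toℕ-↑ˡ i K) φ) e)
      ([ ρ , (λ _ → 0) ] ∘ splitAt k))

validCode-≡ : {k z : ℕ} {φ : Formula k} → Valid φ → cF φ ≡ z → (ψ : Formula k) → cF ψ ≡ z → Valid ψ
validCode-≡ {φ = φ} v e ψ e′ = subst Valid (cF-injective φ ψ (trans e (sym e′))) v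

wfT² : {a b : ℕ} (n : ℕ) (f : ∀ {k} → Term k → Term k → Term k) →
       (∀ {k} (t u : Term k) → cT (f t u) ≡ n ∙ cT t ∙ cT u) → WfT a → WfT b → WfT (n ∙ a ∙ b)
wfT² n f e (K , h) (L , h′) = K ⊔ L , λ k le →
  let t , et = h k (m⊔n≤o⇒m≤o K L le)
      u , eu = h′ k (m⊔n≤o⇒n≤o K L le)
  in f t u , trans (e t u) (cong₂ (λ a b → n ∙ a ∙ b) et eu)

wfFT² : {a b : ℕ} (n : ℕ) (f : ∀ {k} → Term k → Term k → Formula k) →
        (∀ {k} (t u : Term k) → cF (f t u) ≡ n ∙ cT t ∙ cT u) → WfT a → WfT b → WfF (n ∙ a ∙ b)
wfFT² n f e (K , h) (L , h′) = K ⊔ L , λ k le →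
  let t , et = h k (m⊔n≤o⇒m≤o K L le)
      u , eu = h′ k (m⊔n≤o⇒n≤o K L le)
  in f t u , trans (e t u) (cong₂ (λ a b → n ∙ a ∙ b) et eu)

wfF² : {a b : ℕ} (n : ℕ) (f : ∀ {k} → Formula k → Formula k → Formula k) →
       (∀ {k} (φ ψ : Formula k) → cF (f φ ψ) ≡ n ∙ cF φ ∙ cF ψ) → WfF a → WfF b → WfF (n ∙ a ∙ b)
wfF² n f e (K , h) (L , h′) = K ⊔ L , λ k le →
  let t , et = h k (m⊔n≤o⇒m≤o K L le)
      u , eu = h′ k (m⊔n≤o⇒n≤o K L le)
  in f t u , trans (e t u) (cong₂ (λ a b → n ∙ a ∙ b) et eu)

Eval-functional : {A : Oracle} {k : ℕ} {e : Prog k} {xs : Vec ℕ k} {y z : ℕ} →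
                  Eval A e xs y → Eval A e xs z → y ≡ z
EvalV-functional : {A : Oracle} {k m : ℕ} {es : Vec (Prog k) m} {xs : Vec ℕ k} {ys zs : Vec ℕ m} →
                   EvalV A es xs ys → EvalV A es xs zs → ys ≡ zs
Eval-functional eZ eZ = refl
Eval-functional eSucc eSucc = refl
Eval-functional eProj eProj = refl
Eval-functional (eComp ds d) (eComp ds′ d′) with EvalV-functional ds ds′
... | refl = Eval-functional d d′
Eval-functional (eRec0 d) (eRec0 d′) = Eval-functional d d′
Eval-functional (eRecS d₁ d₂) (eRecS d₁′ d₂′) with Eval-functional d₁ d₁′
... | refl = Eval-functional d₂ d₂′
Eval-functional (eMu {y = y} d ds) (eMu {y = y′} d′ ds′) with ≤-<-connex y y′
... | inj₂ y′<y = ⊥-elim (0≢1+n (Eval-functional d′ (proj₂ (ds _ y′<y))))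
... | inj₁ y≤y′ with m≤n⇒m<n∨m≡n y≤y′
...   | inj₁ y<y′ = ⊥-elim (0≢1+n (Eval-functional d (proj₂ (ds′ _ y<y′))))
...   | inj₂ y≡y′ = y≡y′
Eval-functional (eOrc1 a) (eOrc1 a′) = refl
Eval-functional (eOrc1 a) (eOrc0 na) = ⊥-elim (na a)
Eval-functional (eOrc0 na) (eOrc1 a) = ⊥-elim (na a)
Eval-functional (eOrc0 na) (eOrc0 na′) = refl
EvalV-functional []ᵉ []ᵉ = refl
EvalV-functional (d ∷ᵉᵛ ds) (d′ ∷ᵉᵛ ds′) = cong₂ _∷_ (Eval-functional d d′) (EvalV-functional ds ds′)

module Meaning (𝒜 : Oracle) (C₁ : ℕ → Set) (C₀ : ℕ → ℕ → Set) where

  SubT SubF : ℕ → ℕ → ℕ → Set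
  SubT s a b = ∀ k l (D : Desc k l) (t : Term k) → cD D ≡ s → cT t ≡ a → cT (subT (sub D) t) ≡ b
  SubF s a b = ∀ k l (D : Desc k l) (φ : Formula k) → cD D ≡ s → cF φ ≡ a → cF (subF (sub D) φ) ≡ b

  -- Computations, substitutions and derivations are interpreted for every decoding of their
  -- arguments; programs and well-formedness assert that a decoding exists, since some steps have to
  -- start from one. Tag 17 claims preservation of truth rather than `Prov`. `C₁` and `C₀` interpret
  -- tags 2 and 3: trivially while jumps are treated, by ω-consistency and its failure for the final
  -- theory.
  M : Fact → Set
  M (0 ∷ q ∷ _) = ¬ ¬ 𝒜 q
  M (1 ∷ q ∷ _) = ¬ 𝒜 q
  M (2 ∷ y ∷ _) = C₁ y
  M (3 ∷ y ∷ p ∷ _) = C₀ y p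
  M (4 ∷ a ∷ b ∷ c ∷ _) = c ≡ a ∙ b
  M (5 ∷ xs ∷ i ∷ y ∷ _) = ∀ k (v : Vec ℕ k) (j : Fin k) → cV v ≡ xs → toℕ j ≡ i → lookup v j ≡ y
  M (6 ∷ p ∷ xs ∷ y ∷ _) = ∀ k (e : Prog k) (v : Vec ℕ k) → cP e ≡ p → cV v ≡ xs → ¬ ¬ Eval 𝒜 e v y
  M (7 ∷ ps ∷ xs ∷ ys ∷ _) = ∀ k m (es : Vec (Prog k) m) (v : Vec ℕ k) → cPs es ≡ ps → cV v ≡ xs →
    ¬ ¬ Σ (Vec ℕ m) λ w → cV w ≡ ys × EvalV 𝒜 es v w
  M (8 ∷ p ∷ xs ∷ y ∷ _) = ∀ k (e : Prog (suc k)) (v : Vec ℕ k) → cP e ≡ p → cV v ≡ xs →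
    ¬ ¬ ((z : ℕ) → suc z ≤ y → Σ ℕ λ n → Eval 𝒜 e (z ∷ v) (suc n))
  M (9 ∷ k ∷ p ∷ _) = Σ (Prog k) λ e → cP e ≡ p
  M (10 ∷ k ∷ m ∷ ps ∷ _) = Σ (Vec (Prog k) m) λ es → cPs es ≡ ps
  M (11 ∷ m ∷ _) = ¬ ¬ jump 𝒜 m
  M (12 ∷ s ∷ i ∷ u ∷ _) = ∀ k l (D : Desc k l) (j : Fin k) → cD D ≡ s → toℕ j ≡ i → cT (sub D j) ≡ u
  M (13 ∷ s ∷ a ∷ b ∷ _) = WfT a × SubT s a b
  M (14 ∷ s ∷ a ∷ b ∷ _) = WfF a × SubF s a b
  M (15 ∷ n ∷ t ∷ _) = ∀ k → cT (num {k} n) ≡ t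
  M (16 ∷ z ∷ _) = Σ Sentence λ α → QAxiom α × cF α ≡ z
  M (17 ∷ y ∷ z ∷ _) = ∀ (σ : Sentence) → cF σ ≡ y → Valid σ → ValidCode z
  M (18 ∷ y ∷ p ∷ n ∷ _) = ∀ (σ : Sentence) → cF σ ≡ y → Valid σ →
    (Σ ℕ λ k → Σ (Formula (suc k)) λ ψ → cF ψ ≡ p × Valid (∃' ψ)) ×
    (∀ k (ψ : Formula (suc k)) → cF ψ ≡ p → Valid (¬' (ψ [ num n ])))
  M (19 ∷ x ∷ c ∷ p ∷ _) = ∀ (θ : Formula 2) (e : Prog 1) → cF θ ≡ c → cP e ≡ p →
    ¬ ¬ ((Σ Sentence λ α → QAxiom α × cF α ≡ x) ⊎
         Σ ℕ λ y → Eval 𝒜 e (cF (θ [ num c ]) ∷ []) y × (x ≡ y × C₁ y ⊎ x ≡ 3 ∙ y × Σ ℕ (C₀ y)))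
  M _ = ⊤

  qaxiom-sound : ∀ {α} (q : QAxiom α) xs → M ⊨ conclusion (qaxiom q) at xs
  qaxiom-sound {α} q xs = α , q , sym (quoteF-code α xs)

  instantiate-code : ∀ {k} (θ : Fin 3 → Formula k) (xs : Vec ℕ 7) →
                     (∀ i → cF (θ i) ≡ lookup xs (suc (i ↑ˡ 3))) →
                     ∀ s → cF (instantiate θ s) ≡ ⟦ schemaᵐ s ⟧ᵐ xs
  instantiate-code θ xs e (mv i) = e i
  instantiate-code θ xs e ⊥ˢ = refl
  instantiate-code θ xs e (¬ˢ s) = cong (3 ∙_) (instantiate-code θ xs e s)
  instantiate-code θ xs e (s ∧ˢ t) =
    cong₂ (λ a b → 4 ∙ a ∙ b) (instantiate-code θ xs e s) (instantiate-code θ xs e t)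
  instantiate-code θ xs e (s ∨ˢ t) =
    cong₂ (λ a b → 5 ∙ a ∙ b) (instantiate-code θ xs e s) (instantiate-code θ xs e t)
  instantiate-code θ xs e (s ⇒ˢ t) =
    cong₂ (λ a b → 6 ∙ a ∙ b) (instantiate-code θ xs e s) (instantiate-code θ xs e t)

  propositional-sound : ∀ s → (∀ {k} (θ : Fin 3 → Formula k) → Prov (λ _ → ⊥) k (instantiate θ s)) →
                        ∀ xs → M ⊨* premises (propositional s) at xs → M ⊨ conclusion (propositional s) at xs
  propositional-sound s prov xs@(y ∷ a ∷ b ∷ c ∷ _) (((K , f) , _) , ((L , g) , _) , ((N , h) , _) , _) σ _ _ =
    validCode-from (K ⊔ (L ⊔ N)) λ k le →
      let φ , eφ = f k (m⊔n≤o⇒m≤o K _ le)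
          ψ , eψ = g k (m⊔n≤o⇒m≤o L N (m⊔n≤o⇒n≤o K _ le))
          χ , eχ = h k (m⊔n≤o⇒n≤o L N (m⊔n≤o⇒n≤o K _ le))
          θ = lookup (φ ∷ ψ ∷ χ ∷ [])
      in validCode-≡ (sound (λ _ ()) (prov θ))
           (instantiate-code θ xs (λ { 0F → eφ ; 1F → eψ ; 2F → eχ }) s)

  wkF-code : ∀ {k s a b} (φ : Formula k) → s ≡ 0 ∙ 0 → SubF s a b → cF φ ≡ a → cF (wkF φ) ≡ b
  wkF-code φ refl h e = trans (cong cF (sym (wkF≡sub φ))) (h _ _ weaken φ refl e)

  step : ∀ i xs → M ⊨* premises (clauses i) at xs → M ⊨ conclusion (clauses i) at xs
  step lookup-zero (x ∷ xs ∷ []) _ _ (x′ ∷ v) zero e _ = proj₁ (cV-∷ (x′ ∷ v) e)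
  step lookup-suc (x ∷ xs ∷ i ∷ y ∷ []) (h , _) _ (x′ ∷ v) (suc j) e e′ =
    h _ v j (proj₂ (cV-∷ (x′ ∷ v) e)) (suc-injective e′)
  step eval-Z (k ∷ xs ∷ []) _ _ e v ep ev with shapeP e ep
  ... | is-Z = return eZ
  step eval-Succ (x ∷ []) _ _ e v ep ev with shapeP e ep
  step eval-Succ (x ∷ []) _ _ .Succ (x′ ∷ []) ep ev | is-Succ with cV-∷ (x′ ∷ []) ev
  ... | refl , _ = return eSucc
  step eval-Proj (k ∷ i ∷ xs ∷ y ∷ []) (h , _) _ e v ep ev with shapeP e ep
  ... | is-Proj j e′ with ∙-injective e′
  ...   | refl , e″ with h _ v j ev e″
  ...     | refl = return eProj
  step eval-Comp (f ∷ gs ∷ xs ∷ y ∷ ys ∷ []) (hs , h , _) _ e v ep ev with shapeP e ep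
  ... | is-Comp f′ gs′ e′ = do
    (w , ew , ds) ← hs _ _ gs′ v (proj₂ (∙-injective e′)) ev
    d ← h _ f′ w (proj₁ (∙-injective e′)) ew
    return (eComp ds d)
  step eval-Rec0 (g ∷ h ∷ xs ∷ y ∷ []) (ig , _) _ e (x′ ∷ v) ep ev with shapeP e ep
  ... | is-Rec g′ h′ e′ with cV-∷ (x′ ∷ v) ev
  ...   | refl , ev′ = do
    d ← ig _ g′ v (proj₁ (∙-injective e′)) ev′
    return (eRec0 d)
  step eval-RecS (g ∷ h ∷ n ∷ xs ∷ y ∷ r ∷ []) (i , ih , _) _ e (x′ ∷ v) ep ev with shapeP e ep
  ... | is-Rec g′ h′ e′ with cV-∷ (x′ ∷ v) ev
  ...   | refl , ev′ = do
    d ← i _ (Rec g′ h′) (n ∷ v) ep (cong (λ m → suc (n ∙ m)) ev′)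
    d′ ← ih _ h′ (n ∷ r ∷ v) (proj₂ (∙-injective e′)) (cong (λ m → suc (n ∙ suc (r ∙ m))) ev′)
    return (eRecS d d′)
  step eval-Mu (f ∷ xs ∷ y ∷ []) (i , is , _) _ e v ep ev with shapeP e ep
  ... | is-Mu f′ e′ = do
    d ← i _ f′ (y ∷ v) e′ (cong (λ m → suc (y ∙ m)) ev)
    ds ← is _ f′ v e′ ev
    return (eMu d ds)
  step eval-Orc1 (q ∷ _) (h , _) _ e v ep ev with shapeP e ep
  step eval-Orc1 (q ∷ _) (h , _) _ .Orc (q′ ∷ []) ep ev | is-Orc with cV-∷ (q′ ∷ []) ev
  ... | refl , _ = do
    a ← h
    return (eOrc1 a)
  step eval-Orc0 (q ∷ []) (h , _) _ e v ep ev with shapeP e ep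
  step eval-Orc0 (q ∷ []) (h , _) _ .Orc (q′ ∷ []) ep ev | is-Orc with cV-∷ (q′ ∷ []) ev
  ... | refl , _ = return (eOrc0 h)
  step evals-[] (xs ∷ []) _ _ _ [] v ep ev = return ([] , refl , []ᵉ)
  step evals-∷ (g ∷ gs ∷ xs ∷ y ∷ ys ∷ []) (h , hs , _) _ _ (g′ ∷ gs′) v ep ev
    with ∙-injective (suc-injective ep)
  ... | e , es = do
    d ← h _ g′ v e ev
    (w , ew , ds) ← hs _ _ gs′ v es ev
    return (y ∷ w , cong (λ m → suc (y ∙ m)) ew , d ∷ᵉᵛ ds)
  step noZero-zero (f ∷ xs ∷ []) _ _ _ _ _ _ = return λ _ ()
  step noZero-suc (f ∷ xs ∷ y ∷ n ∷ []) (is , i , _) _ e v ep ev = do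
    ds ← is _ e v ep ev
    d ← i _ e (y ∷ v) ep (cong (λ m → suc (y ∙ m)) ev)
    return λ z z≤y → [ ds z , (λ { refl → n , d }) ] (m≤n⇒m<n∨m≡n (≤-pred z≤y))
  step program-Z (k ∷ []) _ = Z , refl
  step program-Succ [] _ = Succ , refl
  step program-Proj (i ∷ j ∷ []) _ = Proj (suc-↑ i j) , cong (λ m → 2 ∙ suc (i + j) ∙ m) (toℕ-suc-↑ i j)
    where
    suc-↑ : ∀ i j → Fin (suc (i + j))
    suc-↑ i j = Data.Fin.fromℕ i ↑ˡ j
    toℕ-suc-↑ : ∀ i j → toℕ (suc-↑ i j) ≡ i
    toℕ-suc-↑ i j = trans (toℕ-↑ˡ (Data.Fin.fromℕ i) j) (Data.Fin.Properties.toℕ-fromℕ i)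
  step program-Comp (k ∷ f ∷ gs ∷ m ∷ []) ((gs′ , es) , (f′ , e) , _) =
    Comp f′ gs′ , cong₂ (λ a b → 3 ∙ a ∙ b) e es
  step program-Rec (k ∷ g ∷ h ∷ []) ((g′ , e) , (h′ , e′) , _) =
    Rec g′ h′ , cong₂ (λ a b → 4 ∙ a ∙ b) e e′
  step program-Mu (k ∷ f ∷ []) ((f′ , e) , _) = Mu f′ , cong (5 ∙_) e
  step program-Orc [] _ = Orc , refl
  step programs-[] (k ∷ []) _ = [] , refl
  step programs-∷ (k ∷ m ∷ g ∷ gs ∷ []) ((g′ , e) , (gs′ , es) , _) =
    g′ ∷ gs′ , cong₂ (λ a b → suc (a ∙ b)) e es
  step halts (m ∷ y ∷ []) ((e , ep) , h , _) = do
    d ← h 1 e (m ∷ []) ep refl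
    return (e , trans (sym (cP≡ e)) ep , y , d)
  step weaken-var (i ∷ []) _ k l D j eD ej with shapeD D eD
  ... | is-weaken = cong (λ i → 0 ∙ suc i) ej
  step inst-zero (t ∷ []) _ k l D j eD ej with shapeD D eD
  step inst-zero (t ∷ []) _ k l .(inst t′) zero eD ej | is-inst t′ e′ = e′
  step inst-suc (t ∷ i ∷ []) _ k l D j eD ej with shapeD D eD
  step inst-suc (t ∷ i ∷ []) _ k l .(inst t′) (suc j) eD ej | is-inst t′ e′ =
    cong (0 ∙_) (suc-injective ej)
  step under-zero (s ∷ []) _ k l D j eD ej with shapeD D eD
  step under-zero (s ∷ []) _ k l .(under D′) zero eD ej | is-under D′ e′ = refl
  step under-suc (s ∷ i ∷ u ∷ u′ ∷ []) (h , (_ , h′) , _) k l D j eD ej with shapeD D eD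
  step under-suc (s ∷ i ∷ u ∷ u′ ∷ []) (h , (_ , h′) , _) k l .(under D′) (suc j) eD ej | is-under D′ e′ =
    trans (cong cT (sym (wkT≡sub (sub D′ j))))
      (h′ _ _ weaken (sub D′ j) refl (h _ _ D′ j e′ (suc-injective ej)))
  step sub-var (s ∷ i ∷ u ∷ []) (h , _) =
    -- The index i is a variable in exactly the scopes above i; the scope bounds of all compound
    -- codes originate here.
    (suc i , λ k i<k → var (Data.Fin.fromℕ< i<k) , cong (0 ∙_) (Data.Fin.Properties.toℕ-fromℕ< i<k)) ,
    λ k l D t eD et → go D t eD (shapeT t et)
    where
    go : ∀ {k l} (D : Desc k l) t → cD D ≡ s → ShapeT 0 i t → cT (subT (sub D) t) ≡ u
    go D _ eD (is-var j e) = h _ _ D j eD e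
  step sub-zer (s ∷ []) _ = (0 , λ k _ → zer , refl) , λ k l D t eD et → go D t (shapeT t et)
    where
    go : ∀ {k l} (D : Desc k l) t → ShapeT 1 0 t → cT (subT (sub D) t) ≡ 1 ∙ 0
    go D _ is-zer = refl
  step sub-S (s ∷ a ∷ b ∷ []) (((K , w) , h) , _) =
    (K , λ k le → S (proj₁ (w k le)) , cong (2 ∙_) (proj₂ (w k le))) ,
    λ k l D t eD et → go D t eD (shapeT t et)
    where
    go : ∀ {k l} (D : Desc k l) t → cD D ≡ s → ShapeT 2 a t → cT (subT (sub D) t) ≡ 2 ∙ b
    go D _ eD (is-S t e) = cong (2 ∙_) (h _ _ D t eD e)
  step sub-+ (s ∷ a ∷ a′ ∷ b ∷ b′ ∷ []) ((w , h) , (w′ , h′) , _) =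
    wfT² 3 _+'_ (λ _ _ → refl) w w′ , λ k l D t eD et → go D t eD (shapeT t et)
    where
    go : ∀ {k l} (D : Desc k l) t → cD D ≡ s → ShapeT 3 (a ∙ a′) t → cT (subT (sub D) t) ≡ 3 ∙ b ∙ b′
    go D _ eD (is-+ t u e) = cong₂ (λ a b → 3 ∙ a ∙ b)
      (h _ _ D t eD (proj₁ (∙-injective e))) (h′ _ _ D u eD (proj₂ (∙-injective e)))
  step sub-· (s ∷ a ∷ a′ ∷ b ∷ b′ ∷ []) ((w , h) , (w′ , h′) , _) =
    wfT² 4 _·'_ (λ _ _ → refl) w w′ , λ k l D t eD et → go D t eD (shapeT t et)
    where
    go : ∀ {k l} (D : Desc k l) t → cD D ≡ s → ShapeT 4 (a ∙ a′) t → cT (subT (sub D) t) ≡ 4 ∙ b ∙ b′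
    go D _ eD (is-· t u e) = cong₂ (λ a b → 4 ∙ a ∙ b)
      (h _ _ D t eD (proj₁ (∙-injective e))) (h′ _ _ D u eD (proj₂ (∙-injective e)))
  step sub-≐ (s ∷ a ∷ a′ ∷ b ∷ b′ ∷ []) ((w , h) , (w′ , h′) , _) =
    wfFT² 0 _≐_ (λ _ _ → refl) w w′ , λ k l D φ eD eφ → go D φ eD (shapeF φ eφ)
    where
    go : ∀ {k l} (D : Desc k l) φ → cD D ≡ s → ShapeF 0 (a ∙ a′) φ → cF (subF (sub D) φ) ≡ 0 ∙ b ∙ b′
    go D _ eD (is-≐ t u e) = cong₂ (λ a b → 0 ∙ a ∙ b)
      (h _ _ D t eD (proj₁ (∙-injective e))) (h′ _ _ D u eD (proj₂ (∙-injective e)))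
  step sub-≼ (s ∷ a ∷ a′ ∷ b ∷ b′ ∷ []) ((w , h) , (w′ , h′) , _) =
    wfFT² 1 _≼_ (λ _ _ → refl) w w′ , λ k l D φ eD eφ → go D φ eD (shapeF φ eφ)
    where
    go : ∀ {k l} (D : Desc k l) φ → cD D ≡ s → ShapeF 1 (a ∙ a′) φ → cF (subF (sub D) φ) ≡ 1 ∙ b ∙ b′
    go D _ eD (is-≼ t u e) = cong₂ (λ a b → 1 ∙ a ∙ b)
      (h _ _ D t eD (proj₁ (∙-injective e))) (h′ _ _ D u eD (proj₂ (∙-injective e)))
  step sub-⊥ (s ∷ []) _ = (0 , λ k _ → ⊥' , refl) , λ k l D φ eD eφ → go D φ (shapeF φ eφ)
    where
    go : ∀ {k l} (D : Desc k l) φ → ShapeF 2 0 φ → cF (subF (sub D) φ) ≡ 2 ∙ 0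
    go D _ is-⊥ = refl
  step sub-¬ (s ∷ a ∷ b ∷ []) (((K , w) , h) , _) =
    (K , λ k le → ¬' proj₁ (w k le) , cong (3 ∙_) (proj₂ (w k le))) ,
    λ k l D φ eD eφ → go D φ eD (shapeF φ eφ)
    where
    go : ∀ {k l} (D : Desc k l) φ → cD D ≡ s → ShapeF 3 a φ → cF (subF (sub D) φ) ≡ 3 ∙ b
    go D _ eD (is-¬ φ e) = cong (3 ∙_) (h _ _ D φ eD e)
  step sub-∧ (s ∷ a ∷ a′ ∷ b ∷ b′ ∷ []) ((w , h) , (w′ , h′) , _) =
    wfF² 4 _∧'_ (λ _ _ → refl) w w′ , λ k l D φ eD eφ → go D φ eD (shapeF φ eφ)
    where
    go : ∀ {k l} (D : Desc k l) φ → cD D ≡ s → ShapeF 4 (a ∙ a′) φ → cF (subF (sub D) φ) ≡ 4 ∙ b ∙ b′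
    go D _ eD (is-∧ φ ψ e) = cong₂ (λ a b → 4 ∙ a ∙ b)
      (h _ _ D φ eD (proj₁ (∙-injective e))) (h′ _ _ D ψ eD (proj₂ (∙-injective e)))
  step sub-∨ (s ∷ a ∷ a′ ∷ b ∷ b′ ∷ []) ((w , h) , (w′ , h′) , _) =
    wfF² 5 _∨'_ (λ _ _ → refl) w w′ , λ k l D φ eD eφ → go D φ eD (shapeF φ eφ)
    where
    go : ∀ {k l} (D : Desc k l) φ → cD D ≡ s → ShapeF 5 (a ∙ a′) φ → cF (subF (sub D) φ) ≡ 5 ∙ b ∙ b′
    go D _ eD (is-∨ φ ψ e) = cong₂ (λ a b → 5 ∙ a ∙ b)
      (h _ _ D φ eD (proj₁ (∙-injective e))) (h′ _ _ D ψ eD (proj₂ (∙-injective e)))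
  step sub-⇒ (s ∷ a ∷ a′ ∷ b ∷ b′ ∷ []) ((w , h) , (w′ , h′) , _) =
    wfF² 6 _⇒'_ (λ _ _ → refl) w w′ , λ k l D φ eD eφ → go D φ eD (shapeF φ eφ)
    where
    go : ∀ {k l} (D : Desc k l) φ → cD D ≡ s → ShapeF 6 (a ∙ a′) φ → cF (subF (sub D) φ) ≡ 6 ∙ b ∙ b′
    go D _ eD (is-⇒ φ ψ e) = cong₂ (λ a b → 6 ∙ a ∙ b)
      (h _ _ D φ eD (proj₁ (∙-injective e))) (h′ _ _ D ψ eD (proj₂ (∙-injective e)))
  step sub-∀ (s ∷ a ∷ b ∷ []) (((K , w) , h) , _) =
    (K , λ k le → let φ , e = w (suc k) (m≤n⇒m≤1+n le) in ∀' φ , cong (7 ∙_) e) ,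
    λ k l D φ eD eφ → go D φ eD (shapeF φ eφ)
    where
    go : ∀ {k l} (D : Desc k l) φ → cD D ≡ s → ShapeF 7 a φ → cF (subF (sub D) φ) ≡ 7 ∙ b
    go D _ eD (is-∀ φ e) = cong (7 ∙_) (h _ _ (under D) φ (cong (2 ∙_) eD) e)
  step sub-∃ (s ∷ a ∷ b ∷ []) (((K , w) , h) , _) =
    (K , λ k le → let φ , e = w (suc k) (m≤n⇒m≤1+n le) in ∃' φ , cong (8 ∙_) e) ,
    λ k l D φ eD eφ → go D φ eD (shapeF φ eφ)
    where
    go : ∀ {k l} (D : Desc k l) φ → cD D ≡ s → ShapeF 8 a φ → cF (subF (sub D) φ) ≡ 8 ∙ b
    go D _ eD (is-∃ φ e) = cong (8 ∙_) (h _ _ (under D) φ (cong (2 ∙_) eD) e)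
  step num-zero [] _ k = refl
  step num-suc (n ∷ t ∷ []) (h , _) k = cong (2 ∙_) (h k)
  step axiom-Q1 xs _ = qaxiom-sound Q1 xs
  step axiom-Q2 xs _ = qaxiom-sound Q2 xs
  step axiom-Q3 xs _ = qaxiom-sound Q3 xs
  step axiom-Q4 xs _ = qaxiom-sound Q4 xs
  step axiom-Q5 xs _ = qaxiom-sound Q5 xs
  step axiom-Q6 xs _ = qaxiom-sound Q6 xs
  step axiom-Q7 xs _ = qaxiom-sound Q7 xs
  step axiom-Q8 xs _ = qaxiom-sound Q8 xs
  step proves-self (y ∷ []) _ σ e v =
    validCode-from 0 λ k _ φ e′ → validCode-≡ {φ = closedF σ}
      (λ ρ → proj₂ (renF-sem (λ ()) σ) (v (λ ()))) (trans (cF-renF (λ ()) σ) e) φ e′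
  step proves-Q (y ∷ z ∷ []) ((α , q , e) , _) σ _ _ =
    validCode-from 0 λ k _ φ e′ → validCode-≡ {φ = closedF α}
      (λ ρ → proj₂ (renF-sem (λ ()) α) (Q-valid α q (λ ()))) (trans (cF-renF (λ ()) α) e) φ e′
  step proves-A1 = propositional-sound schema-A1 λ θ → A1 (θ 0F) (θ 1F)
  step proves-A2 = propositional-sound schema-A2 λ θ → A2 (θ 0F) (θ 1F) (θ 2F)
  step proves-∧E₁ = propositional-sound schema-∧E₁ λ θ → ∧E₁ (θ 0F) (θ 1F)
  step proves-∧E₂ = propositional-sound schema-∧E₂ λ θ → ∧E₂ (θ 0F) (θ 1F)
  step proves-∧I = propositional-sound schema-∧I λ θ → ∧I (θ 0F) (θ 1F)
  step proves-∨I₁ = propositional-sound schema-∨I₁ λ θ → ∨I₁ (θ 0F) (θ 1F)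
  step proves-∨I₂ = propositional-sound schema-∨I₂ λ θ → ∨I₂ (θ 0F) (θ 1F)
  step proves-∨E = propositional-sound schema-∨E λ θ → ∨E (θ 0F) (θ 1F) (θ 2F)
  step proves-⊥E = propositional-sound schema-⊥E λ θ → ⊥E (θ 0F)
  step proves-¬E = propositional-sound schema-¬E λ θ → ¬E (θ 0F)
  step proves-¬I = propositional-sound schema-¬I λ θ → ¬I (θ 0F)
  step proves-DNE = propositional-sound schema-DNE λ θ → DNE (θ 0F)
  step proves-∀E (y ∷ a ∷ t ∷ b ∷ _ ∷ []) (((K , f) , h) , ((L , g) , _) , _) σ _ _ =
    validCode-from (K ⊔ L) λ k le →
      let φ , eφ = f (suc k) (m≤n⇒m≤1+n (m⊔n≤o⇒m≤o K L le))
          u , eu = g k (m⊔n≤o⇒n≤o K L le)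
      in validCode-≡ {φ = ∀' φ ⇒' φ [ u ]} (sound {T = λ _ → ⊥} (λ _ ()) (∀E φ u))
           (cong₂ (λ a b → 6 ∙ (7 ∙ a) ∙ b) eφ (h _ _ (inst u) φ (cong (1 ∙_) eu) eφ))
  step proves-∃I (y ∷ a ∷ t ∷ b ∷ _ ∷ []) (((K , f) , h) , ((L , g) , _) , _) σ _ _ =
    validCode-from (K ⊔ L) λ k le →
      let φ , eφ = f (suc k) (m≤n⇒m≤1+n (m⊔n≤o⇒m≤o K L le))
          u , eu = g k (m⊔n≤o⇒n≤o K L le)
      in validCode-≡ {φ = φ [ u ] ⇒' ∃' φ} (sound {T = λ _ → ⊥} (λ _ ()) (∃I φ u))
           (cong₂ (λ a b → 6 ∙ b ∙ 8 ∙ a) eφ (h _ _ (inst u) φ (cong (1 ∙_) eu) eφ))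
  step proves-∀I (y ∷ _) (((K , f) , h) , ((L , g) , _) , i , _) σ eσ v =
    validCode-from (K ⊔ L) λ k le →
      let ψ , eψ = f k (m⊔n≤o⇒m≤o K L le)
          φ , eφ = g (suc k) (m≤n⇒m≤1+n (m⊔n≤o⇒n≤o K L le))
          d = i σ eσ v (suc k) (wkF ψ ⇒' φ) (cong₂ (λ a b → 6 ∙ a ∙ b) (wkF-code ψ refl h eψ) eφ)
      in validCode-≡ {φ = ψ ⇒' ∀' φ} (λ ρ a n → d (n ∷ᵉ ρ) (proj₂ (wkF-sem ψ) a))
           (cong₂ (λ a b → 6 ∙ a ∙ 7 ∙ b) eψ eφ)
  step proves-∃Elim (y ∷ _) (((K , f) , h) , ((L , g) , _) , i , _) σ eσ v =
    validCode-from (K ⊔ L) λ k le →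
      let ψ , eψ = f k (m⊔n≤o⇒m≤o K L le)
          φ , eφ = g (suc k) (m≤n⇒m≤1+n (m⊔n≤o⇒n≤o K L le))
          d = i σ eσ v (suc k) (φ ⇒' wkF ψ) (cong₂ (λ a b → 6 ∙ b ∙ a) (wkF-code ψ refl h eψ) eφ)
      in validCode-≡ {φ = ∃' φ ⇒' ψ}
           (λ ρ e → stable ψ ρ λ k → e λ n a → k (proj₁ (wkF-sem ψ) (d (n ∷ᵉ ρ) a)))
           (cong₂ (λ a b → 6 ∙ (8 ∙ b) ∙ a) eψ eφ)
  step proves-≐refl (y ∷ t ∷ _) (((K , f) , _) , _) σ _ _ =
    validCode-from K λ k le →
      let u , eu = f k le
      in validCode-≡ {φ = u ≐ u} (λ ρ → refl) (cong (λ a → 0 ∙ a ∙ a) eu)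
  step proves-≐subst (y ∷ _) (((K , f) , _) , ((L , g) , _) , ((N , p) , h) , (_ , h′) , _) σ _ _ =
    validCode-from (K ⊔ (L ⊔ N)) λ k le →
      let s , es = f k (m⊔n≤o⇒m≤o K _ le)
          t , et = g k (m⊔n≤o⇒m≤o L N (m⊔n≤o⇒n≤o K _ le))
          φ , eφ = p (suc k) (m≤n⇒m≤1+n (m⊔n≤o⇒n≤o L N (m⊔n≤o⇒n≤o K _ le)))
      in validCode-≡ {φ = s ≐ t ⇒' (φ [ s ] ⇒' φ [ t ])}
           (sound {T = λ _ → ⊥} (λ _ ()) (≐subst s t φ))
           (cong₂ (λ a b → 6 ∙ a ∙ 6 ∙ b) (cong₂ (λ a b → 0 ∙ a ∙ b) es et)
             (cong₂ _∙_ (h _ _ (inst s) φ (cong (1 ∙_) es) eφ) (h′ _ _ (inst t) φ (cong (1 ∙_) et) eφ)))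
  step proves-MP (y ∷ a ∷ b ∷ _) (i , j , ((K , f) , _) , _) σ eσ v =
    validCode-from K λ k le ψ eψ →
      let φ , eφ = f k le
      in λ ρ → i σ eσ v k (φ ⇒' ψ) (cong₂ (λ a b → 6 ∙ a ∙ b) eφ eψ) ρ (j σ eσ v k φ eφ ρ)
  step refutes (y ∷ p ∷ n ∷ _) (((K , f) , _) , i , e , (_ , h) , j , _) σ eσ v =
    -- The code p is only known to denote formulas in large scopes, so ψ may have parameters besides
    -- the quantified variable.
    (let ψ , eψ = f (suc K) (n≤1+n K) in K , ψ , eψ , i σ eσ v K (∃' ψ) (cong (8 ∙_) eψ)) ,
    λ k ψ eψ → j σ eσ v k (¬' (ψ [ num n ]))
      (cong (3 ∙_) (h _ _ (inst (num n)) ψ (cong (1 ∙_) (e k)) eψ))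
  step axiom-Q (x ∷ _) (h , _) θ e _ _ = return (inj₁ h)
  step axiom-pos (y ∷ c ∷ p ∷ t ∷ d ∷ []) (h , (_ , h′) , i , c₁ , _) θ e eθ ep = do
    ev ← i 1 e (cF (θ [ num c ]) ∷ []) ep
           (cong (λ m → suc (m ∙ 0)) (h′ _ _ (inst (num c)) θ (cong (1 ∙_) (h 1)) eθ))
    return (inj₂ (y , ev , inj₁ (refl , c₁)))
  step axiom-neg (y ∷ c ∷ p ∷ t ∷ d ∷ q ∷ []) (h , (_ , h′) , i , c₀ , _) θ e eθ ep = do
    ev ← i 1 e (cF (θ [ num c ]) ∷ []) ep
           (cong (λ m → suc (m ∙ 0)) (h′ _ _ (inst (num c)) θ (cong (1 ∙_) (h 1)) eθ))
    return (inj₂ (y , ev , inj₂ (refl , q , c₀)))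

  module _ {O : Pred 5} (answers : ∀ f → head f ≤ 3 → O (lookup f) → M f) where

    I-sound : ∀ {f} → Inductive.I (Horn.J clauses O) O f → M f
    I-sound = Horn.horn-induction clauses O M (λ _ _ _ _ → id) (λ _ _ _ _ → id) answers step

-- The diagonal theory

-- O answers the oracle facts with tags 0 (positive, with a witness) and 1 (negative) as A does.
record Answers (A : Oracle) (O : Pred 5) : Set where
  field
    pos-sound    : ∀ {q a b c} → O (lookup (0 ∷ q ∷ a ∷ b ∷ c ∷ [])) → ¬ ¬ A q
    pos-complete : ∀ {q} → A q →
      ¬ ¬ Σ ℕ λ a → Σ ℕ λ b → Σ ℕ λ c → O (lookup (0 ∷ q ∷ a ∷ b ∷ c ∷ []))
    neg-sound    : ∀ {q a b c} → O (lookup (1 ∷ q ∷ a ∷ b ∷ c ∷ [])) → ¬ A q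
    neg-complete : ∀ {q} → ¬ A q → O (lookup (1 ∷ q ∷ 0 ∷ 0 ∷ 0 ∷ []))
    vacuous      : ∀ {r} xs → 2 ≤ r → O (lookup (r ∷ xs))

open Answers

-- Oracle answers for the iterated jump

module _ {A : Oracle} {O : Pred 5} (ans : Answers A O) where

  open Complete O

  private
    module Mng = Meaning A (λ _ → ⊤) (λ _ _ → ⊤)

  answers-sound : ∀ f → head f ≤ 3 → O (lookup f) → Mng.M f
  answers-sound (0 ∷ q ∷ a ∷ b ∷ c ∷ []) _ o = pos-sound ans o
  answers-sound (1 ∷ q ∷ a ∷ b ∷ c ∷ []) _ o = neg-sound ans o
  answers-sound (2 ∷ _ ∷ _) _ _ = tt
  answers-sound (3 ∷ _ ∷ _ ∷ _) _ _ = tt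
  answers-sound (suc (suc (suc (suc _))) ∷ _) (s≤s (s≤s (s≤s ()))) _

  pos-facts : ∀ q → A q → ¬ ¬ Σ ℕ λ a → Σ ℕ λ b → Σ ℕ λ c → I (0 ∷ q ∷ a ∷ b ∷ c ∷ [])
  pos-facts q h = do
    (a , b , c , o) ← pos-complete ans h
    return (a , b , c , base z≤n o)

  neg-facts : ∀ q → ¬ A q → I (1 ∷ q ∷ 0 ∷ 0 ∷ 0 ∷ [])
  neg-facts q h = base (s≤s z≤n) (neg-complete ans h)

module JumpAnswers {A : Oracle} {n : ℕ} {O : Pred 5} (OΠ : Π-Def n O) (ans : Answers A O) where

  open Definability (Horn.J clauses O) OΠ

  -- Membership in the jump asserts that a derivation exists; with N, α, β among the arguments of
  -- the fact it only says that these code one, which is Πₙ. The negative answer quantifies over all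
  -- N, α, β and is Πₙ₊₁. So one jump raises the level by one.
  O⁺ : Pred 5
  O⁺ ρ = (ρ 0F ≡ 0 → Derivation (ρ 2F) (ρ 3F) (ρ 4F) (Halts (ρ 1F)))
       × (ρ 0F ≡ 1 → ∀ N α β → ¬ Derivation N α β (Halts (ρ 1F)))

  O⁺Π : Π-Def (suc n) O⁺
  O⁺Π = ×Π
    (→Π (≐Δ (var 0F) zer) (Π-suc (Π-sub DerivationΠ
      (num 11 ∷ var 1F ∷ zer ∷ zer ∷ zer ∷ var 3F ∷ var 4F ∷ var 2F ∷ []))))
    (→Π (≐Δ (var 0F) (num 1)) (∀Π (∀Π (∀Π (Σ⇒Π (¬Π (Π-sub DerivationΠ
      (num 11 ∷ var 4F ∷ zer ∷ zer ∷ zer ∷ var 1F ∷ var 0F ∷ var 2F ∷ []))))))))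

  halts-sound : ∀ {N α β m} → Derivation N α β (Halts m) → ¬ ¬ jump A m
  halts-sound D k = Derivation-sound D λ i → Meaning.I-sound A _ _ (answers-sound ans) i k

  O⁺-answers : Answers (jump A) O⁺
  O⁺-answers .pos-sound (d , _) = halts-sound (d refl)
  O⁺-answers .pos-complete j = do
    i ← Complete.halts-complete O (pos-facts ans) (neg-facts ans) j
    let (N , α , β , D) = Derivation-complete i
    return (N , α , β , (λ _ → D) , λ ())
  O⁺-answers .neg-sound (_ , nd) j =
    Complete.halts-complete O (pos-facts ans) (neg-facts ans) j λ i →
      let (N , α , β , D) = Derivation-complete i in nd refl N α β D
  O⁺-answers .neg-complete nj = (λ ()) , λ _ N α β D → halts-sound D nj
  O⁺-answers .vacuous xs (s≤s (s≤s _)) = (λ ()) , λ ()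

O₀ : Pred 5
O₀ ρ = ¬ ρ 0F ≡ 0

O₀Π : Π-Def 0 O₀
O₀Π = Δ⇒Π (¬Δ (≐Δ (var 0F) zer))

O₀-answers : Answers (∅^ 0) O₀
O₀-answers .pos-sound o = ⊥-elim (o refl)
O₀-answers .pos-complete ()
O₀-answers .neg-sound _ = id
O₀-answers .neg-complete _ ()
O₀-answers .vacuous _ (s≤s _) ()

∅^-answers : (n : ℕ) → Σ (Pred 5) λ O → Π-Def n O × Answers (∅^ n) O
∅^-answers zero = O₀ , O₀Π , O₀-answers
∅^-answers (suc n) with ∅^-answers n
... | O , OΠ , ans = O⁺ , O⁺Π , O⁺-answers
  where open JumpAnswers OΠ ans

Π-≤ : {m n k : ℕ} {P : Pred k} → m ≤′ n → Π-Def m P → Π-Def n P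
Π-≤ ≤′-refl D = D
Π-≤ (≤′-step le) D = Π-suc (Π-≤ le D)

-- Inconsistent y p: the theory Q + y proves ∃x p(x) and refutes p(j) for all j. No oracle is consulted
-- in provability, so this is Π₂ and its negation for all p is Π₃; here n ≥ 3 is needed.
module Omega where

  open Definability (Horn.J clauses O₀) O₀Π public

  Ref : ℕ → ℕ → ℕ → Set
  Ref y p j = ∃ᶜ λ N → ∃ᶜ λ α → ∃ᶜ λ β → Derivation N α β (Refutes y p j)

  Inconsistent : ℕ → ℕ → Set
  Inconsistent y p = ∀ j → Ref y p j

  Consistentᶜ : ℕ → Set
  Consistentᶜ y = ∀ p → ¬ Inconsistent y p

  InconsistentΠ : Π-Def 2 {2} λ ρ → Inconsistent (ρ 0F) (ρ 1F)
  InconsistentΠ = ∀Π (Σ⇒Π (∃Σ (∃Σ (∃Σ (Π⇒Σ (Π-sub DerivationΠ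
    (num 18 ∷ var 4F ∷ var 5F ∷ var 3F ∷ zer ∷ var 1F ∷ var 0F ∷ var 2F ∷ [])))))))

  ConsistentΠ : Π-Def 3 {1} λ ρ → Consistentᶜ (ρ 0F)
  ConsistentΠ = ∀Π (Σ⇒Π (¬Π (Π-sub InconsistentΠ (var 1F ∷ var 0F ∷ []))))

  open Complete O₀ public

  Ref-complete : ∀ {y p j} → ¬ ¬ I (Refutes y p j) → Ref y p j
  Ref-complete h k = h λ i →
    let (N , α , β , D) = Derivation-complete i in k N λ k → k α λ k → k β D

  private
    module Mng = Meaning (∅^ 0) (λ _ → ⊤) (λ _ _ → ⊤)

  Ref-sound : ∀ {y p j} → Ref y p j → ¬ ¬ Mng.M (Refutes y p j)
  Ref-sound r k = r λ N r → r λ α r → r λ β D → Derivation-sound D λ i →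
    k (Mng.I-sound (answers-sound O₀-answers) i)

  -- Were σ true, ∃x p(x) would have a witness j in ℕ, and the refutation of p(j) derived from σ
  -- would be true as well.
  inconsistent⇒false : ∀ {p} (σ : Sentence) → Inconsistent (cF σ) p → ¬ Valid σ
  -- Every `Refutes` fact includes a proof of ∃x p(x); the instance 0 is an arbitrary choice for
  -- extracting it. The environment `λ _ → 0` gives the possible parameters of p the same values in
  -- both uses.
  inconsistent⇒false σ inc v = Ref-sound (inc 0) λ m →
    let ((k , ψ , e , ∃ψ) , _) = m σ refl v
    in ∃ψ (λ _ → 0) λ j a → Ref-sound (inc j) λ m′ →
         proj₂ (m′ σ refl v) k ψ e (λ _ → 0) (proj₂ ([num]-sem ψ j) a)

open Omega using (Inconsistent; Consistentᶜ)

-- The axiom predicate of the diagonal theory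

module AxiomAnswers {n : ℕ} (3≤n : 3 ≤ n) {A : Oracle} {O : Pred 5} (OΠ : Π-Def n O) (ans : Answers A O) where

  -- By `vacuous` the old answers hold at tags 2 and 3, so each tag is governed by one conjunct.
  -- Failure of ω-consistency is given together with its witness, the second argument, and is thus
  -- Π₂ instead of Σ₃; this keeps all answers Πₙ even for n = 3.
  O* : Pred 5
  O* ρ = O ρ × (ρ 0F ≡ 2 → Consistentᶜ (ρ 1F)) × (ρ 0F ≡ 3 → Inconsistent (ρ 1F) (ρ 2F))

  O*Π : Π-Def n O*
  O*Π = ×Π OΠ (×Π
    (→Π (≐Δ (var 0F) (num 2)) (Π-≤ (≤⇒≤′ 3≤n) (Π-sub Omega.ConsistentΠ (var 1F ∷ []))))
    (→Π (≐Δ (var 0F) (num 3))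
      (Π-≤ (≤⇒≤′ (≤-trans (n≤1+n 2) 3≤n)) (Π-sub Omega.InconsistentΠ (var 1F ∷ var 2F ∷ [])))))

  open Complete O* public
  open Definability (Horn.J clauses O*) O*Π public
  open Meaning A Consistentᶜ Inconsistent public

  O*-sound : ∀ f → head f ≤ 3 → O* (lookup f) → M f
  O*-sound (0 ∷ q ∷ a ∷ b ∷ c ∷ []) _ (o , _) = pos-sound ans o
  O*-sound (1 ∷ q ∷ a ∷ b ∷ c ∷ []) _ (o , _) = neg-sound ans o
  O*-sound (2 ∷ y ∷ _) _ (_ , c₁ , _) = c₁ refl
  O*-sound (3 ∷ y ∷ p ∷ _ ∷ _) _ (_ , _ , c₀) = c₀ refl
  O*-sound (suc (suc (suc (suc _))) ∷ _) (s≤s (s≤s (s≤s ()))) _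

  pos-facts* : ∀ q → A q → ¬ ¬ Σ ℕ λ a → Σ ℕ λ b → Σ ℕ λ c → I (0 ∷ q ∷ a ∷ b ∷ c ∷ [])
  pos-facts* q h = do
    (a , b , c , o) ← pos-complete ans h
    return (a , b , c , base z≤n (o , (λ ()) , λ ()))

  neg-facts* : ∀ q → ¬ A q → I (1 ∷ q ∷ 0 ∷ 0 ∷ 0 ∷ [])
  neg-facts* q h = base (s≤s z≤n) (neg-complete ans h , (λ ()) , λ ())

  consistent-fact : ∀ y → Consistentᶜ y → I (2 ∷ y ∷ 0 ∷ 0 ∷ 0 ∷ [])
  consistent-fact y c = base (s≤s (s≤s z≤n)) (vacuous ans _ ≤-refl , (λ _ → c) , λ ())

  inconsistent-fact : ∀ y p → Inconsistent y p → I (3 ∷ y ∷ p ∷ 0 ∷ 0 ∷ [])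
  inconsistent-fact y p c =
    base (s≤s (s≤s (s≤s z≤n))) (vacuous ans _ (s≤s (s≤s z≤n)) , (λ ()) , λ _ → c)

  IsAxiom : ℕ → ℕ → ℕ → Set
  IsAxiom x c p = ∃ᶜ λ N → ∃ᶜ λ α → ∃ᶜ λ β → Derivation N α β (Axiom x c p)

  -- Variable 0 is the diagonal parameter, the one which `_[_]` instantiates, and variable 1 the
  -- candidate axiom. The code of the program is a constant of the formula, inserted as a numeral.
  axiomΣ : ∀ p → Σ-Def (suc n) {2} λ ρ → IsAxiom (ρ 1F) (ρ 0F) p
  axiomΣ p = conv (λ ρ → subst (λ m → IsAxiom (ρ 1F) (ρ 0F) m) (sem-p ρ) ,
                         subst (λ m → IsAxiom (ρ 1F) (ρ 0F) m) (sym (sem-p ρ)))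
    (Σ-sub {P = λ ρ → IsAxiom (ρ 1F) (ρ 0F) (ρ 2F)} (∃Σ (∃Σ (∃Σ (Π⇒Σ (Π-sub DerivationΠ
      (num 19 ∷ var 4F ∷ var 3F ∷ var 5F ∷ zer ∷ var 1F ∷ var 0F ∷ var 2F ∷ []))))))
      (var 0F ∷ var 1F ∷ num p ∷ []))
    where
    sem-p : (ρ : Env 2) → ⟦ num p ⟧ᵗ ρ ≡ p
    sem-p ρ = num-sem p

  IsAxiom-complete : ∀ {x c p} → ¬ ¬ I (Axiom x c p) → IsAxiom x c p
  IsAxiom-complete h k = h λ i →
    let (N , α , β , D) = Derivation-complete i in k N λ k → k α λ k → k β D

  IsAxiom-sound : ∀ {x c p} → IsAxiom x c p → ¬ ¬ M (Axiom x c p)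
  IsAxiom-sound r k = r λ N r → r λ α r → r λ β D → Derivation-sound D λ i → k (I-sound O*-sound i)

  -- Diagonalization and contradiction

  module Diagonal (f : ℕ → ℕ) (P : Prog 1) (P-computes : ∀ m → Eval A P (m ∷ []) (f m))
                  (θ : Formula 2) (θΣ : IsΣ (suc n) θ)
                  (θ-sem : ⟦ θ ⟧ ≈ λ ρ → IsAxiom (ρ 1F) (ρ 0F) (cP P)) where

    c : ℕ
    c = cF θ

    -- θ at its own code. From c the clauses `axiom-pos` and `axiom-neg` compute the code of this
    -- very formula, and by this Ψ refers to itself.
    Ψ : Formula 1
    Ψ = θ [ num c ]

    ΨΣ : IsΣ (suc n) Ψ
    ΨΣ = IsΣ-sub (single (num c)) θΣ

    y : ℕ
    y = f ⌜ Ψ ⌝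

    T : Theory
    T = T[ Ψ ]

    T⟺ : ∀ α → T α ⟺ IsAxiom (cF α) c (cP P)
    T⟺ α = ⟺-trans ([num]-sem θ c) (⟺-trans (θ-sem _)
      (subst axiom (sym (cF≡ α)) , subst axiom (cF≡ α)))
      where
      axiom : ℕ → Set
      axiom x = IsAxiom x c (cP P)

    T-elim : ∀ α → T α → ¬ ¬ (QAxiom α ⊎ cF α ≡ y × Consistentᶜ y ⊎ cF α ≡ 3 ∙ y × Σ ℕ (Inconsistent y))
    T-elim α t = do
      m ← IsAxiom-sound (proj₁ (T⟺ α) t)
      r ← m θ P refl refl
      return (cases r)
      where
      cases : _ → _
      cases (inj₁ (β , q , e)) = inj₁ (subst QAxiom (cF-injective β α e) q)
      cases (inj₂ (z , ev , r))
        with Eval-functional ev (subst (λ m → Eval A P (m ∷ []) y) (sym (cF≡ Ψ)) (P-computes ⌜ Ψ ⌝))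
      ... | refl = inj₂ r

    T-Q : ∀ α → QAxiom α → T α
    T-Q α q = proj₂ (T⟺ α) (IsAxiom-complete
      (return (derive axiom-Q (cF α ∷ c ∷ cP P ∷ []) (qax-complete q , tt))))

    y-computed : ¬ ¬ I (Evals (cP P) (cV (cF Ψ ∷ [])) y)
    y-computed = subst (λ m → ¬ ¬ I (Evals (cP P) (cV (m ∷ [])) y)) (sym (cF≡ Ψ))
      (eval-complete pos-facts* neg-facts* (P-computes ⌜ Ψ ⌝))

    T-consistent-case : ∀ σ → cF σ ≡ y → Consistentᶜ y → T σ
    T-consistent-case σ e con = proj₂ (T⟺ σ) (IsAxiom-complete do
      i ← y-computed
      return (subst (λ x → I (Axiom x c (cP P))) (sym e)
        (derive axiom-pos (y ∷ c ∷ cP P ∷ cT (num {1} c) ∷ cF Ψ ∷ [])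
          (numeral-complete {1} c , subForm-complete (inst (num c)) θ , i , consistent-fact y con , tt))))

    T-inconsistent-case : ∀ σ → cF σ ≡ y → ∀ p → Inconsistent y p → T (¬' σ)
    T-inconsistent-case σ e p inc = proj₂ (T⟺ (¬' σ)) (IsAxiom-complete do
      i ← y-computed
      return (subst (λ x → I (Axiom (3 ∙ x) c (cP P))) (sym e)
        (derive axiom-neg (y ∷ c ∷ cP P ∷ cT (num {1} c) ∷ cF Ψ ∷ p ∷ [])
          (numeral-complete {1} c , subForm-complete (inst (num c)) θ , i , inconsistent-fact y p inc , tt))))

    T-⊢ : ∀ α → T α → T ⊢ α
    -- `ax` proves `closedF α`, which has the same code as α and hence equals it.
    T-⊢ α t = subst (Prov T 0) (cF-injective (closedF α) α (cF-renF (λ ()) α)) (ax t)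

    -- That y codes a sentence becomes known only after this has been shown, so both cases work with
    -- the bare number y. In the first, a failure of n-consistency becomes a family of facts
    -- `Refutes y`, contradicting ω-consistency of y; in the second, an axiom of T outside Q must be
    -- the negation of a sentence with code y, and that sentence is false.
    T-consistent : n Consistent T
    T-consistent w@(ψ , _ , d , e) = excluded-middle (Consistentᶜ y) λ
      { (inj₁ con) → con (cF ψ) λ j →
          Omega.Ref-complete (Omega.refutes-complete y (axioms con) ψ d j (e j))
      ; (inj₂ ncon) → sound-consistent n (true ncon) w }
      where
      axioms : Consistentᶜ y → ∀ α → T α → ¬ ¬ Omega.I (Proves y (cF α))
      axioms con α t = do
        inj₁ q ← T-elim α t
          where
          inj₂ (inj₁ (e , _)) → return (subst (λ z → Omega.I (Proves y z)) (sym e)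
                                  (Omega.derive proves-self (y ∷ []) tt))
          inj₂ (inj₂ (_ , p , inc)) → ⊥-elim (con p inc)
        return (Omega.derive proves-Q (y ∷ cF α ∷ []) (Omega.qax-complete q , tt))
      true : ¬ Consistentᶜ y → ∀ α → T α → Valid α
      true ncon α t ρ = stable α ρ λ k → T-elim α t λ
        { (inj₁ q) → k (Q-valid α q ρ)
        ; (inj₂ (inj₁ (_ , con))) → ncon con
        ; (inj₂ (inj₂ (e , p , inc))) → k (negation (shapeF α e) inc) }
        where
        negation : ∀ {α p} → ShapeF 3 y α → Inconsistent y p → ⟦ α ⟧ ρ
        negation {p = p} (is-¬ β e) inc b =
          Omega.inconsistent⇒false β (subst (λ z → Inconsistent z p) (sym e) inc) λ ρ′ → proj₁ (⟦⟧-cong (λ ()) β) b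

    decided : ∀ σ → y ≡ ⌜ σ ⌝ → ¬ (T ⊢ σ) → ¬ (T ⊢ ¬' σ) → ⊥
    decided σ e ⊬σ ⊬¬σ = excluded-middle (Consistentᶜ y) λ
      { (inj₁ con) → ⊬σ (T-⊢ σ (T-consistent-case σ eσ con))
      ; (inj₂ ncon) → ncon λ p inc → ⊬¬σ (T-⊢ (¬' σ) (T-inconsistent-case σ eσ p inc)) }
      where
      eσ : cF σ ≡ y
      eσ = trans (cF≡ σ) (sym e)

    contradiction : ¬ FindsIndependent n f
    contradiction find =
      let σ , _ , e , ⊬σ , ⊬¬σ = find Ψ ΨΣ (λ α q → T-⊢ α (T-Q α q)) T-consistent
      in decided σ e ⊬σ ⊬¬σ

theorem3p5 : (n : ℕ) → 3 ≤ n → (f : ℕ → ℕ) → RecursiveIn (∅^ n) f → ¬ FindsIndependent n f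
theorem3p5 n 3≤n f (P , P-computes) =
  Diagonal.contradiction f P P-computes (formula D) (class D) (sem D)
  where
  O-answers = ∅^-answers n
  open AxiomAnswers 3≤n (proj₁ (proj₂ O-answers)) (proj₂ (proj₂ O-answers))
  D = axiomΣ (cP P)
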